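{- For every odd integer $n\ge 9$, $R(W_n,W_n)\le 4n+\min\{(n-9)/2,\ 660\}$.
   Context: For graphs $G_1,G_2$, the Ramsey number $R(G_1,G_2)$ is the smallest positive integer $N$ such that every red-blue edge-coloring of $K_N$ contains a red copy of $G_1$ or a blue copy of $G_2$. The wheel $W_n$ is the graph on $n$ vertices obtained by adding a new vertex adjacent to every vertex of the cycle $C_{n-1}$. -}

module Defs where

open import Data.Nat using (ℕ; zero; suc; _+_; _≤_; _∸_)
open import Data.Fin using (Fin; toℕ)
open import Data.Bool using (Bool; true; false)
open import Data.Product using (Σ; _×_; ∃-syntax)
open import Data.Sum using (_⊎_)
open import Relation.Binary.PropositionalEquality using (_≡_; _≢_)
open import Function.Definitions using (Injective)

record Graph (n : ℕ) : Set₁ where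
  field
    Adj : Fin n → Fin n → Set

open Graph public

-- A red-blue edge-colouring of K_N: a colour for every pair of vertices,
-- symmetric; only pairs of distinct vertices matter.
-- Convention: true = red, false = blue.
record Colouring (N : ℕ) : Set where
  field
    col : Fin N → Fin N → Bool
    sym : ∀ x y → col x y ≡ col y x

open Colouring public

red blue : Bool
red = true
blue = false

MonoCopy : {n N : ℕ} → Graph n → Colouring N → Bool → Set
MonoCopy {n} {N} G c b =
  Σ (Fin n → Fin N) λ f →
    Injective _≡_ _≡_ f × (∀ u v → Adj G u v → col c (f u) (f v) ≡ b)

RamseyProperty : {n₁ n₂ : ℕ} → Graph n₁ → Graph n₂ → ℕ → Set
RamseyProperty G₁ G₂ N =
  (c : Colouring N) → MonoCopy G₁ c red ⊎ MonoCopy G₂ c blue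

-- R(G₁,G₂) ≤ M : the least positive N with the Ramsey property is ≤ M,
-- i.e. some positive N ≤ M has the Ramsey property.
RamseyLE : {n₁ n₂ : ℕ} → Graph n₁ → Graph n₂ → ℕ → Set
RamseyLE G₁ G₂ M = ∃[ N ] (1 ≤ N × N ≤ M × RamseyProperty G₁ G₂ N)

CycAdj : ℕ → ℕ → ℕ → Set
CycAdj m a b = (b ≡ suc a) ⊎ (a ≡ suc b) ⊎ (a ≡ 1 × b ≡ m) ⊎ (a ≡ m × b ≡ 1)

WheelAdj : (n : ℕ) → Fin n → Fin n → Set
WheelAdj n u v =
  (toℕ u ≡ 0 × toℕ v ≢ 0) ⊎ (toℕ u ≢ 0 × toℕ v ≡ 0)
  ⊎ (toℕ u ≢ 0 × toℕ v ≢ 0 × CycAdj (n ∸ 1) (toℕ u) (toℕ v))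

Wheel : (n : ℕ) → Graph n
Wheel n = record { Adj = WheelAdj n }

{-# OPTIONS --safe #-}
module Submission where

-- Put n = 2p + 3 and m = n − 1 = 2p + 2, and suppose that a colouring of the complete graph on D + 1 vertices has no
-- monochromatic wheel: no vertex has a monochromatic cycle of length m inside its neighbourhood of the same colour.
-- Counting triangles as Goodman does, some vertex with r red and b blue neighbours has
-- 2e(red in red neighbourhood) + 2e(blue in blue neighbourhood) ≥ D(D − 1) − 3rb, so it suffices to bound the number of
-- edges of a graph on x vertices without a cycle of length m. Take a longest cycle C, of length ℓ.
-- * At most ℓ(x − ℓ)/2 edges are not inside C: contract the first edge of a longest path through the outside that joins
--   two vertices of C, or shrink C to a point if there is no such path.
-- * If ℓ > m, let ρ(w) count the chords of C spanning w steps. A pattern of chords which closes up to a cycle of length m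
--   cannot occur in any rotated position, so averaging over the rotations gives linear inequalities between the ρ(w).
--   They bound the average degree on C by about ℓ/2 − p/10, unless ℓ is so short that 2e(C) ≤ ℓ²/2 suffices.
-- For p ≥ 17 the claim becomes a polynomial inequality. For 3 ≤ p ≤ 16 it is evaluated, where for p ≤ 8 the bounds
-- for the average degree come from linear-programming certificates.

open import Defs hiding (sym)
open import Data.Nat
open import Data.Nat.Properties
open import Data.Nat.DivMod using (_%_; m≡m%n+[m/n]*n; m%n<n; [m+n]%n≡m%n; [m+kn]%n≡m%n; m<n⇒m%n≡m; m*n%n≡0; m*n/n≡m; m/n≤m; /-monoˡ-≤)
open import Data.Nat.Divisibility using (_∣_; divides)
open import Data.Nat.ListAction using (sum)
open import Data.Nat.ListAction.Properties using (sum-++)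
open import Data.Nat.Tactic.RingSolver using (solve-∀)
open import Data.Bool using (Bool; true; false; _∧_; _∨_; not; if_then_else_; T)
import Data.Bool as Bool
open import Data.Bool.ListAction using (all)
open import Data.Bool.Properties using (T-≡)
open import Data.Maybe using (Maybe; just; nothing)
open import Data.Fin using (Fin; toℕ)
import Data.Fin.Properties as FP
open import Data.Vec as Vec using (Vec; []; _∷_)
open import Data.Vec.Properties using (lookup∘tabulate)
open import Data.List using (List; []; _∷_; _++_; length; map; reverse; [_]; replicate; allFin; filterᵇ)
open import Data.List.Properties using (++-assoc; ++-identityʳ; length-++; unfold-reverse; length-replicate; length-map; length-tabulate; map-++)
open import Data.List.Membership.Propositional using (_∈_; _∉_)
open import Data.List.Membership.Propositional.Properties using (∈-∃++; ∈-++⁺ˡ; ∈-++⁺ʳ; ∈-++⁻; ∈-map⁻; ∈-allFin; ∈-filter⁻)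
open import Data.List.Relation.Unary.Any using (here; there)
open import Data.List.Relation.Unary.All as All using (All; []; _∷_)
open import Data.List.Relation.Unary.All.Properties using (++⁺; replicate⁺)
open import Data.List.Relation.Unary.AllPairs using (AllPairs; []; _∷_)
open import Data.List.Relation.Unary.Unique.Propositional using (Unique)
open import Data.List.Relation.Unary.Unique.Propositional.Properties using (allFin⁺; filter⁺)
open import Data.List.Relation.Binary.Permutation.Propositional as Perm using (_↭_; prep; swap; ↭-sym; ↭-refl; ↭-trans; ↭-reflexive)
open import Data.List.Relation.Binary.Permutation.Propositional.Properties using (∈-resp-↭; ↭-length; shift; ++⁺ˡ; ++-comm; ↭-reverse)
open import Data.Product using (Σ; ∃; ∃-syntax; _×_; _,_; proj₁; proj₂)
open import Data.Sum using (_⊎_; inj₁; inj₂)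
open import Data.Empty using (⊥; ⊥-elim)
open import Data.Unit using (⊤; tt)
open import Relation.Nullary using (¬_; Dec; yes; no)
open import Relation.Nullary.Decidable using (does; decidable-stable; map′; _×-dec_; _⊎-dec_; _→-dec_; ¬?; T?)
open import Relation.Binary.Definitions using (DecidableEquality; Tri; tri<; tri≈; tri>)
open import Relation.Binary.PropositionalEquality using (_≡_; _≢_; refl; sym; trans; cong; cong₂; subst; module ≡-Reasoning)
open import Function using (_∘_; id; case_of_)
open import Function.Bundles using (Equivalence)
open import Function.Definitions using (Injective)

-- Longest cycles and longest ears exist here only up to double negation: `em` and `¬¬-max` supply
-- them, and `decidable-stable` removes the negations where the conclusion is a comparison of
-- numbers. The saving p/10 comes from ℓ = 4p + 1 + g. One combination of the chord inequalities
-- puts six times the average degree about (p + g)/2 below 3ℓ, another about p - 2g below it. The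
-- better of the two is worst near g = p/5, where both give 3p/5. For ℓ below about 17p/5 the
-- combinations may save too little, but then so many vertices lie outside the cycle that ℓ²/2 is
-- affordable. Here D = 8p + 11 + s with s = min(p - 3, 660). Two neighbourhoods of at least 4p + 4
-- vertices each are always compatible with Goodman's count. The excess s is spent where one of them
-- has at most 4p + 3 vertices: then an average degree up to m - 1 has to be allowed on that side
-- while the other side may be dense.

em : (P : Set) → ¬ ¬ (P ⊎ ¬ P)
em P k = k (inj₂ (λ p → k (inj₁ p)))

-- Every improvement of the witness uses up part of its distance to `B`, so the fuel `f` suffices.
¬¬-max : (P : ℕ → Set) (B : ℕ) → (∀ n → P n → n ≤ B) → ∀ n → P n →
         ¬ ¬ (∃[ k ] (P k × (∀ j → P j → j ≤ k)))
¬¬-max P B bd n pn = go B n pn (m≤n+m B n)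
  where
  go : ∀ f n → P n → B ≤ n + f → ¬ ¬ (∃[ k ] (P k × (∀ j → P j → j ≤ k)))
  go zero n pn B≤ k = k (n , pn , λ j pj → ≤-trans (bd j pj) (≤-trans B≤ (≤-reflexive (+-identityʳ n))))
  go (suc f) n pn B≤ k = em (∃[ j ] (P j × n < j)) λ where
    (inj₁ (j , pj , n<j)) → go f j pj (≤-trans B≤ (≤-trans (≤-reflexive (+-suc n f)) (+-monoˡ-≤ f n<j))) k
    (inj₂ none) → k (n , pn , λ j pj → ≮⇒≥ (λ n<j → none (j , pj , n<j)))

-- Finite sums and lists without repetition.

sum-ones : ∀ k → sum (replicate k 1) ≡ k
sum-ones zero = refl
sum-ones (suc k) = cong suc (sum-ones k)

⟦_⟧ : Bool → ℕ
⟦ true ⟧ = 1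
⟦ false ⟧ = 0

⟦⟧≤1 : ∀ b → ⟦ b ⟧ ≤ 1
⟦⟧≤1 true = ≤-refl
⟦⟧≤1 false = z≤n

∑ : {X : Set} → List X → (X → ℕ) → ℕ
∑ [] f = 0
∑ (x ∷ xs) f = f x + ∑ xs f

module _ {X : Set} where

  ∑-cong : ∀ (xs : List X) {f g} → (∀ {x} → x ∈ xs → f x ≡ g x) → ∑ xs f ≡ ∑ xs g
  ∑-cong [] h = refl
  ∑-cong (x ∷ xs) h = cong₂ _+_ (h (here refl)) (∑-cong xs (h ∘ there))

  ∑-mono : ∀ (xs : List X) {f g} → (∀ {x} → x ∈ xs → f x ≤ g x) → ∑ xs f ≤ ∑ xs g
  ∑-mono [] h = z≤n
  ∑-mono (x ∷ xs) h = +-mono-≤ (h (here refl)) (∑-mono xs (h ∘ there))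

  ∑-++ : ∀ (xs ys : List X) f → ∑ (xs ++ ys) f ≡ ∑ xs f + ∑ ys f
  ∑-++ [] ys f = refl
  ∑-++ (x ∷ xs) ys f rewrite ∑-++ xs ys f = sym (+-assoc (f x) _ _)

  ∑-↭ : ∀ {xs ys : List X} f → xs ↭ ys → ∑ xs f ≡ ∑ ys f
  ∑-↭ f Perm.refl = refl
  ∑-↭ f (prep x p) = cong (f x +_) (∑-↭ f p)
  ∑-↭ f (swap x y p) rewrite ∑-↭ f p = lem (f x) (f y) _
    where lem : ∀ a b c → a + (b + c) ≡ b + (a + c)
          lem = solve-∀
  ∑-↭ f (Perm.trans p q) = trans (∑-↭ f p) (∑-↭ f q)

  ∑-+ : ∀ (xs : List X) f g → ∑ xs (λ x → f x + g x) ≡ ∑ xs f + ∑ xs g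
  ∑-+ [] f g = refl
  ∑-+ (x ∷ xs) f g rewrite ∑-+ xs f g = lem (f x) (g x) _ _
    where lem : ∀ a b c d → (a + b) + (c + d) ≡ (a + c) + (b + d)
          lem = solve-∀

  ∑-const : ∀ (xs : List X) c → ∑ xs (λ _ → c) ≡ length xs * c
  ∑-const [] c = refl
  ∑-const (x ∷ xs) c = cong (c +_) (∑-const xs c)

  ∑-bound : ∀ (xs : List X) {f} c → (∀ {x} → x ∈ xs → f x ≤ c) → ∑ xs f ≤ length xs * c
  ∑-bound xs c h = ≤-trans (∑-mono xs h) (≤-reflexive (∑-const xs c))

  ∑-zero : ∀ (xs : List X) {f} → (∀ {x} → x ∈ xs → f x ≡ 0) → ∑ xs f ≡ 0
  ∑-zero xs h = trans (∑-cong xs h) (trans (∑-const xs 0) (*-zeroʳ (length xs)))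

∑-swap : ∀ {X Y : Set} (xs : List X) (ys : List Y) (f : X → Y → ℕ) →
         ∑ xs (λ x → ∑ ys (f x)) ≡ ∑ ys (λ y → ∑ xs (λ x → f x y))
∑-swap [] ys f = sym (∑-zero ys (λ _ → refl))
∑-swap (x ∷ xs) ys f rewrite ∑-swap xs ys f = sym (∑-+ ys (f x) (λ y → ∑ xs (λ z → f z y)))

module _ {X : Set} where

  ∉-head : ∀ {x : X} {xs} → Unique (x ∷ xs) → x ∉ xs
  ∉-head (px ∷ _) x∈ = All.lookup px x∈ refl

  Unique-tail : ∀ {x : X} {xs} → Unique (x ∷ xs) → Unique xs
  Unique-tail (_ ∷ u) = u

  Unique-cons : ∀ {x : X} {xs} → x ∉ xs → Unique xs → Unique (x ∷ xs)
  Unique-cons x∉ u = All.tabulate (λ y∈ x≡y → x∉ (subst (_∈ _) (sym x≡y) y∈)) ∷ u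

  Unique-↭ : ∀ {xs ys : List X} → xs ↭ ys → Unique xs → Unique ys
  Unique-↭ Perm.refl u = u
  Unique-↭ (prep x p) u =
    Unique-cons (∉-head u ∘ ∈-resp-↭ (↭-sym p)) (Unique-↭ p (Unique-tail u))
  Unique-↭ (swap x y p) u =
    Unique-cons (λ { (here y≡x) → ∉-head u (here (sym y≡x)) ; (there y∈) → ∉-head (Unique-tail u) (∈-resp-↭ (↭-sym p) y∈) })
      (Unique-cons (λ x∈ → ∉-head u (there (∈-resp-↭ (↭-sym p) x∈))) (Unique-↭ p (Unique-tail (Unique-tail u))))
  Unique-↭ (Perm.trans p q) u = Unique-↭ q (Unique-↭ p u)

  Unique-++ˡ : ∀ (xs : List X) {ys} → Unique (xs ++ ys) → Unique xs
  Unique-++ˡ [] u = []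
  Unique-++ˡ (x ∷ xs) u = Unique-cons (∉-head u ∘ ∈-++⁺ˡ) (Unique-++ˡ xs (Unique-tail u))

  Unique-++ʳ : ∀ (xs : List X) {ys} → Unique (xs ++ ys) → Unique ys
  Unique-++ʳ [] u = u
  Unique-++ʳ (x ∷ xs) u = Unique-++ʳ xs (Unique-tail u)

  Unique-disj : ∀ (xs : List X) {ys x} → Unique (xs ++ ys) → x ∈ xs → x ∉ ys
  Unique-disj (x ∷ xs) u (here refl) x∈ = ∉-head u (∈-++⁺ʳ xs x∈)
  Unique-disj (x ∷ xs) u (there p) x∈ = Unique-disj xs (Unique-tail u) p x∈

  Unique-join : ∀ (xs : List X) {ys} → Unique xs → Unique ys → (∀ {x} → x ∈ xs → x ∉ ys) → Unique (xs ++ ys)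
  Unique-join [] u v d = v
  Unique-join (x ∷ xs) u v d =
    Unique-cons (λ x∈ → case ∈-++⁻ xs x∈ of λ { (inj₁ p) → ∉-head u p ; (inj₂ q) → d (here refl) q })
      (Unique-join xs (Unique-tail u) v (d ∘ there))

  ∈-↭ : ∀ {x : X} {xs} → x ∈ xs → ∃[ ys ] xs ↭ x ∷ ys
  ∈-↭ {x} x∈ with ys , zs , refl ← ∈-∃++ x∈ = ys ++ zs , shift x ys zs

  ⊆-length : ∀ (xs : List X) {ys} → Unique xs → (∀ {x} → x ∈ xs → x ∈ ys) → length xs ≤ length ys
  ⊆-length [] u s = z≤n
  ⊆-length (x ∷ xs) u s with zs , p ← ∈-↭ (s (here refl)) =
    ≤-trans (s≤s (⊆-length xs (Unique-tail u) sub)) (≤-reflexive (sym (↭-length p)))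
    where
    sub : ∀ {y} → y ∈ xs → y ∈ zs
    sub y∈ with ∈-resp-↭ p (s (there y∈))
    ... | here refl = ⊥-elim (∉-head u y∈)
    ... | there q = q

  ⊆-↭ : ∀ (xs : List X) {ys} → Unique xs → (∀ {x} → x ∈ xs → x ∈ ys) → ∃[ zs ] ys ↭ xs ++ zs
  ⊆-↭ [] {ys} u s = ys , ↭-refl
  ⊆-↭ (x ∷ xs) u s with zs , p ← ∈-↭ (s (here refl)) =
    let ws , q = ⊆-↭ xs (Unique-tail u) sub in ws , ↭-trans p (prep x q)
    where
    sub : ∀ {y} → y ∈ xs → y ∈ zs
    sub y∈ with ∈-resp-↭ p (s (there y∈))
    ... | here refl = ⊥-elim (∉-head u y∈)
    ... | there q = q

  count-⊆ : ∀ (xs : List X) {ys} (b : X → Bool) → Unique xs → (∀ {x} → x ∈ xs → b x ≡ true → x ∈ ys) →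
            ∑ xs (⟦_⟧ ∘ b) ≤ length ys
  count-⊆ [] b u s = z≤n
  count-⊆ (x ∷ xs) {ys} b u s with b x in bx
  ... | false = count-⊆ xs b (Unique-tail u) (s ∘ there)
  ... | true with zs , p ← ∈-↭ (s (here refl) bx) =
    ≤-trans (s≤s (count-⊆ xs b (Unique-tail u) sub)) (≤-reflexive (sym (↭-length p)))
    where
    sub : ∀ {y} → y ∈ xs → b y ≡ true → y ∈ zs
    sub y∈ by with ∈-resp-↭ p (s (there y∈) by)
    ... | here refl = ⊥-elim (∉-head u y∈)
    ... | there q = q

  -- Cut into consecutive pairs, the list has at most one hit per pair; an odd entry left over
  -- accounts for `suc`.
  sparse-count : ∀ (b : X → Bool) (R : List X) →
    (∀ P y y′ S → R ≡ P ++ y ∷ y′ ∷ S → b y ≡ true → b y′ ≡ true → ⊥) →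
    2 * ∑ R (⟦_⟧ ∘ b) ≤ suc (length R)
  sparse-count b [] h = z≤n
  sparse-count b (x ∷ []) h = *-monoʳ-≤ 2 (≤-trans (≤-reflexive (+-identityʳ _)) (⟦⟧≤1 (b x)))
  sparse-count b (x ∷ y ∷ R) h = go (b x) (b y) refl refl
      (sparse-count b (y ∷ R) (λ P u v S eq → h (x ∷ P) u v S (cong (x ∷_) eq)))
      (sparse-count b R (λ P u v S eq → h (x ∷ y ∷ P) u v S (cong (λ l → x ∷ y ∷ l) eq)))
    where
    lem : ∀ a → 2 * (1 + (0 + a)) ≡ 2 + 2 * a
    lem = solve-∀
    go : ∀ p q → b x ≡ p → b y ≡ q → 2 * (⟦ b y ⟧ + ∑ R (⟦_⟧ ∘ b)) ≤ suc (suc (length R)) →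
         2 * ∑ R (⟦_⟧ ∘ b) ≤ suc (length R) →
         2 * (⟦ b x ⟧ + (⟦ b y ⟧ + ∑ R (⟦_⟧ ∘ b))) ≤ suc (suc (suc (length R)))
    go true true bx by _ _ = ⊥-elim (h [] x y R refl bx by)
    go false _ bx by r _ rewrite bx = ≤-trans r (n≤1+n _)
    go true false bx by _ r rewrite bx | by = ≤-trans (≤-reflexive (lem _)) (s≤s (s≤s r))

split-at-≥ : ∀ {X : Set} n (xs : List X) → n ≤ length xs → ∃[ ys ] ∃[ zs ] (xs ≡ ys ++ zs × length ys ≡ n)
split-at-≥ zero xs h = [] , xs , refl , refl
split-at-≥ (suc n) (x ∷ xs) (s≤s h) = let ys , zs , e , l = split-at-≥ n xs h in x ∷ ys , zs , cong (x ∷_) e , cong suc l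

split-end : ∀ {X : Set} n (xs : List X) → n ≤ length xs → ∃[ ys ] ∃[ zs ] (xs ≡ ys ++ zs × length zs ≡ n)
split-end n xs h =
  let ys , zs , e , l = split-at-≥ (length xs ∸ n) xs (m∸n≤m (length xs) n) in
  ys , zs , e , +-cancelˡ-≡ (length ys) _ _ (trans (sym (length-++ ys)) (trans (sym (cong length e))
    (trans (sym (m∸n+n≡m h)) (cong (_+ n) (sym l)))))

∨-true : ∀ x y → x ∨ y ≡ true → x ≡ true ⊎ y ≡ true
∨-true true y e = inj₁ refl
∨-true false y e = inj₂ e

⟦∨⟧ : ∀ x y → ⟦ x ∨ y ⟧ + ⟦ x ∧ y ⟧ ≡ ⟦ x ⟧ + ⟦ y ⟧
⟦∨⟧ true true = refl
⟦∨⟧ true false = refl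
⟦∨⟧ false y = +-identityʳ _

sumTo : ℕ → (ℕ → ℕ) → ℕ
sumTo zero f = 0
sumTo (suc n) f = f 0 + sumTo n (f ∘ suc)

sumTo-cong : ∀ n {f g} → (∀ i → i < n → f i ≡ g i) → sumTo n f ≡ sumTo n g
sumTo-cong zero h = refl
sumTo-cong (suc n) h = cong₂ _+_ (h 0 z<s) (sumTo-cong n (λ i i< → h (suc i) (s<s i<)))

sumTo-mono : ∀ n {f g} → (∀ i → i < n → f i ≤ g i) → sumTo n f ≤ sumTo n g
sumTo-mono zero h = z≤n
sumTo-mono (suc n) h = +-mono-≤ (h 0 z<s) (sumTo-mono n (λ i i< → h (suc i) (s<s i<)))

sumTo-+ : ∀ n f g → sumTo n (λ i → f i + g i) ≡ sumTo n f + sumTo n g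
sumTo-+ zero f g = refl
sumTo-+ (suc n) f g rewrite sumTo-+ n (f ∘ suc) (g ∘ suc) = lem (f 0) (g 0) _ _
  where lem : ∀ a b c d → (a + b) + (c + d) ≡ (a + c) + (b + d)
        lem = solve-∀

sumTo-const : ∀ n c → sumTo n (λ _ → c) ≡ n * c
sumTo-const zero c = refl
sumTo-const (suc n) c = cong (c +_) (sumTo-const n c)

sumTo-bound : ∀ n {f} c → (∀ i → i < n → f i ≤ c) → sumTo n f ≤ n * c
sumTo-bound n c h = ≤-trans (sumTo-mono n h) (≤-reflexive (sumTo-const n c))

sumTo-split : ∀ a b f → sumTo (a + b) f ≡ sumTo a f + sumTo b (λ i → f (a + i))
sumTo-split zero b f = refl
sumTo-split (suc a) b f rewrite sumTo-split a b (f ∘ suc) = sym (+-assoc (f 0) _ _)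

sumTo-snoc : ∀ n f → sumTo (suc n) f ≡ sumTo n f + f n
sumTo-snoc zero f = +-identityʳ (f 0)
sumTo-snoc (suc n) f rewrite sumTo-snoc n (f ∘ suc) = sym (+-assoc (f 0) _ _)

-- The rotational invariance behind all averaging over the positions of a chord pattern.
sumTo-periodic : ∀ n f → (∀ i → f (n + i) ≡ f i) → ∀ o → sumTo n (λ i → f (i + o)) ≡ sumTo n f
sumTo-periodic n f p zero = sumTo-cong n (λ i _ → cong f (+-identityʳ i))
sumTo-periodic n f p (suc o) = begin
  sumTo n (λ i → f (i + suc o))  ≡⟨ sumTo-cong n (λ i _ → cong f (+-suc i o)) ⟩
  sumTo n (g ∘ suc)              ≡⟨ +-cancelˡ-≡ (g 0) _ _ (trans (sumTo-snoc n g) (trans (+-comm (sumTo n g) (g n)) (cong (_+ sumTo n g) gn))) ⟩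
  sumTo n g                      ≡⟨ sumTo-periodic n f p o ⟩
  sumTo n f ∎
  where
  open ≡-Reasoning
  g : ℕ → ℕ
  g i = f (i + o)
  gn : g n ≡ g 0
  gn = p o

-- ρ w is the number of chords of length w of a cycle of length ℓ in a graph without a cycle of length m.

record Chords (m ℓ : ℕ) (ρ : ℕ → ℕ) : Set where
  field
    ρ0 : ρ 0 ≡ 0
    ρ1 : ρ 1 ≡ ℓ
    ρ≤ : ∀ w → ρ w ≤ ℓ
    flip : ∀ {w w′} → w + w′ ≡ ℓ → ρ w′ ≡ ρ w
    -- The list holds the steps of a walk once round the cycle; with m steps it would be a cycle of
    -- length m.
    fwd : ∀ t ss → All (1 ≤_) (t ∷ ss) → sum (t ∷ ss) ≡ ℓ → length (t ∷ ss) ≡ m → ∑ (t ∷ ss) ρ + ℓ ≤ m * ℓ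
    cross : ∀ a α b β → 1 ≤ a → 1 ≤ b → α + β + 2 ≡ m → a + α + b + β ≡ ℓ → ρ (a + α) + ρ (α + b) ≤ ℓ
    tri : ∀ h e b → 1 ≤ e → 1 ≤ b → h + h + 2 ≡ m → h + e + b + (h + h) ≡ ℓ → 2 * ρ (h + b) + ρ e ≤ ℓ
    tri-8-15 : m ≡ 8 → ℓ ≡ 15 → ρ 3 + (ρ 5 + ρ 6) ≤ ℓ

-- Graphs, cycles and edge counts.

module Graphs {V : Set} (_≟ᵥ_ : DecidableEquality V) where

  open import Data.List.Membership.DecPropositional _≟ᵥ_ using (_∈?_)

  Rel : Set
  Rel = V → V → Bool

  Symm Irr : Rel → Set
  Symm A = ∀ x y → A x y ≡ A y x
  Irr A = ∀ x → A x x ≡ false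

  -- Ordered pairs are counted, so `E A X X` is the degree sum, twice the number of edges inside
  -- `X`.
  E : Rel → List V → List V → ℕ
  E A X Y = ∑ X (λ x → ∑ Y (λ y → ⟦ A x y ⟧))

  Seg : Rel → V → List V → V → Set
  Seg A x [] y = A x y ≡ true
  Seg A x (w ∷ ws) y = A x w ≡ true × Seg A w ws y

  -- In a symmetric graph an edge qualifies as a cycle of length two. Hence a graph without a cycle
  -- in this sense has no edge, and any other graph has a longest cycle.
  Cyc : Rel → List V → Set
  Cyc A [] = ⊥
  Cyc A (x ∷ xs) = Seg A x xs x

  NoLong : Rel → List V → ℕ → Set
  NoLong A W n = ∀ L → Cyc A L → Unique L → (∀ {x} → x ∈ L → x ∈ W) → length L ≤ n

  module _ {A : Rel} where

    Seg-join : ∀ {x} xs {y ys z} → Seg A x xs y → Seg A y ys z → Seg A x (xs ++ y ∷ ys) z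
    Seg-join [] p q = p , q
    Seg-join (w ∷ ws) (p , r) q = p , Seg-join ws r q

    Seg-split : ∀ {x} xs {y ys z} → Seg A x (xs ++ y ∷ ys) z → Seg A x xs y × Seg A y ys z
    Seg-split [] (p , q) = p , q
    Seg-split (w ∷ ws) (p , r) = let a , b = Seg-split ws r in (p , a) , b

    Seg-rev : Symm A → ∀ {x} xs {y} → Seg A x xs y → Seg A y (reverse xs) x
    Seg-rev sy [] p = trans (sy _ _) p
    Seg-rev sy {x} (w ∷ ws) {y} (p , r) =
      subst (λ l → Seg A y l x) (sym (unfold-reverse w ws)) (Seg-join (reverse ws) (Seg-rev sy ws r) (trans (sy _ _) p))

    Cyc-rot : ∀ xs {y ys} → Cyc A (xs ++ y ∷ ys) → Cyc A (y ∷ ys ++ xs)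
    Cyc-rot [] {y} {ys} c = subst (λ l → Seg A y l y) (sym (++-identityʳ ys)) c
    Cyc-rot (x ∷ xs) {y} {ys} c = let a , b = Seg-split xs c in Seg-join ys b a

  Seg-mono : ∀ {A A′ : Rel} → (∀ {u v} → A u v ≡ true → A′ u v ≡ true) → ∀ {x} xs {y} → Seg A x xs y → Seg A′ x xs y
  Seg-mono h [] p = h p
  Seg-mono h (w ∷ ws) (p , r) = h p , Seg-mono h ws r

  Cyc-mono : ∀ {A A′ : Rel} → (∀ {u v} → A u v ≡ true → A′ u v ≡ true) → ∀ xs → Cyc A xs → Cyc A′ xs
  Cyc-mono h (x ∷ xs) c = Seg-mono h xs c

  -- The two graphs may differ at the end `x`. The path is cut before `x`, at its last vertex `b`;
  -- the part up to `b` lies in `A` and can be continued to any neighbour of `b`.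
  Seg-last : ∀ {A A′ : Rel} a r {x} → (∀ {u v} → u ∈ a ∷ r → v ∈ a ∷ r → A′ u v ≡ A u v) → Seg A′ a r x →
             ∃[ b ] (b ∈ a ∷ r × A′ b x ≡ true × (∀ y → A b y ≡ true → Seg A a r y))
  Seg-last a [] h p = a , here refl , p , λ y q → q
  Seg-last a (w ∷ r) h (p , s) =
    let b , b∈ , q , f = Seg-last w r (λ u∈ v∈ → h (there u∈) (there v∈)) s in
    b , there b∈ , q , λ y e → trans (sym (h (here refl) (there (here refl)))) p , f y e

  Irr-≢ : ∀ {A : Rel} → Irr A → ∀ {x y} → A x y ≡ true → x ≢ y
  Irr-≢ ir {x} p refl with trans (sym p) (ir x)
  ... | ()

  E-↭ˡ : ∀ (A : Rel) {X X′} Y → X ↭ X′ → E A X Y ≡ E A X′ Y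
  E-↭ˡ A Y p = ∑-↭ _ p

  E-↭ʳ : ∀ (A : Rel) X {Y Y′} → Y ↭ Y′ → E A X Y ≡ E A X Y′
  E-↭ʳ A X p = ∑-cong X (λ _ → ∑-↭ _ p)

  E-↭ : ∀ (A : Rel) {X X′} → X ↭ X′ → E A X X ≡ E A X′ X′
  E-↭ A {X} {X′} p = trans (E-↭ˡ A X p) (E-↭ʳ A X′ p)

  E-sym : ∀ {A : Rel} → Symm A → ∀ X Y → E A X Y ≡ E A Y X
  E-sym {A} sy X Y = trans (∑-swap X Y (λ x y → ⟦ A x y ⟧)) (∑-cong Y (λ {y} _ → ∑-cong X (λ {x} _ → cong ⟦_⟧ (sy x y))))

  E-++ : ∀ {A : Rel} → Symm A → ∀ X Y → E A (X ++ Y) (X ++ Y) ≡ E A X X + (2 * E A X Y + E A Y Y)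
  E-++ {A} sy X Y = begin
    E A (X ++ Y) (X ++ Y)                               ≡⟨ ∑-++ X Y _ ⟩
    E A X (X ++ Y) + E A Y (X ++ Y)                     ≡⟨ cong₂ _+_ (split X) (split Y) ⟩
    (E A X X + E A X Y) + (E A Y X + E A Y Y)           ≡⟨ cong (λ t → (E A X X + E A X Y) + (t + E A Y Y)) (E-sym sy Y X) ⟩
    (E A X X + E A X Y) + (E A X Y + E A Y Y)           ≡⟨ lem (E A X X) (E A X Y) (E A Y Y) ⟩
    E A X X + (2 * E A X Y + E A Y Y) ∎
    where
    open ≡-Reasoning
    split : ∀ Z → E A Z (X ++ Y) ≡ E A Z X + E A Z Y
    split Z = trans (∑-cong Z (λ _ → ∑-++ X Y _)) (∑-+ Z _ _)
    lem : ∀ a b c → (a + b) + (b + c) ≡ a + (2 * b + c)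
    lem = solve-∀

  E-self : ∀ {A : Rel} → Irr A → ∀ X → E A X X + length X ≤ length X * length X
  E-self {A} ir X = ≤-trans (≤-reflexive (trans (cong (E A X X +_) (trans (sym (*-identityʳ _)) (sym (∑-const X 1)))) (sym (∑-+ X _ _))))
                    (∑-bound X (length X) row)
    where
    row : ∀ {x} → x ∈ X → ∑ X (λ y → ⟦ A x y ⟧) + 1 ≤ length X
    row {x} x∈ with Z , p ← ∈-↭ x∈ = begin
      ∑ X (λ y → ⟦ A x y ⟧) + 1               ≡⟨ cong (_+ 1) (∑-↭ _ p) ⟩
      ⟦ A x x ⟧ + ∑ Z (λ y → ⟦ A x y ⟧) + 1   ≡⟨ cong (λ b → ⟦ b ⟧ + ∑ Z (λ y → ⟦ A x y ⟧) + 1) (ir x) ⟩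
      ∑ Z (λ y → ⟦ A x y ⟧) + 1               ≤⟨ +-monoˡ-≤ 1 (∑-bound Z 1 (λ {y} _ → ⟦⟧≤1 (A x y))) ⟩
      length Z * 1 + 1                         ≡⟨ cong (_+ 1) (*-identityʳ _) ⟩
      length Z + 1                             ≡⟨ +-comm _ 1 ⟩
      suc (length Z)                           ≡⟨ ↭-length (↭-sym p) ⟩
      length X ∎
      where open ≤-Reasoning

  2-cycle : ∀ {A : Rel} → Symm A → Irr A → ∀ {x y} → A x y ≡ true → Cyc A (x ∷ y ∷ []) × Unique (x ∷ y ∷ [])
  2-cycle sy ir {x} {y} p = (p , trans (sy y x) p) , Unique-cons (λ { (here e) → Irr-≢ ir p e }) (Unique-cons (λ ()) [])

  -- Edges outside a longest cycle.

  -- A path from c to c′ with interior d ∷ D.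

  record Ear (A : Rel) (C H : List V) (n : ℕ) : Set where
    field
      {c c′ d} : V
      {D} : List V
      c∈ : c ∈ C
      c′∈ : c′ ∈ C
      c≢c′ : c ≢ c′
      D-uniq : Unique (d ∷ D)
      D⊆H : ∀ {x} → x ∈ d ∷ D → x ∈ H
      edge : A c d ≡ true
      seg : Seg A d D c′
      len : length D ≡ n

  module _ {A : Rel} (sy : Symm A) (ir : Irr A) {C H : List V} (cyc : Cyc A C) (uniq : Unique (C ++ H))
           (nolong : NoLong A (C ++ H) (length C)) {q : ℕ} (ear : Ear A C H q) (maxear : ∀ j → Ear A C H j → j ≤ q) where
    open Ear ear

    private
      uC : Unique C
      uC = Unique-++ˡ C uniq

    -- The cycle is read from the end `c′` of the ear, so that positions in `R` measure distances
    -- from `c′` in both directions.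
    module Rotated (R : List V) (R↭ : C ↭ c′ ∷ R) (cycR : Seg A c′ R c′) where

      -- Taking in the q + 1 interior vertices of the ear must be paid for by leaving out at least
      -- as many others, since `C` is longest.
      perm-cycle : ∀ L Z → Z ++ L ↭ (c′ ∷ R) ++ (d ∷ D) → Cyc A L → suc q ≤ length Z
      perm-cycle L Z p cy = +-cancelʳ-≤ (length C) (suc q) (length Z) (begin
        suc q + length C                   ≡⟨ +-comm (suc q) _ ⟩
        length C + suc q                   ≡⟨ cong₂ _+_ (↭-length R↭) (cong suc (sym len)) ⟩
        length (c′ ∷ R) + length (d ∷ D)   ≡⟨ sym (length-++ (c′ ∷ R)) ⟩
        length ((c′ ∷ R) ++ (d ∷ D))       ≡⟨ ↭-length (↭-sym p) ⟩
        length (Z ++ L)                    ≡⟨ length-++ Z ⟩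
        length Z + length L                ≤⟨ +-monoʳ-≤ (length Z) (nolong L cy uL L⊆) ⟩
        length Z + length C ∎)
        where
        open ≤-Reasoning
        uRD : Unique ((c′ ∷ R) ++ (d ∷ D))
        uRD = Unique-join (c′ ∷ R) (Unique-↭ R↭ uC) D-uniq
                (λ x∈ x∈D → Unique-disj C uniq (∈-resp-↭ (↭-sym R↭) x∈) (D⊆H x∈D))
        uL : Unique L
        uL = Unique-++ʳ Z (Unique-↭ (↭-sym p) uRD)
        L⊆ : ∀ {x} → x ∈ L → x ∈ C ++ H
        L⊆ x∈ with ∈-++⁻ (c′ ∷ R) (∈-resp-↭ p (∈-++⁺ʳ Z x∈))
        ... | inj₁ r = ∈-++⁺ˡ (∈-resp-↭ (↭-sym R↭) r)
        ... | inj₂ h = ∈-++⁺ʳ C (D⊆H h)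

      -- From `y` through `S` to `c′`, backwards along the ear to `d` and over to `y`: only `P` is
      -- left out.
      far-left : ∀ P y S → R ≡ P ++ y ∷ S → A d y ≡ true → suc q ≤ length P
      far-left P y S refl ady = perm-cycle (y ∷ (S ++ c′ ∷ (reverse D ++ d ∷ []))) P perm
          (Seg-join S (proj₂ sp) (Seg-join (reverse D) (Seg-rev sy D seg) ady))
        where
        sp : Seg A c′ P y × Seg A y S c′
        sp = Seg-split P cycR
        open Perm.PermutationReasoning
        perm : P ++ y ∷ (S ++ c′ ∷ (reverse D ++ d ∷ [])) ↭ (c′ ∷ (P ++ y ∷ S)) ++ (d ∷ D)
        perm = begin
          P ++ (y ∷ S) ++ (c′ ∷ (reverse D ++ d ∷ []))   ≡⟨ sym (++-assoc P (y ∷ S) _) ⟩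
          (P ++ y ∷ S) ++ (c′ ∷ (reverse D ++ d ∷ []))   ↭⟨ shift c′ (P ++ y ∷ S) _ ⟩
          c′ ∷ ((P ++ y ∷ S) ++ (reverse D ++ d ∷ []))   ↭⟨ prep c′ (++⁺ˡ (P ++ y ∷ S) (++-comm (reverse D) (d ∷ []))) ⟩
          c′ ∷ ((P ++ y ∷ S) ++ (d ∷ reverse D))         ↭⟨ prep c′ (++⁺ˡ (P ++ y ∷ S) (prep d (↭-reverse D))) ⟩
          c′ ∷ ((P ++ y ∷ S) ++ (d ∷ D)) ∎

      -- From `c′` through `P` to `y`, over to `d` and along the ear to `c′`: only `S` is left out.
      far-right : ∀ P y S → R ≡ P ++ y ∷ S → A d y ≡ true → suc q ≤ length S
      far-right P y S refl ady = perm-cycle (c′ ∷ (P ++ y ∷ d ∷ D)) S perm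
          (Seg-join P (proj₁ sp) (trans (sy y d) ady , seg))
        where
        sp : Seg A c′ P y × Seg A y S c′
        sp = Seg-split P cycR
        open Perm.PermutationReasoning
        perm : S ++ c′ ∷ (P ++ y ∷ d ∷ D) ↭ (c′ ∷ (P ++ y ∷ S)) ++ (d ∷ D)
        perm = begin
          S ++ c′ ∷ (P ++ y ∷ d ∷ D)            ↭⟨ ++-comm S _ ⟩
          c′ ∷ ((P ++ y ∷ d ∷ D) ++ S)          ≡⟨ cong (c′ ∷_) (++-assoc P (y ∷ d ∷ D) S) ⟩
          c′ ∷ (P ++ y ∷ ((d ∷ D) ++ S))        ↭⟨ prep c′ (++⁺ˡ P (prep y (++-comm (d ∷ D) S))) ⟩
          c′ ∷ (P ++ y ∷ (S ++ (d ∷ D)))        ≡⟨ cong (c′ ∷_) (sym (++-assoc P (y ∷ S) (d ∷ D))) ⟩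
          c′ ∷ ((P ++ y ∷ S) ++ (d ∷ D)) ∎

      -- Inserting `d` between the two gives a cycle that leaves out only `D`, which has q vertices,
      -- one too few.
      no-adjacent : ∀ P y y′ S → R ≡ P ++ y ∷ y′ ∷ S → A d y ≡ true → A d y′ ≡ true → ⊥
      no-adjacent P y y′ S refl ady ady′ =
        1+n≰n (≤-trans (perm-cycle (c′ ∷ (P ++ y ∷ d ∷ y′ ∷ S)) D perm
          (Seg-join P (proj₁ sp) (trans (sy y d) ady , ady′ , proj₂ (proj₂ sp)))) (≤-reflexive len))
        where
        sp : Seg A c′ P y × (A y y′ ≡ true × Seg A y′ S c′)
        sp = Seg-split P cycR
        open Perm.PermutationReasoning
        perm : D ++ c′ ∷ (P ++ y ∷ d ∷ y′ ∷ S) ↭ (c′ ∷ (P ++ y ∷ y′ ∷ S)) ++ (d ∷ D)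
        perm = begin
          D ++ c′ ∷ (P ++ y ∷ d ∷ y′ ∷ S)       ↭⟨ ++-comm D _ ⟩
          c′ ∷ ((P ++ y ∷ d ∷ y′ ∷ S) ++ D)     ≡⟨ cong (c′ ∷_) (++-assoc P (y ∷ d ∷ y′ ∷ S) D) ⟩
          c′ ∷ (P ++ y ∷ d ∷ ((y′ ∷ S) ++ D))   ↭⟨ prep c′ (++⁺ˡ P (prep y (↭-sym (shift d (y′ ∷ S) D)))) ⟩
          c′ ∷ (P ++ y ∷ ((y′ ∷ S) ++ (d ∷ D))) ≡⟨ cong (c′ ∷_) (sym (++-assoc P (y ∷ y′ ∷ S) (d ∷ D))) ⟩
          c′ ∷ ((P ++ y ∷ y′ ∷ S) ++ (d ∷ D)) ∎

      -- The neighbours of `d` in `R` avoid the first and the last q + 1 entries and are never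
      -- consecutive. Since `c` is such a neighbour, the two margins `P` and `S` do not overlap, and
      -- `sparse-count` applies to the part `M` between them.
      count-R : 2 * ∑ R (λ y → ⟦ A d y ⟧) + 2 * suc q ≤ length C
      count-R with ∈-∃++ c∈R
        where
        c∈R : c ∈ R
        c∈R with ∈-resp-↭ R↭ c∈
        ... | here e = ⊥-elim (c≢c′ e)
        ... | there h = h
      ... | R₁ , R₂ , eR
        with P , M₁ , e₁ , lP ← split-at-≥ (suc q) R₁ (far-left R₁ c R₂ eR (trans (sy d c) edge))
           | M₂ , S , e₂ , lS ← split-end (suc q) R₂ (far-right R₁ c R₂ eR (trans (sy d c) edge)) = begin
          2 * ∑ R b + 2 * suc q                        ≡⟨ cong (λ t → 2 * t + 2 * suc q) cnt ⟩
          2 * ∑ M b + 2 * suc q                        ≤⟨ +-monoˡ-≤ (2 * suc q) (sparse-count (A d) M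
               (λ P′ y y′ S′ e → no-adjacent (P ++ P′) y y′ (S′ ++ S) (trans eq (trans (cong (λ l → P ++ (l ++ S)) e)
                  (trans (cong (P ++_) (++-assoc P′ (y ∷ y′ ∷ S′) S)) (sym (++-assoc P P′ _))))))) ⟩
          suc (length M) + 2 * suc q                   ≡⟨ lem (length M) (suc q) ⟩
          suc (suc q + (length M + suc q))             ≡⟨ cong suc (cong₂ (λ u v → u + (length M + v)) (sym lP) (sym lS)) ⟩
          suc (length P + (length M + length S))       ≡⟨ cong (λ t → suc (length P + t)) (sym (length-++ M)) ⟩
          suc (length P + length (M ++ S))             ≡⟨ cong suc (sym (length-++ P)) ⟩
          suc (length (P ++ (M ++ S)))                 ≡⟨ cong (suc ∘ length) (sym eq) ⟩
          length (c′ ∷ R)                              ≡⟨ sym (↭-length R↭) ⟩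
          length C ∎
        where
        open ≤-Reasoning
        b : V → ℕ
        b y = ⟦ A d y ⟧
        M : List V
        M = M₁ ++ c ∷ M₂
        lem : ∀ m n → suc m + 2 * n ≡ suc (n + (m + n))
        lem = solve-∀
        eq : R ≡ P ++ (M ++ S)
        eq = trans eR (trans (cong₂ (λ u v → u ++ c ∷ v) e₁ e₂) (trans (++-assoc P M₁ _) (cong (P ++_) (sym (++-assoc M₁ (c ∷ M₂) S)))))
        zero-of : ∀ y → (A d y ≡ true → ⊥) → ⟦ A d y ⟧ ≡ 0
        zero-of y h with A d y
        ... | true = ⊥-elim (h refl)
        ... | false = refl
        zP : ∀ {y} → y ∈ P → b y ≡ 0
        zP {y} y∈ with P′ , P″ , refl ← ∈-∃++ y∈ = zero-of y λ e →
          1+n≰n (≤-trans (≤-trans (≤-trans (m≤m+n (suc (length P′)) (length P″)) (≤-reflexive (trans (sym (+-suc _ _)) (sym (length-++ P′)))))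
            (≤-reflexive lP)) (far-left P′ y (P″ ++ (M ++ S)) (trans eq (++-assoc P′ (y ∷ P″) _)) e))
        zS : ∀ {y} → y ∈ S → b y ≡ 0
        zS {y} y∈ with S′ , S″ , refl ← ∈-∃++ y∈ = zero-of y λ e →
          1+n≰n (≤-trans (≤-trans (≤-trans (m≤n+m (suc (length S″)) (length S′)) (≤-reflexive (sym (length-++ S′))))
            (≤-reflexive lS)) (far-right (P ++ (M ++ S′)) y S″
               (trans eq (trans (cong (P ++_) (sym (++-assoc M S′ _))) (sym (++-assoc P (M ++ S′) _)))) e))
        cnt : ∑ R b ≡ ∑ M b
        cnt = trans (cong (λ l → ∑ l b) eq) (trans (∑-++ P (M ++ S) b) (trans (cong₂ _+_ (∑-zero P zP) (∑-++ M S b))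
                (trans (cong (∑ M b +_) (∑-zero S zS)) (+-identityʳ _))))

    -- The left side is what contracting `d` into `c` costs, by `contract-total`. The summand 1 for
    -- `c′` and the at most q common neighbours of `c` and `d` outside `C` fill up the margin that
    -- `count-R` leaves.
    ear-loss : ∀ H′ → H ↭ d ∷ H′ → 2 * (∑ C (λ y → ⟦ A d y ⟧) + ∑ H′ (λ w → ⟦ A c w ∧ A d w ⟧)) ≤ length C
    ear-loss H′ H↭ with P₀ , S₀ , eC ← ∈-∃++ c′∈ = begin
        2 * (∑ C b + k)                              ≡⟨ cong (λ t → 2 * (t + k)) (∑-↭ b R↭) ⟩
        2 * ((⟦ A d c′ ⟧ + ∑ R b) + k)               ≤⟨ *-monoʳ-≤ 2 (+-mono-≤ (+-monoˡ-≤ (∑ R b) (⟦⟧≤1 (A d c′))) codeg) ⟩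
        2 * ((1 + ∑ R b) + q)                        ≡⟨ lem (∑ R b) q ⟩
        2 * ∑ R b + 2 * suc q                        ≤⟨ Rotated.count-R R R↭ (Cyc-rot P₀ (subst (Cyc A) eC cyc)) ⟩
        length C ∎
      where
      open ≤-Reasoning
      R : List V
      R = S₀ ++ P₀
      R↭ : C ↭ c′ ∷ R
      R↭ = ↭-trans (↭-reflexive eC) (++-comm P₀ (c′ ∷ S₀))
      b : V → ℕ
      b y = ⟦ A d y ⟧
      k : ℕ
      k = ∑ H′ (λ w → ⟦ A c w ∧ A d w ⟧)
      lem : ∀ m n → 2 * ((1 + m) + n) ≡ 2 * m + 2 * suc n
      lem = solve-∀
      udH′ : Unique (d ∷ H′)
      udH′ = Unique-↭ H↭ (Unique-++ʳ C uniq)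
      ∧-true : ∀ x y → x ∧ y ≡ true → x ≡ true × y ≡ true
      ∧-true true true _ = refl , refl
      in-D : ∀ {w} → w ∈ H′ → A c w ∧ A d w ≡ true → w ∈ D
      in-D {w} w∈ e with w ∈? D
      ... | yes p = p
      -- The path from `c` over `w`, `d` and `D` would be a longer ear.
      ... | no w∉ = let acw , adw = ∧-true _ _ e in ⊥-elim (1+n≰n (maxear (suc q) (record
        { c∈ = c∈ ; c′∈ = c′∈ ; c≢c′ = c≢c′
        ; D-uniq = Unique-cons (λ { (here refl) → ∉-head udH′ w∈ ; (there p) → w∉ p }) D-uniq
        ; D⊆H = λ { (here refl) → ∈-resp-↭ (↭-sym H↭) (there w∈) ; (there p) → D⊆H p }
        ; edge = acw ; seg = trans (sy w d) adw , seg ; len = cong suc len })))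
      codeg : k ≤ q
      codeg = ≤-trans (count-⊆ H′ _ (Unique-tail udH′) in-D) (≤-reflexive len)

  -- One construction for two purposes: with the union of the neighbourhoods of `c` and `d` it
  -- contracts the edge between them, with `hit A C` it shrinks `C` to the point `c`. Vertices that
  -- disappear are merely dropped from the vertex lists.
  attach : Rel → V → (V → Bool) → Rel
  attach A c f x y with x ≟ᵥ c | y ≟ᵥ c
  ... | yes _ | yes _ = false
  ... | yes _ | no _ = f y
  ... | no _ | yes _ = f x
  ... | no _ | no _ = A x y

  module _ {A : Rel} (sy : Symm A) (ir : Irr A) (c : V) (f : V → Bool) where

    attach-sym : Symm (attach A c f)
    attach-sym x y with x ≟ᵥ c | y ≟ᵥ c
    ... | yes _ | yes _ = refl
    ... | yes _ | no _ = refl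
    ... | no _ | yes _ = refl
    ... | no _ | no _ = sy x y

    attach-irr : Irr (attach A c f)
    attach-irr x with x ≟ᵥ c
    ... | yes _ = refl
    ... | no _ = ir x

    attach-off : ∀ {x y} → x ≢ c → y ≢ c → attach A c f x y ≡ A x y
    attach-off {x} {y} x≢ y≢ with x ≟ᵥ c | y ≟ᵥ c
    ... | yes e | _ = ⊥-elim (x≢ e)
    ... | no _ | yes e = ⊥-elim (y≢ e)
    ... | no _ | no _ = refl

    attach-c : ∀ {y} → y ≢ c → attach A c f c y ≡ f y
    attach-c {y} y≢ with c ≟ᵥ c | y ≟ᵥ c
    ... | _ | yes e = ⊥-elim (y≢ e)
    ... | yes _ | no _ = refl
    ... | no n | no _ = ⊥-elim (n refl)

    attach-mono : (∀ {y} → A c y ≡ true → f y ≡ true) → ∀ {x y} → A x y ≡ true → attach A c f x y ≡ true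
    attach-mono h {x} {y} e with x ≟ᵥ c | y ≟ᵥ c
    ... | yes refl | yes refl = ⊥-elim (Irr-≢ {A} ir e refl)
    ... | yes refl | no _ = h e
    ... | no _ | yes refl = h (trans (sy y x) e)
    ... | no _ | no _ = e

    -- A cycle through `c` leaves it towards some `a` and returns from some `b`. The path between
    -- them avoids `c`, so it lies in `A` and can be closed by other vertices when the cycle is
    -- lifted.
    attach-cycle : ∀ L → Cyc (attach A c f) L → Unique L →
      Cyc A L ⊎ (∃[ a ] ∃[ r ] ∃[ b ] (L ↭ c ∷ a ∷ r × b ∈ a ∷ r × f a ≡ true × f b ≡ true ×
                   (∀ y → A b y ≡ true → Seg A a r y)))
    attach-cycle L cy u with c ∈? L
    ... | no c∉ = inj₁ (off L c∉ cy)
      where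
      seg-off : ∀ {x} xs {y} → x ≢ c → y ≢ c → c ∉ xs → Seg (attach A c f) x xs y → Seg A x xs y
      seg-off [] x≢ y≢ n p = trans (sym (attach-off x≢ y≢)) p
      seg-off (w ∷ xs) x≢ y≢ n (p , s) = trans (sym (attach-off x≢ w≢)) p , seg-off xs w≢ y≢ (n ∘ there) s
        where w≢ : w ≢ c
              w≢ e = n (here (sym e))
      off : ∀ L → c ∉ L → Cyc (attach A c f) L → Cyc A L
      off (x ∷ xs) n s = seg-off xs (λ e → n (here (sym e))) (λ e → n (here (sym e))) (n ∘ there) s
    ... | yes c∈ with P , S , e ← ∈-∃++ c∈ = inj₂ (split (S ++ P) rot perm (Cyc-rot P (subst (Cyc (attach A c f)) e cy)))
      where
      perm : L ↭ c ∷ (S ++ P)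
      perm = ↭-trans (↭-reflexive e) (++-comm P (c ∷ S))
      rot : Unique (c ∷ (S ++ P))
      rot = Unique-↭ perm u
      split : ∀ R → Unique (c ∷ R) → L ↭ c ∷ R → Seg (attach A c f) c R c →
        ∃[ a ] ∃[ r ] ∃[ b ] (L ↭ c ∷ a ∷ r × b ∈ a ∷ r × f a ≡ true × f b ≡ true ×
                   (∀ y → A b y ≡ true → Seg A a r y))
      split [] _ _ s = ⊥-elim (Irr-≢ {attach A c f} attach-irr s refl)
      split (a ∷ r) v p (s , t) =
        let off = λ {z} (z∈ : z ∈ a ∷ r) → λ (e : z ≡ c) → ∉-head v (subst (_∈ a ∷ r) e z∈)
            b , b∈ , bc , g = Seg-last a r (λ u∈ v∈ → attach-off (off u∈) (off v∈)) t
        in a , r , b , p , b∈ , trans (sym (attach-c (off (here refl)))) s ,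
           trans (sym (attach-c (off b∈))) (trans (attach-sym c b) bc) , g

  -- Twice the number of edges on `C ++ H` that are not inside `C`.
  total : Rel → List V → List V → ℕ
  total A C H = 2 * E A C H + E A H H

  module _ {A : Rel} (sy : Symm A) (ir : Irr A) {c d : V} (c≢d : c ≢ d) where

    private
      f : V → Bool
      f y = A c y ∨ A d y
      A′ : Rel
      A′ = attach A c f

    -- A cycle through the contracted vertex lifts with `c` or with `d` in its place if `a` and `b`
    -- are both joined to that vertex; otherwise the edge between `c` and `d` is inserted and the
    -- lifted cycle is longer by one.
    contract-nolong : ∀ {W W′ n} → A c d ≡ true → c ∈ W → d ∈ W → (∀ {x} → x ∈ W′ → x ∈ W) → d ∉ W′ →
                      NoLong A W n → NoLong A′ W′ n
    contract-nolong {W} {W′} {n} acd c∈ d∈ sub d∉ nl L cy u L⊆ with attach-cycle sy ir c f L cy u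
    ... | inj₁ cyA = nl L cyA u (sub ∘ L⊆)
    ... | inj₂ (a , r , b , p , b∈ , fa , fb , seg) = go (∨-true _ _ fa) (∨-true _ _ fb)
      where
      ucar : Unique (c ∷ a ∷ r)
      ucar = Unique-↭ p u
      d∉L : d ∉ c ∷ a ∷ r
      d∉L d∈L = d∉ (L⊆ (∈-resp-↭ (↭-sym p) d∈L))
      sub′ : ∀ {x} → x ∈ a ∷ r → x ∈ W
      sub′ x∈ = sub (L⊆ (∈-resp-↭ (↭-sym p) (there x∈)))
      lenL : length L ≡ length (c ∷ a ∷ r)
      lenL = ↭-length p
      go : A c a ≡ true ⊎ A d a ≡ true → A c b ≡ true ⊎ A d b ≡ true → length L ≤ n
      go (inj₁ ca) (inj₁ cb) = ≤-trans (≤-reflexive lenL)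
        (nl (c ∷ a ∷ r) (ca , seg c (trans (sy b c) cb)) ucar λ { (here refl) → c∈ ; (there x∈) → sub′ x∈ })
      go (inj₂ da) (inj₂ db) = ≤-trans (≤-reflexive lenL)
        (nl (d ∷ a ∷ r) (da , seg d (trans (sy b d) db)) (Unique-cons (d∉L ∘ there) (Unique-tail ucar))
          λ { (here refl) → d∈ ; (there x∈) → sub′ x∈ })
      go (inj₁ ca) (inj₂ db) = ≤-trans (≤-reflexive lenL) (≤-trans (n≤1+n _)
        (nl (d ∷ c ∷ a ∷ r) (trans (sy d c) acd , ca , seg d (trans (sy b d) db)) (Unique-cons d∉L ucar)
          λ { (here refl) → d∈ ; (there (here refl)) → c∈ ; (there (there x∈)) → sub′ x∈ }))
      go (inj₂ da) (inj₁ cb) = ≤-trans (≤-reflexive lenL) (≤-trans (n≤1+n _)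
        (nl (c ∷ d ∷ a ∷ r) (acd , da , seg c (trans (sy b c) cb))
          (Unique-cons (λ { (here e) → c≢d e ; (there x∈) → ∉-head ucar x∈ })
            (Unique-cons (d∉L ∘ there) (Unique-tail ucar)))
          λ { (here refl) → c∈ ; (there (here refl)) → d∈ ; (there (there x∈)) → sub′ x∈ }))

    -- The edges from `d` to `C` disappear, and at each common neighbour of `c` and `d` in `H′` two
    -- edges merge into one. New edges inside `C` do not enter `total`.
    contract-total : ∀ C H′ → Unique C → c ∈ C → c ∉ H′ →
      total A C (d ∷ H′) ≡ total A′ C H′ + 2 * (∑ C (λ y → ⟦ A d y ⟧) + ∑ H′ (λ w → ⟦ A c w ∧ A d w ⟧))
    contract-total C H′ uC c∈ c∉ = begin
      2 * E A C (d ∷ H′) + E A (d ∷ H′) (d ∷ H′)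
        ≡⟨ cong₂ (λ s t → 2 * s + t) eCd (E-++ sy (d ∷ []) H′) ⟩
      2 * (degC + E A C H′) + (E A (d ∷ []) (d ∷ []) + (2 * E A (d ∷ []) H′ + E A H′ H′))
        ≡⟨ cong₂ (λ s t → 2 * (degC + E A C H′) + (s + (2 * t + E A H′ H′))) edd (+-identityʳ degH) ⟩
      2 * (degC + E A C H′) + (2 * degH + E A H′ H′)
        ≡⟨ lem₁ degC (E A C H′) degH (E A H′ H′) ⟩
      2 * (E A C H′ + degH) + E A H′ H′ + 2 * degC
        ≡⟨ cong₂ (λ s t → 2 * s + t + 2 * degC) (sym eC) (sym eH) ⟩
      2 * (E A′ C H′ + k) + E A′ H′ H′ + 2 * degC
        ≡⟨ lem₂ (E A′ C H′) k (E A′ H′ H′) degC ⟩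
      total A′ C H′ + 2 * (degC + k) ∎
      where
      open ≡-Reasoning
      degC degH k : ℕ
      degC = ∑ C (λ y → ⟦ A d y ⟧)
      degH = ∑ H′ (λ y → ⟦ A d y ⟧)
      k = ∑ H′ (λ w → ⟦ A c w ∧ A d w ⟧)
      lem₁ : ∀ a b c e → 2 * (a + b) + (2 * c + e) ≡ 2 * (b + c) + e + 2 * a
      lem₁ = solve-∀
      lem₂ : ∀ a b c e → 2 * (a + b) + c + 2 * e ≡ 2 * a + c + 2 * (e + b)
      lem₂ = solve-∀
      eCd : E A C (d ∷ H′) ≡ degC + E A C H′
      eCd = trans (∑-+ C _ _) (cong (_+ E A C H′) (∑-cong C (λ {y} _ → cong ⟦_⟧ (sy y d))))
      edd : E A (d ∷ []) (d ∷ []) ≡ 0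
      edd rewrite ir d = refl
      H′≢ : ∀ {x} → x ∈ H′ → x ≢ c
      H′≢ x∈ refl = c∉ x∈
      eH : E A′ H′ H′ ≡ E A H′ H′
      eH = ∑-cong H′ (λ x∈ → ∑-cong H′ (λ y∈ → cong ⟦_⟧ (attach-off sy ir c f (H′≢ x∈) (H′≢ y∈))))
      row : ∀ {w} → w ∈ H′ → ∑ C (λ y → ⟦ A′ y w ⟧) + ⟦ A c w ∧ A d w ⟧ ≡ ∑ C (λ y → ⟦ A y w ⟧) + ⟦ A d w ⟧
      row {w} w∈ with C₀ , p ← ∈-↭ c∈ = begin
        ∑ C (λ y → ⟦ A′ y w ⟧) + ⟦ A c w ∧ A d w ⟧
          ≡⟨ cong (_+ ⟦ A c w ∧ A d w ⟧) (∑-↭ _ p) ⟩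
        ⟦ A′ c w ⟧ + ∑ C₀ (λ y → ⟦ A′ y w ⟧) + ⟦ A c w ∧ A d w ⟧
          ≡⟨ cong₂ (λ s t → ⟦ s ⟧ + t + ⟦ A c w ∧ A d w ⟧) (attach-c sy ir c f (H′≢ w∈))
               (∑-cong C₀ (λ {y} y∈ → cong ⟦_⟧ (attach-off sy ir c f (λ { refl → ∉-head (Unique-↭ p uC) y∈ }) (H′≢ w∈)))) ⟩
        ⟦ A c w ∨ A d w ⟧ + ∑ C₀ (λ y → ⟦ A y w ⟧) + ⟦ A c w ∧ A d w ⟧
          ≡⟨ lem₃ ⟦ A c w ∨ A d w ⟧ _ _ ⟩
        (⟦ A c w ∨ A d w ⟧ + ⟦ A c w ∧ A d w ⟧) + ∑ C₀ (λ y → ⟦ A y w ⟧)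
          ≡⟨ cong (_+ ∑ C₀ (λ y → ⟦ A y w ⟧)) (⟦∨⟧ (A c w) (A d w)) ⟩
        (⟦ A c w ⟧ + ⟦ A d w ⟧) + ∑ C₀ (λ y → ⟦ A y w ⟧)
          ≡⟨ lem₃ ⟦ A c w ⟧ _ _ ⟩
        (⟦ A c w ⟧ + ∑ C₀ (λ y → ⟦ A y w ⟧)) + ⟦ A d w ⟧
          ≡⟨ cong (_+ ⟦ A d w ⟧) (sym (∑-↭ _ p)) ⟩
        ∑ C (λ y → ⟦ A y w ⟧) + ⟦ A d w ⟧ ∎
        where
        lem₃ : ∀ a b c → a + b + c ≡ a + c + b
        lem₃ = solve-∀
      eC : E A′ C H′ + k ≡ E A C H′ + degH
      eC = begin
        E A′ C H′ + k                                                        ≡⟨ cong (_+ k) (∑-swap C H′ _) ⟩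
        ∑ H′ (λ w → ∑ C (λ y → ⟦ A′ y w ⟧)) + k                              ≡⟨ sym (∑-+ H′ _ _) ⟩
        ∑ H′ (λ w → ∑ C (λ y → ⟦ A′ y w ⟧) + ⟦ A c w ∧ A d w ⟧)              ≡⟨ ∑-cong H′ row ⟩
        ∑ H′ (λ w → ∑ C (λ y → ⟦ A y w ⟧) + ⟦ A d w ⟧)                       ≡⟨ ∑-+ H′ _ _ ⟩
        ∑ H′ (λ w → ∑ C (λ y → ⟦ A y w ⟧)) + degH                            ≡⟨ cong (_+ degH) (sym (∑-swap C H′ _)) ⟩
        E A C H′ + degH ∎

  hit : Rel → List V → V → Bool
  hit A [] y = false
  hit A (x ∷ xs) y = A x y ∨ hit A xs y

  hit⁻ : ∀ A xs y → hit A xs y ≡ true → ∃[ x ] (x ∈ xs × A x y ≡ true)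
  hit⁻ A (x ∷ xs) y e with ∨-true (A x y) _ e
  ... | inj₁ p = x , here refl , p
  ... | inj₂ q = let z , z∈ , r = hit⁻ A xs y q in z , there z∈ , r

  hit⁺ : ∀ A xs y {x} → x ∈ xs → A x y ≡ true → hit A xs y ≡ true
  hit⁺ A (x ∷ xs) y (here refl) e rewrite e = refl
  hit⁺ A (x ∷ xs) y (there x∈) e with A x y
  ... | true = refl
  ... | false = hit⁺ A xs y x∈ e

  hit-sum : ∀ A xs y → Unique xs → (∀ {x x′} → x ∈ xs → x′ ∈ xs → A x y ≡ true → A x′ y ≡ true → x ≡ x′) →
            ∑ xs (λ x → ⟦ A x y ⟧) ≤ ⟦ hit A xs y ⟧
  hit-sum A [] y u h = z≤n
  hit-sum A (x ∷ xs) y u h with A x y in e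
  ... | false = hit-sum A xs y (Unique-tail u) (λ p q → h (there p) (there q))
  ... | true = ≤-reflexive (cong suc (∑-zero xs rest))
    where
    rest : ∀ {z} → z ∈ xs → ⟦ A z y ⟧ ≡ 0
    rest {z} z∈ with A z y in ez
    ... | false = refl
    ... | true = ⊥-elim (∉-head u (subst (_∈ xs) (sym (h (here refl) (there z∈) e ez)) z∈))

  Cycle-in : Rel → List V → List V → Set
  Cycle-in A W L = Cyc A L × Unique L × (∀ {x} → x ∈ L → x ∈ W)

  longest-cycle : ∀ {A W L} → Cycle-in A W L → ¬ ¬ (∃[ M ] (Cycle-in A W M × NoLong A W (length M)))
  longest-cycle {A} {W} {L} cL k =
    ¬¬-max (λ n → ∃[ M ] (Cycle-in A W M × length M ≡ n)) (length W)
      (λ { n (M , (_ , u , s) , refl) → ⊆-length M u s }) (length L) (L , cL , refl)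
      λ { (n , (M , cM , refl) , mx) → k (M , cM , λ N cy u s → mx (length N) (N , (cy , u , s) , refl)) }

  acyclic-E : ∀ {A W} → Symm A → Irr A → ¬ (∃[ L ] Cycle-in A W L) → E A W W ≡ 0
  acyclic-E {A} {W} sy ir none = ∑-zero W (λ {x} x∈ → ∑-zero W (λ {y} y∈ → edge x y x∈ y∈))
    where
    edge : ∀ x y → x ∈ W → y ∈ W → ⟦ A x y ⟧ ≡ 0
    edge x y x∈ y∈ with A x y in e
    ... | false = refl
    ... | true = let cy , u = 2-cycle sy ir e in
       ⊥-elim (none (x ∷ y ∷ [] , cy , u , λ { (here refl) → x∈ ; (there (here refl)) → y∈ }))

  Cyc-length : ∀ {A} → Irr A → ∀ L → Cyc A L → 2 ≤ length L
  Cyc-length {A} ir (x ∷ []) c = ⊥-elim (Irr-≢ {A} ir c refl)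
  Cyc-length ir (x ∷ y ∷ L) c = s≤s (s≤s z≤n)

  -- A contraction takes one vertex from `H` and costs at most `length C`. The fuel `k` is needed
  -- because the case without an ear calls the induction with another cycle, in the shrunken graph.
  outside-edges : ∀ k {A} → Symm A → Irr A → ∀ C H → length H ≤ k → Cyc A C → Unique (C ++ H) →
    NoLong A (C ++ H) (length C) → total A C H ≤ length C * length H
  outside-edges zero {A} sy ir C [] le cyc u nl =
    ≤-trans (≤-reflexive (cong (λ t → 2 * t + 0) (∑-zero C (λ _ → refl)))) z≤n
  outside-edges (suc k) {A} sy ir C H le cyc u nl = decidable-stable (_ ≤? _) λ ng →
    em (∃[ n ] Ear A C H n) λ where
      (inj₁ (n , ear)) → ¬¬-max (Ear A C H) (length H)
         (λ j e → ≤-trans (≤-trans (n≤1+n j) (≤-reflexive (cong suc (sym (Ear.len e))))) (⊆-length _ (Ear.D-uniq e) (Ear.D⊆H e)))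
         n ear λ { (q , ear , mx) → ng (by-contraction ear mx) }
      (inj₂ no-ear) → collapse no-ear ng
    where
    uC : Unique C
    uC = Unique-++ˡ C u

    by-contraction : ∀ {q} → (ear : Ear A C H q) → (∀ j → Ear A C H j → j ≤ q) → total A C H ≤ length C * length H
    by-contraction ear mx with H′ , H↭ ← ∈-↭ (Ear.D⊆H ear (here refl)) = begin
        total A C H                      ≡⟨ cong₂ (λ s t → 2 * s + t) (E-↭ʳ A C H↭) (E-↭ A H↭) ⟩
        total A C (d ∷ H′)               ≡⟨ contract-total sy ir c≢d C H′ uC c∈ c∉H′ ⟩
        total A′ C H′ + 2 * (∑ C (λ y → ⟦ A d y ⟧) + ∑ H′ (λ w → ⟦ A c w ∧ A d w ⟧))
          ≤⟨ +-mono-≤ (outside-edges k (attach-sym sy ir c f) (attach-irr sy ir c f) C H′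
                (≤-pred (≤-trans (≤-reflexive (sym (↭-length H↭))) le)) (Cyc-mono (attach-mono sy ir c f (λ {y} e → cong (_∨ A d y) e)) C cyc)
                (Unique-tail uH′) nl′)
              (ear-loss sy ir cyc u nl ear mx H′ H↭) ⟩
        length C * length H′ + length C  ≡⟨ trans (+-comm _ (length C)) (sym (*-suc (length C) (length H′))) ⟩
        length C * suc (length H′)       ≡⟨ cong (length C *_) (sym (↭-length H↭)) ⟩
        length C * length H ∎
      where
      open ≤-Reasoning
      open Ear ear using (c; d; c∈; edge)
      f : V → Bool
      f y = A c y ∨ A d y
      A′ : Rel
      A′ = attach A c f
      c≢d : c ≢ d
      c≢d = Irr-≢ ir edge
      uH′ : Unique (d ∷ C ++ H′)
      uH′ = Unique-↭ (↭-trans (++⁺ˡ C H↭) (shift d C H′)) u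
      c∉H′ : c ∉ H′
      c∉H′ c∈H = Unique-disj C (Unique-tail uH′) c∈ c∈H
      d∈ : d ∈ C ++ H
      d∈ = ∈-++⁺ʳ C (∈-resp-↭ (↭-sym H↭) (here refl))
      sub : ∀ {x} → x ∈ C ++ H′ → x ∈ C ++ H
      sub x∈ with ∈-++⁻ C x∈
      ... | inj₁ p = ∈-++⁺ˡ p
      ... | inj₂ p = ∈-++⁺ʳ C (∈-resp-↭ (↭-sym H↭) (there p))
      nl′ : NoLong A′ (C ++ H′) (length C)
      nl′ = contract-nolong sy ir c≢d edge (∈-++⁺ˡ c∈) d∈ sub (∉-head uH′) nl

    -- Without an ear every component of H is attached to at most one vertex of C, so C may be shrunk to a point.
    collapse : ¬ (∃[ n ] Ear A C H n) → ¬ ¬ (total A C H ≤ length C * length H)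
    collapse no-ear ng = go C refl
      where
      one-nbr : ∀ {h x x′} → h ∈ H → x ∈ C → x′ ∈ C → A x h ≡ true → A x′ h ≡ true → x ≡ x′
      one-nbr {h} {x} {x′} h∈ x∈ x′∈ e e′ with x ≟ᵥ x′
      ... | yes p = p
      -- Two neighbours on `C` would make `h` the interior of an ear.
      ... | no x≢ = ⊥-elim (no-ear (0 , record { c∈ = x∈ ; c′∈ = x′∈ ; c≢c′ = x≢ ; D-uniq = Unique-cons (λ ()) []
          ; D⊆H = λ { (here refl) → h∈ } ; edge = e ; seg = trans (sy h x′) e′ ; len = refl }))
      go : ∀ C′ → C′ ≡ C → ⊥
      go [] refl = cyc
      go (c ∷ C′) refl = finish
        where
        f : V → Bool
        f = hit A C
        B : Rel
        B = attach A c f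
        syB : Symm B
        syB = attach-sym sy ir c f
        irB : Irr B
        irB = attach-irr sy ir c f
        uW : Unique (c ∷ H)
        uW = Unique-cons (Unique-disj C u (here refl)) (Unique-++ʳ C u)
        H≢ : ∀ {x} → x ∈ H → x ≢ c
        H≢ x∈ refl = ∉-head uW x∈
        le-W : total A C H ≤ E B (c ∷ H) (c ∷ H)
        le-W = begin
          2 * E A C H + E A H H       ≡⟨ cong₂ (λ s t → 2 * s + t) (∑-swap C H _)
                (∑-cong H (λ x∈ → ∑-cong H (λ y∈ → cong ⟦_⟧ (sym (attach-off sy ir c f (H≢ x∈) (H≢ y∈)))))) ⟩
          2 * ∑ H (λ h → ∑ C (λ x → ⟦ A x h ⟧)) + E B H H
                ≤⟨ +-monoˡ-≤ (E B H H) (*-monoʳ-≤ 2 (∑-mono H (λ {h} h∈ →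
                     ≤-trans (hit-sum A C h uC (one-nbr h∈)) (≤-reflexive (cong ⟦_⟧ (sym (attach-c sy ir c f (H≢ h∈)))))))) ⟩
          2 * ∑ H (λ h → ⟦ B c h ⟧) + E B H H ≡⟨ cong (λ t → 2 * t + E B H H) (sym (+-identityʳ (∑ H (λ h → ⟦ B c h ⟧)))) ⟩
          2 * E B (c ∷ []) H + E B H H  ≤⟨ m≤n+m _ (E B (c ∷ []) (c ∷ [])) ⟩
          E B (c ∷ []) (c ∷ []) + (2 * E B (c ∷ []) H + E B H H) ≡⟨ sym (E-++ syB (c ∷ []) H) ⟩
          E B (c ∷ H) (c ∷ H) ∎
          where open ≤-Reasoning
        nlB : NoLong B (c ∷ H) (length C)
        nlB L cy uL L⊆ with attach-cycle sy ir c f L cy uL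
        ... | inj₁ cyA = nl L cyA uL λ x∈ → case L⊆ x∈ of λ { (here refl) → here refl ; (there p) → ∈-++⁺ʳ C p }
        ... | inj₂ (a , r , b , p , b∈ , fa , fb , seg)
          with x , x∈ , xa ← hit⁻ A C a fa | y , y∈ , yb ← hit⁻ A C b fb = by-eq (x ≟ᵥ y)
          where
          ar⊆ : ∀ {z} → z ∈ a ∷ r → z ∈ H
          ar⊆ z∈ with L⊆ (∈-resp-↭ (↭-sym p) (there z∈))
          ... | here refl = ⊥-elim (∉-head (Unique-↭ p uL) z∈)
          ... | there q = q
          uar : Unique (a ∷ r)
          uar = Unique-tail (Unique-↭ p uL)
          by-eq : Dec (x ≡ y) → length L ≤ length C
          by-eq (yes refl) = ≤-trans (≤-reflexive (↭-length p)) (nl (x ∷ a ∷ r) (xa , seg x (trans (sy b x) yb))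
            (Unique-cons (λ x∈ar → Unique-disj C u x∈ (ar⊆ x∈ar)) uar)
            λ { (here refl) → ∈-++⁺ˡ x∈ ; (there q) → ∈-++⁺ʳ C (ar⊆ q) })
          -- Undoing the shrinking, the path from `a` to `b` joins two different vertices of `C`.
          by-eq (no x≢y) = ⊥-elim (no-ear (length r , record { c∈ = x∈ ; c′∈ = y∈ ; c≢c′ = x≢y ; D-uniq = uar ; D⊆H = ar⊆
            ; edge = xa ; seg = seg y (trans (sy b y) yb) ; len = refl }))
        finish : ⊥
        finish = em (∃[ L ] Cycle-in B (c ∷ H) L) cases
          where
          cases : (∃[ L ] Cycle-in B (c ∷ H) L) ⊎ ¬ (∃[ L ] Cycle-in B (c ∷ H) L) → ⊥
          bound : ∀ M → Cyc B M → Unique M → (∀ {x} → x ∈ M → x ∈ c ∷ H) → NoLong B (c ∷ H) (length M) →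
                  E B (c ∷ H) (c ∷ H) ≤ length C * length H
          cases (inj₂ none) = ng (≤-trans le-W (≤-trans (≤-reflexive (acyclic-E syB irB none)) z≤n))
          cases (inj₁ (L , cL)) = longest-cycle cL λ { (M , (cyM , uM , M⊆) , nlM) → ng (≤-trans le-W (bound M cyM uM M⊆ nlM)) }
          -- `M` is a longest cycle of the shrunken graph. Inside it the degree sum is at most
          -- |M|(|M| - 1), and |M| + |Z| = |H| + 1, so the total is at most |M||H|. Since |M| ≥ 2,
          -- fewer than |H| vertices lie outside `M` and the induction applies.
          bound M cyM uM M⊆ nlM with Z , p ← ⊆-↭ M uM M⊆ = begin
            E B (c ∷ H) (c ∷ H)                    ≡⟨ E-↭ B p ⟩
            E B (M ++ Z) (M ++ Z)                  ≡⟨ E-++ syB M Z ⟩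
            E B M M + total B M Z                  ≤⟨ +-monoʳ-≤ (E B M M) (outside-edges k syB irB M Z lenZ cyM
                   (Unique-↭ p uW) (λ N cy uN N⊆ → nlM N cy uN (λ x∈ → ∈-resp-↭ (↭-sym p) (N⊆ x∈)))) ⟩
            E B M M + length M * length Z          ≤⟨ arith (E B M M) (length M) (length Z) (length H) (E-self irB M) lens ⟩
            length M * length H                    ≤⟨ *-monoˡ-≤ (length H) (nlB M cyM uM M⊆) ⟩
            length C * length H ∎
            where
            open ≤-Reasoning
            lens : length M + length Z ≡ suc (length H)
            lens = trans (sym (length-++ M)) (sym (↭-length p))
            lenZ : length Z ≤ k
            lenZ = ≤-pred (≤-trans (+-cancelˡ-≤ 1 _ _ (≤-trans (+-monoˡ-≤ (length Z) (Cyc-length irB M cyM)) (≤-reflexive lens))) le)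
            arith : ∀ e m z h → e + m ≤ m * m → m + z ≡ suc h → e + m * z ≤ m * h
            arith e m z h em eq = +-cancelʳ-≤ m _ _ (begin
              e + m * z + m      ≡⟨ l₁ e m z ⟩
              (e + m) + m * z    ≤⟨ +-monoˡ-≤ (m * z) em ⟩
              m * m + m * z      ≡⟨ sym (*-distribˡ-+ m m z) ⟩
              m * (m + z)        ≡⟨ cong (m *_) eq ⟩
              m * suc h          ≡⟨ l₂ m h ⟩
              m * h + m ∎)
              where
              l₁ : ∀ e m z → e + m * z + m ≡ (e + m) + m * z
              l₁ = solve-∀
              l₂ : ∀ m h → m * suc h ≡ m * h + m
              l₂ = solve-∀

  -- Chord patterns around a cycle.

  module Rotation (A : Rel) (sy : Symm A) (ℓ m : ℕ) (z : ℕ → V) (per : ∀ i → z (ℓ + i) ≡ z i)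
    (adj : ∀ i → A (z i) (z (suc i)) ≡ true) (inj : ∀ i k → i < k → k < ℓ + i → z i ≢ z k)
    (nocyc : ∀ L → Cyc A L → Unique L → (∀ {x} → x ∈ L → ∃[ i ] x ≡ z i) → length L ≢ m) where

    per′ : ∀ i → z (i + ℓ) ≡ z i
    per′ i = trans (cong z (+-comm i ℓ)) (per i)

    adj+1 : ∀ i → A (z i) (z (i + 1)) ≡ true
    adj+1 i = subst (λ k → A (z i) (z k) ≡ true) (+-comm 1 i) (adj i)

    chord : ℕ → ℕ → Bool
    chord j w = A (z j) (z (j + w))

    -- A chord is counted under w from one end and under ℓ - w from the other, so the sum over all w
    -- is the degree sum on the cycle.
    ρ : ℕ → ℕ
    ρ w = sumTo ℓ (λ j → ⟦ chord j w ⟧)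

    chord-periodic : ∀ w i → ⟦ chord (ℓ + i) w ⟧ ≡ ⟦ chord i w ⟧
    chord-periodic w i = cong ⟦_⟧ (cong₂ A (per i) (trans (cong z (+-assoc ℓ i w)) (per (i + w))))

    ρ-shift : ∀ o w → sumTo ℓ (λ j → ⟦ chord (j + o) w ⟧) ≡ ρ w
    ρ-shift o w = sumTo-periodic ℓ (λ j → ⟦ chord j w ⟧) (chord-periodic w) o

    chord-flip : ∀ {w w′} → w + w′ ≡ ℓ → ∀ j → chord (j + w) w′ ≡ chord j w
    chord-flip {w} {w′} e j = trans (cong (A (z (j + w))) (trans (cong z (trans (+-assoc j w w′) (cong (j +_) e))) (per′ j))) (sy _ _)

    ρ-flip : ∀ {w w′} → w + w′ ≡ ℓ → ρ w′ ≡ ρ w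
    ρ-flip {w} {w′} e = trans (sym (ρ-shift w w′)) (sumTo-cong ℓ (λ j _ → cong ⟦_⟧ (chord-flip e j)))

    ρ≤ℓ : ∀ w → ρ w ≤ ℓ
    ρ≤ℓ w = ≤-trans (sumTo-bound ℓ 1 (λ j _ → ⟦⟧≤1 _)) (≤-reflexive (*-identityʳ ℓ))

    ρ1 : ρ 1 ≡ ℓ
    ρ1 = trans (sumTo-cong ℓ (λ j _ → cong ⟦_⟧ (adj+1 j))) (trans (sumTo-const ℓ 1) (*-identityʳ ℓ))

    upt : ℕ → List ℕ → List ℕ
    upt j [] = []
    upt j (s ∷ ss) = (j + s) ∷ upt (j + s) ss

    Red : ℕ → List ℕ → Set
    Red j [] = ⊤
    Red j (s ∷ ss) = chord j s ≡ true × Red (j + s) ss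

    Seg-up : ∀ j ss {ys y} → Red j ss → Seg A (z (j + sum ss)) ys y → Seg A (z j) (map z (upt j ss) ++ ys) y
    Seg-up j [] {ys} {y} r s = subst (λ k → Seg A (z k) ys y) (+-identityʳ j) s
    Seg-up j (t ∷ ss) {ys} {y} (e , r) s = e , Seg-up (j + t) ss r (subst (λ k → Seg A (z k) ys y) (sym (+-assoc j t (sum ss))) s)

    Red-ones : ∀ j k → Red j (replicate k 1)
    Red-ones j zero = tt
    Red-ones j (suc k) = adj+1 j , Red-ones (j + 1) k

    Red-++ : ∀ j ss {ts} → Red j ss → Red (j + sum ss) ts → Red j (ss ++ ts)
    Red-++ j [] {ts} _ r = subst (λ k → Red k ts) (+-identityʳ j) r
    Red-++ j (s ∷ ss) {ts} (e , r) q = e , Red-++ (j + s) ss r (subst (λ k → Red k ts) (sym (+-assoc j s (sum ss))) q)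

    -- Increasing positions in a window of fewer than ℓ + 1 steps; by `Asc-Unique` this makes the
    -- vertices of the cycles constructed below distinct.
    Asc : ℕ → List ℕ → ℕ → Set
    Asc lo ps hi = AllPairs _<_ ps × All (λ q → lo ≤ q × q ≤ hi) ps

    Asc-up : ∀ j ss → All (1 ≤_) ss → Asc j (j ∷ upt j ss) (j + sum ss)
    Asc-up j [] [] = ([] ∷ []) , (≤-refl , m≤m+n j 0) ∷ []
    Asc-up j (s ∷ ss) (s≥1 ∷ a) =
      let p , q = Asc-up (j + s) ss a
          j< = ≤-trans (≤-reflexive (+-comm 1 j)) (+-monoʳ-≤ j s≥1)
          e = +-assoc j s (sum ss)
      in (All.map (λ h → ≤-trans j< (proj₁ h)) q ∷ p) ,
         (≤-refl , m≤m+n j _) ∷ All.map (λ h → ≤-trans (≤-trans (n≤1+n j) j<) (proj₁ h) , ≤-trans (proj₂ h) (≤-reflexive e)) q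

    Asc-++ : ∀ {lo mid mid′ hi} ps {qs} → Asc lo ps mid → Asc mid′ qs hi → mid < mid′ → lo ≤ mid → mid′ ≤ hi → Asc lo (ps ++ qs) hi
    Asc-++ [] (_ , _) (c , d) mm lm mh = c , All.map (λ h → ≤-trans (≤-trans lm (<⇒≤ mm)) (proj₁ h) , proj₂ h) d
    Asc-++ (p ∷ ps) (pp ∷ a , ph ∷ b) (c , d) mm lm mh =
      let u , v = Asc-++ ps (a , b) (c , d) mm lm mh in
      (++⁺ pp (All.map (λ h → ≤-trans (s≤s (proj₂ ph)) (≤-trans mm (proj₁ h))) d) ∷ u) ,
      (proj₁ ph , ≤-trans (proj₂ ph) (≤-trans (<⇒≤ mm) mh)) ∷ v

    Asc-Unique : ∀ {lo hi} ps → Asc lo ps hi → hi < ℓ + lo → Unique (map z ps)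
    Asc-Unique [] _ _ = []
    Asc-Unique {lo} (p ∷ ps) (pp ∷ a , ph ∷ b) hl =
      Unique-cons (λ x∈ → let q , q∈ , e = ∈-map⁻ z x∈ in
        inj p q (All.lookup pp q∈) (≤-trans (s≤s (proj₂ (All.lookup b q∈))) (≤-trans hl (+-monoʳ-≤ ℓ (proj₁ ph)))) e)
      (Asc-Unique ps (a , b) hl)

    private
      on-cycle : ∀ ps {x} → x ∈ map z ps → ∃[ i ] x ≡ z i
      on-cycle ps x∈ = let q , _ , e = ∈-map⁻ z x∈ in q , e

      length-upt : ∀ j ss → length (upt j ss) ≡ length ss
      length-upt j [] = refl
      length-upt j (s ∷ ss) = cong suc (length-upt (j + s) ss)

    -- The steps add up to ℓ, so the walk closes after one turn. It is listed from j + t to j + ℓ, a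
    -- window that t ≥ 1 keeps short enough for distinctness; the first chord then closes the cycle.
    forward : ∀ j t ss → All (1 ≤_) (t ∷ ss) → sum (t ∷ ss) ≡ ℓ → length (t ∷ ss) ≡ m → Red j (t ∷ ss) → ⊥
    forward j t ss (t≥1 ∷ a) e lm (c , r) =
      nocyc (map z (u ∷ upt u ss)) cyc (Asc-Unique (u ∷ upt u ss) (Asc-up u ss a) win) (on-cycle (u ∷ upt u ss))
        (trans (length-map z (u ∷ upt u ss)) (trans (cong suc (length-upt u ss)) lm))
      where
      u : ℕ
      u = j + t
      end : u + sum ss ≡ j + ℓ
      end = trans (+-assoc j t (sum ss)) (cong (j +_) e)
      win : u + sum ss < ℓ + u
      win = ≤-trans (≤-reflexive (cong suc (trans end (+-comm j ℓ)))) (≤-trans (≤-reflexive (sym (+-suc ℓ j))) (+-monoʳ-≤ ℓ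
              (≤-trans (≤-reflexive (+-comm 1 j)) (+-monoʳ-≤ j t≥1))))
      cyc : Cyc A (map z (u ∷ upt u ss))
      cyc = subst (λ l → Seg A (z u) l (z u)) (++-identityʳ _)
              (Seg-up u ss r (subst (λ v → A v (z u) ≡ true) (sym (trans (cong z end) (per′ j))) c))

    -- Two crossing chords, the arcs of lengths α and β between them being kept.
    crossing : ∀ j a α b β → 1 ≤ a → 1 ≤ b → α + β + 2 ≡ m → a + α + b + β ≡ ℓ →
               chord j (a + α) ≡ true → chord (j + a) (α + b) ≡ true → ⊥
    crossing j a α b β a≥1 b≥1 em eℓ c₁ c₂ = nocyc L cyc
        (Unique-↭ (↭-sym perm) (Asc-Unique (ups ++ dns) (Asc-++ ups (Asc-up u₁ s₁ (replicate⁺ α ≤-refl)) (Asc-up u₂ s₂ (replicate⁺ β ≤-refl))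
          v₁<u₂ (m≤m+n u₁ _) (m≤m+n u₂ _)) win))
        (λ x∈ → on-cycle (ups ++ dns) (∈-resp-↭ perm x∈))
        (trans (↭-length perm) (trans (length-map z (ups ++ dns)) (trans (length-++ ups) lens)))
      where
      s₁ s₂ : List ℕ
      s₁ = replicate α 1
      s₂ = replicate β 1
      u₁ u₂ : ℕ
      u₁ = j + a
      u₂ = j + a + α + b
      ups dns : List ℕ
      ups = u₁ ∷ upt u₁ s₁
      dns = u₂ ∷ upt u₂ s₂
      -- Up the first arc, over the first chord to position j + ℓ, down the second arc, and over the
      -- second chord back to `u₁`.
      L : List V
      L = z u₁ ∷ (map z (upt u₁ s₁) ++ (reverse (map z (upt u₂ s₂)) ++ [ z u₂ ]))
      perm : L ↭ map z (ups ++ dns)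
      perm = ↭-trans (prep (z u₁) (++⁺ˡ (map z (upt u₁ s₁)) (↭-trans (++-comm (reverse (map z (upt u₂ s₂))) [ z u₂ ])
               (prep (z u₂) (↭-reverse (map z (upt u₂ s₂))))))) (↭-reflexive (sym (map-++ z ups dns)))
      end₁ : u₁ + sum s₁ ≡ j + (a + α)
      end₁ = trans (cong (u₁ +_) (sum-ones α)) (+-assoc j a α)
      end₂ : u₂ + sum s₂ ≡ ℓ + j
      end₂ = trans (cong (u₂ +_) (sum-ones β)) (trans (lem j a α b β) (cong (_+ j) eℓ))
        where lem : ∀ j a α b β → j + a + α + b + β ≡ a + α + b + β + j
              lem = solve-∀
      v₁<u₂ : u₁ + sum s₁ < u₂
      v₁<u₂ = ≤-trans (≤-reflexive (trans (cong suc (cong (u₁ +_) (sum-ones α))) (+-comm 1 _))) (+-monoʳ-≤ (j + a + α) b≥1)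
      win : u₂ + sum s₂ < ℓ + u₁
      win = ≤-trans (≤-reflexive (trans (cong suc end₂) (sym (+-suc ℓ j)))) (+-monoʳ-≤ ℓ (≤-trans (≤-reflexive (+-comm 1 j)) (+-monoʳ-≤ j a≥1)))
      lens : length ups + length dns ≡ m
      lens = trans (cong₂ (λ x y → suc x + suc y) (trans (length-upt u₁ s₁) (length-replicate α)) (trans (length-upt u₂ s₂) (length-replicate β)))
               (trans (lem α β) em)
        where lem : ∀ x y → suc x + suc y ≡ x + y + 2
              lem = solve-∀
      back : Seg A (z (u₁ + sum s₁)) (reverse (map z (upt u₂ s₂))) (z u₂)
      back = Seg-rev sy (map z (upt u₂ s₂)) (subst (λ l → Seg A (z u₂) l (z (u₁ + sum s₁))) (++-identityʳ _)
               (Seg-up u₂ s₂ (Red-ones u₂ β) (trans (cong₂ A (trans (cong z end₂) (per j)) (cong z end₁)) c₁)))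
      cyc : Cyc A L
      cyc = Seg-up u₁ s₁ (Red-ones u₁ α) (Seg-join (reverse (map z (upt u₂ s₂))) back
              (trans (sy _ _) (trans (cong (λ k → A (z u₁) (z k)) (sym (lem j a α b))) c₂)))
        where lem : ∀ j a α b → j + a + (α + b) ≡ j + a + α + b
              lem = solve-∀

    reds : ℕ → List ℕ → ℕ
    reds j [] = 0
    reds j (s ∷ ss) = ⟦ chord j s ⟧ + reds (j + s) ss

    reds≤ : ∀ j ss → reds j ss ≤ length ss
    reds≤ j [] = z≤n
    reds≤ j (s ∷ ss) = +-mono-≤ (⟦⟧≤1 (chord j s)) (reds≤ (j + s) ss)

    ¬Red-reds : ∀ j ss → (Red j ss → ⊥) → suc (reds j ss) ≤ length ss
    ¬Red-reds j [] n = ⊥-elim (n tt)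
    ¬Red-reds j (s ∷ ss) n with chord j s
    ... | false = s≤s (reds≤ (j + s) ss)
    ... | true = s≤s (¬Red-reds (j + s) ss (λ r → n (refl , r)))

    reds-sum : ∀ ss o → sumTo ℓ (λ j → reds (j + o) ss) ≡ ∑ ss ρ
    reds-sum [] o = trans (sumTo-const ℓ 0) (*-zeroʳ ℓ)
    reds-sum (s ∷ ss) o = trans (sumTo-+ ℓ _ _) (cong₂ _+_ (ρ-shift o s)
      (trans (sumTo-cong ℓ (λ j _ → cong (λ k → reds k ss) (+-assoc j o s))) (reds-sum ss (o + s))))

    -- Double counting: at each of the ℓ starting points at least one of the m chords is missing,
    -- and over all starting points the chord at a fixed place of the pattern runs through every
    -- rotation of itself.
    forward-ρ : ∀ t ss → All (1 ≤_) (t ∷ ss) → sum (t ∷ ss) ≡ ℓ → length (t ∷ ss) ≡ m → ∑ (t ∷ ss) ρ + ℓ ≤ m * ℓ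
    forward-ρ t ss a e lm = begin
      ∑ (t ∷ ss) ρ + ℓ                                              ≡⟨ cong₂ _+_ (sym (reds-sum (t ∷ ss) 0)) (sym (trans (sumTo-const ℓ 1) (*-identityʳ ℓ))) ⟩
      sumTo ℓ (λ j → reds (j + 0) (t ∷ ss)) + sumTo ℓ (λ _ → 1)     ≡⟨ sym (sumTo-+ ℓ _ _) ⟩
      sumTo ℓ (λ j → reds (j + 0) (t ∷ ss) + 1)                     ≤⟨ sumTo-bound ℓ m (λ j _ → ≤-trans (≤-reflexive (+-comm _ 1))
                                                                         (≤-trans (¬Red-reds (j + 0) (t ∷ ss) (forward (j + 0) t ss a e lm)) (≤-reflexive lm))) ⟩
      ℓ * m                                                         ≡⟨ *-comm ℓ m ⟩
      m * ℓ ∎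
      where open ≤-Reasoning

    two-of : ∀ {x y : Bool} → (x ≡ true → y ≡ true → ⊥) → ⟦ x ⟧ + ⟦ y ⟧ ≤ 1
    two-of {true} {true} h = ⊥-elim (h refl refl)
    two-of {true} {false} h = ≤-refl
    two-of {false} {y} h = ⟦⟧≤1 y

    three-of : ∀ {x y w : Bool} → (x ≡ true → y ≡ true → ⊥) → (x ≡ true → w ≡ true → ⊥) → (y ≡ true → w ≡ true → ⊥) →
               ⟦ x ⟧ + (⟦ y ⟧ + ⟦ w ⟧) ≤ 1
    three-of {false} f g h = two-of h
    three-of {true} {true} f g h = ⊥-elim (f refl refl)
    three-of {true} {false} {true} f g h = ⊥-elim (g refl refl)
    three-of {true} {false} {false} f g h = ≤-refl

    crossing-ρ : ∀ a α b β → 1 ≤ a → 1 ≤ b → α + β + 2 ≡ m → a + α + b + β ≡ ℓ → ρ (a + α) + ρ (α + b) ≤ ℓ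
    crossing-ρ a α b β a≥1 b≥1 em eℓ = begin
      ρ (a + α) + ρ (α + b)                                         ≡⟨ cong (ρ (a + α) +_) (sym (ρ-shift a (α + b))) ⟩
      ρ (a + α) + sumTo ℓ (λ j → ⟦ chord (j + a) (α + b) ⟧)         ≡⟨ sym (sumTo-+ ℓ _ _) ⟩
      sumTo ℓ (λ j → ⟦ chord j (a + α) ⟧ + ⟦ chord (j + a) (α + b) ⟧)
        ≤⟨ sumTo-bound ℓ 1 (λ j _ → two-of (crossing j a α b β a≥1 b≥1 em eℓ)) ⟩
      ℓ * 1                                                         ≡⟨ *-identityʳ ℓ ⟩
      ℓ ∎
      where open ≤-Reasoning

    three-ρ : ∀ u v o o′ w → (∀ j → chord j u ≡ true → chord (j + o) v ≡ true → ⊥) →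
              (∀ j → chord j u ≡ true → chord (j + o′) w ≡ true → ⊥) →
              (∀ j → chord (j + o) v ≡ true → chord (j + o′) w ≡ true → ⊥) → ρ u + (ρ v + ρ w) ≤ ℓ
    three-ρ u v o o′ w f g h = begin
      ρ u + (ρ v + ρ w)
        ≡⟨ cong (ρ u +_) (cong₂ _+_ (sym (ρ-shift o v)) (sym (ρ-shift o′ w))) ⟩
      ρ u + (sumTo ℓ (λ j → ⟦ chord (j + o) v ⟧) + sumTo ℓ (λ j → ⟦ chord (j + o′) w ⟧))
        ≡⟨ cong (ρ u +_) (sym (sumTo-+ ℓ _ _)) ⟩
      ρ u + sumTo ℓ (λ j → ⟦ chord (j + o) v ⟧ + ⟦ chord (j + o′) w ⟧)
        ≡⟨ sym (sumTo-+ ℓ _ _) ⟩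
      sumTo ℓ (λ j → ⟦ chord j u ⟧ + (⟦ chord (j + o) v ⟧ + ⟦ chord (j + o′) w ⟧))
        ≤⟨ sumTo-bound ℓ 1 (λ j _ → three-of (f j) (g j) (h j)) ⟩
      ℓ * 1                                                         ≡⟨ *-identityʳ ℓ ⟩
      ℓ ∎
      where open ≤-Reasoning

    private
      ones : ℕ → List ℕ
      ones k = replicate k 1

      ones≥1 : ∀ k → All (1 ≤_) (ones k)
      ones≥1 k = replicate⁺ k ≤-refl

    -- The chords (j, j+e), (j, j+h+e+h) and (j+h+e, j+h+e+h+b) pairwise conflict; the last two have the same length
    -- up to complementation.
    triangle-ρ : ∀ h e b → 1 ≤ e → 1 ≤ b → h + h + 2 ≡ m → h + e + b + (h + h) ≡ ℓ → 2 * ρ (h + b) + ρ e ≤ ℓ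
    triangle-ρ h e b e≥1 b≥1 em eℓ = begin
      2 * ρ (h + b) + ρ e                       ≡⟨ lem₁ (ρ (h + b)) (ρ e) ⟩
      ρ e + (ρ (h + b) + ρ (h + b))             ≡⟨ cong (λ t → ρ e + (t + ρ (h + b))) (ρ-flip eq₁) ⟩
      ρ e + (ρ (a + h) + ρ (h + b))             ≤⟨ three-ρ e (a + h) 0 a (h + b) c₁ c₂ c₃ ⟩
      ℓ ∎
      where
      open ≤-Reasoning
      a : ℕ
      a = h + e
      lem₁ : ∀ x y → 2 * x + y ≡ y + (x + x)
      lem₁ = solve-∀
      eq₁ : a + h + (h + b) ≡ ℓ
      eq₁ = trans (lem h e b) eℓ
        where lem : ∀ h e b → h + e + h + (h + b) ≡ h + e + b + (h + h)
              lem = solve-∀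
      c₁ : ∀ j → chord j e ≡ true → chord (j + 0) (a + h) ≡ true → ⊥
      c₁ j p q = forward j e (ones (h + h) ++ (h + b) ∷ []) (e≥1 ∷ ++⁺ (ones≥1 (h + h)) (≤-trans b≥1 (m≤n+m b h) ∷ []))
        (trans (cong (e +_) (trans (sum-++ (ones (h + h)) _) (cong (_+ (h + b + 0)) (sum-ones (h + h))))) (trans (l₁ h e b) eℓ))
        (trans (cong suc (trans (length-++ (ones (h + h))) (cong (_+ 1) (length-replicate (h + h))))) (trans (l₂ h) em))
        (p , Red-++ (j + e) (ones (h + h)) (Red-ones (j + e) (h + h))
          (trans (cong (λ k → chord k (h + b)) (trans (cong (j + e +_) (sum-ones (h + h))) (l₃ j h e)))
             (trans (chord-flip eq₁ j) (subst (λ k → chord k (a + h) ≡ true) (+-identityʳ j) q)) , tt))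
        where
        l₁ : ∀ h e b → e + (h + h + (h + b + 0)) ≡ h + e + b + (h + h)
        l₁ = solve-∀
        l₂ : ∀ h → suc (h + h + 1) ≡ h + h + 2
        l₂ = solve-∀
        l₃ : ∀ j h e → j + e + (h + h) ≡ j + (h + e + h)
        l₃ = solve-∀
      c₂ : ∀ j → chord j e ≡ true → chord (j + a) (h + b) ≡ true → ⊥
      c₂ j p q = forward j e (ones h ++ (h + b) ∷ ones h) (e≥1 ∷ ++⁺ (ones≥1 h) (≤-trans b≥1 (m≤n+m b h) ∷ ones≥1 h))
        (trans (cong (e +_) (trans (sum-++ (ones h) _) (cong₂ (λ x y → x + (h + b + y)) (sum-ones h) (sum-ones h)))) (trans (l₁ h e b) eℓ))
        (trans (cong suc (trans (length-++ (ones h)) (cong₂ (λ x y → x + suc y) (length-replicate h) (length-replicate h)))) (trans (l₂ h) em))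
        (p , Red-++ (j + e) (ones h) (Red-ones (j + e) h)
          (trans (cong (λ k → chord k (h + b)) (trans (cong (j + e +_) (sum-ones h)) (l₃ j h e))) q , Red-ones _ h))
        where
        l₁ : ∀ h e b → e + (h + (h + b + h)) ≡ h + e + b + (h + h)
        l₁ = solve-∀
        l₂ : ∀ h → suc (h + suc h) ≡ h + h + 2
        l₂ = solve-∀
        l₃ : ∀ j h e → j + e + h ≡ j + (h + e)
        l₃ = solve-∀
      c₃ : ∀ j → chord (j + 0) (a + h) ≡ true → chord (j + a) (h + b) ≡ true → ⊥
      c₃ j p q = crossing j a h b h (≤-trans e≥1 (m≤n+m e h)) b≥1 em (trans (l₁ h e b) eℓ)
        (subst (λ k → chord k (a + h) ≡ true) (+-identityʳ j) p) q
        where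
        l₁ : ∀ h e b → h + e + h + b + h ≡ h + e + b + (h + h)
        l₁ = solve-∀

    -- The triangle of chords (0,3), (2,7), (6,12).
    triangle-8-15 : m ≡ 8 → ℓ ≡ 15 → ρ 3 + (ρ 5 + ρ 6) ≤ ℓ
    triangle-8-15 em eℓ = three-ρ 3 5 2 6 6
      (λ j p q → crossing (j + 2) 1 4 8 2 (s≤s z≤n) (s≤s z≤n) (sym em) (sym eℓ) q
         (trans (cong (λ k → chord k 12) (+-assoc j 2 1)) (trans (chord-flip (sym eℓ) j) p)))
      (λ j p q → forward j 3 (ones 3 ++ 6 ∷ ones 3) (s≤s z≤n ∷ ++⁺ (ones≥1 3) (s≤s z≤n ∷ ones≥1 3)) (sym eℓ) (sym em)
         (p , Red-++ (j + 3) (ones 3) (Red-ones (j + 3) 3) (trans (cong (λ k → chord k 6) (+-assoc j 3 3)) q , Red-ones _ 3)))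
      (λ j p q → crossing (j + 2) 4 1 5 5 (s≤s z≤n) (s≤s z≤n) (sym em) (sym eℓ) p
         (trans (cong (λ k → chord k 6) (+-assoc j 2 4)) q))

  at : V → List V → ℕ → V
  at e [] i = e
  at e (x ∷ xs) zero = x
  at e (x ∷ xs) (suc i) = at e xs i

  at-∈ : ∀ e xs i → i < length xs → at e xs i ∈ xs
  at-∈ e (x ∷ xs) zero _ = here refl
  at-∈ e (x ∷ xs) (suc i) (s≤s h) = there (at-∈ e xs i h)

  at-inj : ∀ e xs → Unique xs → ∀ i k → i < k → k < length xs → at e xs i ≢ at e xs k
  at-inj e (x ∷ xs) u zero (suc k) _ (s≤s h) eq = ∉-head u (subst (_∈ xs) (sym eq) (at-∈ e xs k h))
  at-inj e (x ∷ xs) u (suc i) (suc k) (s≤s l) (s≤s h) eq = at-inj e xs (Unique-tail u) i k l h eq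

  at-Seg : ∀ {A x y} xs → Seg A x xs y → ∀ i → i ≤ length xs → A (at y (x ∷ xs) i) (at y xs i) ≡ true
  at-Seg [] s zero z≤n = s
  at-Seg (w ∷ xs) (p , s) zero _ = p
  at-Seg (w ∷ xs) (p , s) (suc i) (s≤s h) = at-Seg xs s i h

  at-end : ∀ e xs → at e xs (length xs) ≡ e
  at-end e [] = refl
  at-end e (x ∷ xs) = at-end e xs

  ∑-at : ∀ e xs f → ∑ xs f ≡ sumTo (length xs) (λ i → f (at e xs i))
  ∑-at e [] f = refl
  ∑-at e (x ∷ xs) f = cong (f x +_) (∑-at e xs f)

  module _ {A : Rel} (sy : Symm A) (ir : Irr A) {m : ℕ} where

    private
      module OfCycle (x : V) (xs : List V) (cy : Cyc A (x ∷ xs)) (u : Unique (x ∷ xs))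
        (noC : ∀ L → Cyc A L → Unique L → (∀ {y} → y ∈ L → y ∈ x ∷ xs) → length L ≢ m) where
        ℓ : ℕ
        ℓ = suc (length xs)
        C : List V
        C = x ∷ xs
        z : ℕ → V
        z i = at x C (i % ℓ)
        per : ∀ i → z (ℓ + i) ≡ z i
        per i = cong (at x C) (trans (cong (_% ℓ) (+-comm ℓ i)) ([m+n]%n≡m%n i ℓ))
        adj : ∀ i → A (z i) (z (suc i)) ≡ true
        adj i = subst (λ v → A (z i) v ≡ true) next (at-Seg xs cy (i % ℓ) (≤-pred (m%n<n i ℓ)))
          where
          dec : suc i ≡ suc (i % ℓ) + (i / ℓ) * ℓ
          dec = cong suc (m≡m%n+[m/n]*n i ℓ)
          next : at x xs (i % ℓ) ≡ z (suc i)
          next with m≤n⇒m<n∨m≡n (m%n<n i ℓ)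
          ... | inj₁ lt = cong (at x C) (sym (trans (cong (_% ℓ) dec) (trans ([m+kn]%n≡m%n (suc (i % ℓ)) (i / ℓ) ℓ) (m<n⇒m%n≡m lt))))
          ... | inj₂ e = trans (cong (at x xs) (suc-injective e)) (trans (at-end x xs)
                (cong (at x C) (sym (trans (cong (_% ℓ) (trans dec (cong (_+ (i / ℓ) * ℓ) e))) (m*n%n≡0 (suc (i / ℓ)) ℓ)))))
        inj : ∀ i k → i < k → k < ℓ + i → z i ≢ z k
        inj i k i<k k< e with <-cmp (i % ℓ) (k % ℓ)
        ... | tri< l _ _ = at-inj x C u (i % ℓ) (k % ℓ) l (m%n<n k ℓ) e
        ... | tri> _ _ g = at-inj x C u (k % ℓ) (i % ℓ) g (m%n<n i ℓ) (sym e)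
        ... | tri≈ _ eq _ = <⇒≱ k< (begin
              ℓ + i                          ≡⟨ cong (ℓ +_) (m≡m%n+[m/n]*n i ℓ) ⟩
              ℓ + (i % ℓ + (i / ℓ) * ℓ)      ≡⟨ lem ℓ (i % ℓ) (i / ℓ) ⟩
              i % ℓ + suc (i / ℓ) * ℓ        ≤⟨ +-mono-≤ (≤-reflexive eq) (*-monoˡ-≤ ℓ q<) ⟩
              k % ℓ + (k / ℓ) * ℓ            ≡⟨ sym (m≡m%n+[m/n]*n k ℓ) ⟩
              k ∎)
          where
          open ≤-Reasoning
          lem : ∀ a b c → a + (b + c * a) ≡ b + suc c * a
          lem = solve-∀
          q< : i / ℓ < k / ℓ
          q< = ≰⇒> λ h → <⇒≱ i<k (≤-trans (≤-reflexive (m≡m%n+[m/n]*n k ℓ))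
                 (≤-trans (+-mono-≤ (≤-reflexive (sym eq)) (*-monoˡ-≤ ℓ h)) (≤-reflexive (sym (m≡m%n+[m/n]*n i ℓ)))))
        nocyc : ∀ L → Cyc A L → Unique L → (∀ {y} → y ∈ L → ∃[ i ] y ≡ z i) → length L ≢ m
        nocyc L cL uL L⊆ = noC L cL uL λ y∈ → let i , e = L⊆ y∈ in subst (_∈ C) (sym e) (at-∈ x C (i % ℓ) (m%n<n i ℓ))

        module R = Rotation A sy ℓ m z per adj inj nocyc

        z-at : ∀ i → i < ℓ → z i ≡ at x C i
        z-at i h = cong (at x C) (m<n⇒m%n≡m h)

        ∑-z : ∀ f → ∑ C f ≡ sumTo ℓ (f ∘ z)
        ∑-z f = trans (∑-at x C f) (sumTo-cong ℓ (λ i h → cong f (sym (z-at i h))))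

        sumTo-swap : ∀ a b (f : ℕ → ℕ → ℕ) → sumTo a (λ i → sumTo b (f i)) ≡ sumTo b (λ k → sumTo a (λ i → f i k))
        sumTo-swap zero b f = sym (trans (sumTo-const b 0) (*-zeroʳ b))
        sumTo-swap (suc a) b f = trans (cong (sumTo b (f 0) +_) (sumTo-swap a b (f ∘ suc))) (sym (sumTo-+ b _ _))

        E-ρ : E A C C ≡ sumTo ℓ R.ρ
        E-ρ = trans (∑-z _) (trans (sumTo-cong ℓ row) (sumTo-swap ℓ ℓ (λ i w → ⟦ A (z i) (z (i + w)) ⟧)))
          where
          row : ∀ i → i < ℓ → ∑ C (λ y → ⟦ A (z i) y ⟧) ≡ sumTo ℓ (λ w → ⟦ A (z i) (z (i + w)) ⟧)
          row i _ = trans (∑-z _) (trans (sym (sumTo-periodic ℓ (λ k → ⟦ A (z i) (z k) ⟧) (λ k → cong (λ v → ⟦ A (z i) v ⟧) (per k)) i))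
                      (sumTo-cong ℓ (λ w _ → cong (λ k → ⟦ A (z i) (z k) ⟧) (+-comm w i))))

        chords : Chords m ℓ R.ρ
        chords = record
          { ρ0 = trans (sumTo-cong ℓ (λ j _ → cong ⟦_⟧ (trans (cong (λ k → A (z j) (z k)) (+-identityʳ j)) (ir (z j))))) (trans (sumTo-const ℓ 0) (*-zeroʳ ℓ))
          ; ρ1 = R.ρ1 ; ρ≤ = R.ρ≤ℓ ; flip = R.ρ-flip ; fwd = R.forward-ρ ; cross = R.crossing-ρ ; tri = R.triangle-ρ
          ; tri-8-15 = R.triangle-8-15 }

    -- The alternatives are a longest cycle shorter than m, or no cycle at all, and a longest cycle
    -- longer than m. In the short case `E-self` and `outside-edges` add up to ℓ(n - 1).
    degree-sum : ∀ W → Unique W → (∀ L → Cycle-in A W L → length L ≢ m) →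
      ¬ ¬ (E A W W ≤ (m ∸ 1) * (length W ∸ 1) ⊎
           ∃[ ℓ ] ∃[ ρ ] (m < ℓ × ℓ ≤ length W × Chords m ℓ ρ × E A W W ≤ sumTo ℓ ρ + ℓ * (length W ∸ ℓ)))
    degree-sum W uW noC k = em (∃[ L ] Cycle-in A W L) cases
      where
      n : ℕ
      n = length W
      long : ∀ C → Cyc A C → Unique C → (∀ {x} → x ∈ C → x ∈ W) → NoLong A W (length C) → ⊥
      long (x ∷ xs) cy u C⊆ nl with Z , p ← ⊆-↭ (x ∷ xs) u C⊆ = by-cmp (<-cmp (suc (length xs)) m)
        where
        module O = OfCycle x xs cy u (λ L cL uL L⊆ → noC L (cL , uL , λ y∈ → C⊆ (L⊆ y∈)))
        open O using (ℓ; C)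
        n≡ : n ≡ ℓ + length Z
        n≡ = trans (↭-length p) (length-++ C)
        ℓ≤n : ℓ ≤ n
        ℓ≤n = ≤-trans (m≤m+n ℓ (length Z)) (≤-reflexive (sym n≡))
        Z≡ : length Z ≡ n ∸ ℓ
        Z≡ = sym (trans (cong (_∸ ℓ) n≡) (m+n∸m≡n ℓ (length Z)))
        bound : E A W W ≤ E A C C + ℓ * length Z
        bound = ≤-trans (≤-reflexive (trans (E-↭ A p) (E-++ sy C Z))) (+-monoʳ-≤ (E A C C)
          (outside-edges (length Z) sy ir C Z ≤-refl cy (Unique-↭ p uW) (λ N cN uN N⊆ → nl N cN uN (λ x∈ → ∈-resp-↭ (↭-sym p) (N⊆ x∈)))))
        by-cmp : Tri (ℓ < m) (ℓ ≡ m) (m < ℓ) → ⊥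
        by-cmp (tri≈ _ e _) = noC C (cy , u , C⊆) e
        by-cmp (tri> _ _ g) = k (inj₂ (ℓ , O.R.ρ , g , ℓ≤n , O.chords ,
          ≤-trans bound (≤-reflexive (cong₂ (λ s t → s + ℓ * t) O.E-ρ Z≡))))
        by-cmp (tri< l _ _) = k (inj₁ (begin
          E A W W                     ≤⟨ bound ⟩
          E A C C + ℓ * length Z      ≤⟨ +-cancelʳ-≤ ℓ _ _ short ⟩
          ℓ * (n ∸ 1)                 ≤⟨ *-monoˡ-≤ (n ∸ 1) (∸-monoˡ-≤ 1 l) ⟩
          (m ∸ 1) * (n ∸ 1) ∎))
          where
          open ≤-Reasoning
          short : E A C C + ℓ * length Z + ℓ ≤ ℓ * (n ∸ 1) + ℓ
          short = begin
            E A C C + ℓ * length Z + ℓ       ≡⟨ l₁ (E A C C) ℓ (length Z) ⟩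
            (E A C C + ℓ) + ℓ * length Z     ≤⟨ +-monoˡ-≤ (ℓ * length Z) (E-self {A} ir C) ⟩
            ℓ * ℓ + ℓ * length Z             ≡⟨ l₂ (length xs) (length Z) ⟩
            ℓ * (length xs + length Z) + ℓ   ≡⟨ cong (λ t → ℓ * (t ∸ 1) + ℓ) (sym n≡) ⟩
            ℓ * (n ∸ 1) + ℓ ∎
            where
            l₁ : ∀ e m z → e + m * z + m ≡ (e + m) + m * z
            l₁ = solve-∀
            l₂ : ∀ a z → suc a * suc a + suc a * z ≡ suc a * (a + z) + suc a
            l₂ = solve-∀
      cases : (∃[ L ] Cycle-in A W L) ⊎ ¬ (∃[ L ] Cycle-in A W L) → ⊥
      cases (inj₂ none) = k (inj₁ (≤-trans (≤-reflexive (acyclic-E sy ir none)) z≤n))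
      cases (inj₁ (L , cL)) = longest-cycle cL λ { (M , (cM , uM , M⊆) , nl) → long M cM uM M⊆ nl }

open module FinGraphs {N : ℕ} = Graphs {Fin N} FP._≟_

-- The format of most numerical arguments below: the hypotheses are added up to L ≤ R, `s` is the
-- slack, and the equation, an identity for the ring solver, says Y - X = R - L + s.
linear : ∀ {L R} X Y s → L ≤ R → X + R + s ≡ Y + L → X ≤ Y
linear {L} {R} X Y s h e = +-cancelʳ-≤ R X Y (≤-trans (≤-trans (m≤m+n (X + R) s) (≤-reflexive e)) (+-monoʳ-≤ Y h))

sumTo-* : ∀ n x f → x * sumTo n f ≡ sumTo n (λ i → x * f i)
sumTo-* zero x f = *-zeroʳ x
sumTo-* (suc n) x f = trans (*-distribˡ-+ x (f 0) _) (cong (x * f 0 +_) (sumTo-* n x (f ∘ suc)))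

sumTo-rev : ∀ n f → sumTo n f ≡ sumTo n (λ i → f (n ∸ suc i))
sumTo-rev zero f = refl
sumTo-rev (suc n) f = trans (sumTo-snoc n f) (trans (+-comm (sumTo n f) (f n)) (cong (f n +_) (sumTo-rev n f)))

-- One sum is read upwards and the other downwards, so that chord lengths with a constant sum meet.
sumTo-pair : ∀ n x {f g} c → (∀ i j → i + suc j ≡ n → x * f i + g j ≤ c) → x * sumTo n f + sumTo n g ≤ n * c
sumTo-pair n x {f} {g} c h = begin
  x * sumTo n f + sumTo n g                              ≡⟨ cong₂ _+_ (sumTo-* n x f) (sumTo-rev n g) ⟩
  sumTo n (λ i → x * f i) + sumTo n (λ i → g (n ∸ suc i)) ≡⟨ sym (sumTo-+ n _ _) ⟩
  sumTo n (λ i → x * f i + g (n ∸ suc i))                ≤⟨ sumTo-bound n c (λ i i< → h i (n ∸ suc i) (trans (+-suc i _) (m+[n∸m]≡n i<))) ⟩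
  n * c ∎
  where open ≤-Reasoning

-- Only the k samples o, o + 2, ... are kept; each of the other n - k terms is at most c.
sumTo-skip : ∀ k n o f c → (∀ i → f i ≤ c) → o + 2 * k ≤ suc n → sumTo n f + k * c ≤ sumTo k (λ i → f (o + 2 * i)) + n * c
sumTo-skip zero n o f c h le = ≤-trans (≤-reflexive (+-identityʳ _)) (sumTo-bound n c (λ i _ → h i))
sumTo-skip (suc k) n o f c h le = begin
  sumTo n f + suc k * c
    ≡⟨ cong (λ t → sumTo t f + suc k * c) (sym n≡) ⟩
  sumTo (o + suc r) f + suc k * c
    ≡⟨ cong (_+ suc k * c) (sumTo-split o (suc r) f) ⟩
  sumTo o f + (f (o + 0) + sumTo r g) + suc k * c
    ≡⟨ l₁ (sumTo o f) (f (o + 0)) (sumTo r g) c (k * c) ⟩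
  f (o + 0) + (sumTo o f + c) + (sumTo r g + k * c)
    ≤⟨ +-mono-≤ (+-monoʳ-≤ (f (o + 0)) (+-monoˡ-≤ c (sumTo-bound o c (λ i _ → h i))))
         (sumTo-skip k r 1 g c (λ i → h (o + suc i)) bnd) ⟩
  f (o + 0) + (o * c + c) + (sumTo k (λ i → g (1 + 2 * i)) + r * c)
    ≡⟨ l₂ (f (o + 0)) (sumTo k (λ i → g (1 + 2 * i))) o r c ⟩
  f (o + 0) + sumTo k (λ i → g (1 + 2 * i)) + (o + suc r) * c
    ≡⟨ cong₂ (λ s t → f (o + 0) + s + t * c) (sumTo-cong k (λ i _ → cong f (cong (o +_) (l₃ i)))) n≡ ⟩
  sumTo (suc k) (λ i → f (o + 2 * i)) + n * c ∎
  where
  open ≤-Reasoning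
  l₁ : ∀ a b d c e → a + (b + d) + (c + e) ≡ b + (a + c) + (d + e)
  l₁ = solve-∀
  l₂ : ∀ a s o r c → a + (o * c + c) + (s + r * c) ≡ a + s + (o + suc r) * c
  l₂ = solve-∀
  l₃ : ∀ i → suc (1 + 2 * i) ≡ 2 * suc i
  l₃ = solve-∀
  l₄ : ∀ o k → o + 2 * suc k ≡ suc (suc (o + 2 * k))
  l₄ = solve-∀
  r : ℕ
  r = n ∸ suc o
  o<n : suc o ≤ n
  o<n = ≤-pred (≤-trans (s≤s (s≤s (m≤m+n o (2 * k)))) (≤-trans (≤-reflexive (sym (l₄ o k))) le))
  n≡ : o + suc r ≡ n
  n≡ = trans (+-suc o r) (m+[n∸m]≡n o<n)
  g : ℕ → ℕ
  g i = f (o + suc i)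
  bnd : 1 + 2 * k ≤ suc r
  bnd = +-cancelˡ-≤ o _ _ (≤-pred (≤-trans (≤-reflexive (trans (cong suc (+-suc o (2 * k))) (sym (l₄ o k)))) (≤-trans le (≤-reflexive (cong suc (sym n≡))))))

-- Inequalities between the numbers of chords of given lengths.

module Count {m ℓ : ℕ} {ρ : ℕ → ℕ} (ch : Chords m ℓ ρ) where
  open Chords ch public

  -- The k remaining steps follow the cycle itself; by `ρ1` their terms cancel on both sides.
  chords≤ : ∀ w ws k → All (1 ≤_) (w ∷ ws) → sum (w ∷ ws) + k ≡ ℓ → length (w ∷ ws) + k ≡ m → ∑ (w ∷ ws) ρ + ℓ ≤ length (w ∷ ws) * ℓ
  chords≤ w ws k a es el = +-cancelʳ-≤ (k * ℓ) _ _ (begin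
      ∑ (w ∷ ws) ρ + ℓ + k * ℓ                          ≡⟨ l₁ (∑ (w ∷ ws) ρ) ℓ (k * ℓ) ⟩
      ∑ (w ∷ ws) ρ + k * ℓ + ℓ                          ≡⟨ cong (λ t → ∑ (w ∷ ws) ρ + t + ℓ) (sym ones) ⟩
      ∑ (w ∷ ws) ρ + ∑ (replicate k 1) ρ + ℓ            ≡⟨ cong (_+ ℓ) (sym (∑-++ (w ∷ ws) (replicate k 1) ρ)) ⟩
      ∑ (w ∷ ws ++ replicate k 1) ρ + ℓ                 ≤⟨ fwd w (ws ++ replicate k 1) (++⁺ a (replicate⁺ k ≤-refl))
             (trans (sum-++ (w ∷ ws) (replicate k 1)) (trans (cong (sum (w ∷ ws) +_) (sum-ones k)) es))
             (trans (length-++ (w ∷ ws)) (trans (cong (length (w ∷ ws) +_) (length-replicate k)) el)) ⟩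
      m * ℓ                                             ≡⟨ cong (_* ℓ) (sym el) ⟩
      (length (w ∷ ws) + k) * ℓ                         ≡⟨ *-distribʳ-+ ℓ (length (w ∷ ws)) k ⟩
      length (w ∷ ws) * ℓ + k * ℓ ∎)
    where
    open ≤-Reasoning
    l₁ : ∀ a b c → a + b + c ≡ a + c + b
    l₁ = solve-∀
    ones : ∑ (replicate k 1) ρ ≡ k * ℓ
    ones = go k
      where
      go : ∀ k → ∑ (replicate k 1) ρ ≡ k * ℓ
      go zero = refl
      go (suc k) = cong₂ _+_ ρ1 (go k)

  S : ℕ
  S = sumTo ℓ ρ

  σ : ℕ → ℕ → ℕ
  σ a k = sumTo k (λ i → ρ (a + i))

  σ-split : ∀ a k l → σ a (k + l) ≡ σ a k + σ (a + k) l
  σ-split a k l = trans (sumTo-split k l _) (cong (σ a k +_) (sumTo-cong l (λ i _ → cong ρ (sym (+-assoc a k i)))))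

  σ≤ : ∀ a k → σ a k ≤ k * ℓ
  σ≤ a k = sumTo-bound k ℓ (λ i _ → ρ≤ (a + i))

  module Even (p : ℕ) (em : m ≡ suc p + suc p) where

    -- Two long steps and 2p steps along the cycle.
    pair : ∀ w w′ → w + w′ + (p + p) ≡ ℓ → 1 ≤ w → 1 ≤ w′ → ρ w + ρ w′ ≤ ℓ
    pair w w′ e w≥1 w′≥1 = +-cancelʳ-≤ ℓ _ _ (≤-trans (≤-reflexive (l₁ (ρ w) (ρ w′) ℓ))
        (≤-trans (chords≤ w (w′ ∷ []) (p + p) (w≥1 ∷ w′≥1 ∷ []) (trans (cong (λ t → w + t + (p + p)) (+-identityʳ w′)) e) (trans (l₂ p) (sym em)))
          (≤-reflexive (l₃ ℓ))))
      where
      l₁ : ∀ a b c → a + b + c ≡ a + (b + 0) + c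
      l₁ = solve-∀
      l₂ : ∀ p → 2 + (p + p) ≡ suc p + suc p
      l₂ = solve-∀
      l₃ : ∀ c → 2 * c ≡ c + c
      l₃ = solve-∀

    -- Three long steps, two of them equal, and 2p - 1 steps along the cycle.
    double : ∀ a b → 1 ≤ p → 1 ≤ a → 1 ≤ b → 2 * a + b + (p + p) ≡ suc ℓ → 2 * ρ a + ρ b ≤ 2 * ℓ
    double a b (s≤s {n = p′} z≤n) a≥1 b≥1 e = +-cancelʳ-≤ ℓ _ _ (≤-trans (≤-reflexive (l₁ (ρ a) (ρ b) ℓ))
        (≤-trans (chords≤ a (a ∷ b ∷ []) (p′ + p) (a≥1 ∷ a≥1 ∷ b≥1 ∷ []) (suc-injective (trans (l₂ a b p′) e)) (trans (l₄ p′) (sym em)))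
          (≤-reflexive (l₃ ℓ))))
      where
      l₁ : ∀ a b c → 2 * a + b + c ≡ a + (a + (b + 0)) + c
      l₁ = solve-∀
      l₂ : ∀ a b p → suc (a + (a + (b + 0)) + (p + suc p)) ≡ 2 * a + b + (suc p + suc p)
      l₂ = solve-∀
      l₄ : ∀ p → 3 + (p + suc p) ≡ suc (suc p) + suc (suc p)
      l₄ = solve-∀
      l₃ : ∀ c → 3 * c ≡ 2 * c + c
      l₃ = solve-∀

    -- Crossing chords with a = 1; the second one, of length α + b, is complementary to length β +
    -- 1.
    opposite : ∀ b α β → 1 ≤ b → 1 + α + b + β ≡ ℓ → α + β ≡ p + p → ρ (suc α) + ρ (suc β) ≤ ℓ
    opposite b α β b≥1 e ab = ≤-trans (≤-reflexive (cong (ρ (suc α) +_) (flip (trans (l₁ α b β) e))))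
        (cross 1 α b β ≤-refl b≥1 (trans (cong (_+ 2) ab) (trans (l₂ p) (sym em))) e)
      where
      l₁ : ∀ α b β → α + b + suc β ≡ 1 + α + b + β
      l₁ = solve-∀
      l₂ : ∀ p → p + p + 2 ≡ suc p + suc p
      l₂ = solve-∀

    triangle : ∀ b e → 1 ≤ b → 1 ≤ e → p + e + b + (p + p) ≡ ℓ → 2 * ρ (p + b) + ρ e ≤ ℓ
    triangle b e b≥1 e≥1 eq = tri p e b e≥1 b≥1 (trans (l₂ p) (sym em)) eq
      where
      l₂ : ∀ p → p + p + 2 ≡ suc p + suc p
      l₂ = solve-∀

    -- q is the number of classes below the shortest chord of weight ℓ − 2p.
    module Width (q : ℕ) (eℓ : ℓ ≡ suc q + (p + p)) where

      -- Complementation turns the lengths from q + 1 to ℓ - 1 into those from 2p down to 1.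
      S-split : S ≡ σ 1 q + σ 1 (p + p)
      S-split = begin
        sumTo ℓ ρ                                       ≡⟨ cong (λ t → sumTo t ρ) eℓ ⟩
        ρ 0 + sumTo (q + (p + p)) (ρ ∘ suc)             ≡⟨ cong₂ _+_ ρ0 (sumTo-split q (p + p) (ρ ∘ suc)) ⟩
        σ 1 q + sumTo (p + p) (λ i → ρ (suc (q + i)))   ≡⟨ cong (σ 1 q +_) (trans (sumTo-rev (p + p) _) (sumTo-cong (p + p) mirror)) ⟩
        σ 1 q + σ 1 (p + p) ∎
        where
        open ≡-Reasoning
        mirror : ∀ i → i < p + p → ρ (suc (q + (p + p ∸ suc i))) ≡ ρ (1 + i)
        mirror i h = flip (trans (l i q (p + p ∸ suc i)) (trans (cong (λ t → suc q + t) (m+[n∸m]≡n h)) (sym eℓ)))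
          where l : ∀ i q r → 1 + i + suc (q + r) ≡ suc q + (suc i + r)
                l = solve-∀

      low : 2 * σ 1 q ≤ q * ℓ
      low = ≤-trans (≤-reflexive (l₁ (σ 1 q))) (sumTo-pair q 1 ℓ (λ i j e →
              ≤-trans (≤-reflexive (cong (_+ ρ (suc j)) (+-identityʳ _))) (pair (suc i) (suc j) (trans (cong (_+ (p + p)) (cong suc e)) (sym eℓ)) (s≤s z≤n) (s≤s z≤n))))
        where
        l₁ : ∀ x → 2 * x ≡ 1 * x + x
        l₁ = solve-∀

      -- Length 1 has no partner and contributes ℓ in full; the lengths from 2 to 2p are paired by
      -- `opposite` to the sum 2p + 2.
      high : 1 ≤ p → 1 ≤ q → 2 * σ 1 (p + p) ≤ suc (p + p) * ℓ
      high (s≤s {n = p′} z≤n) q≥1 = begin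
        2 * (ρ 1 + X)              ≡⟨ cong (λ t → 2 * (t + X)) ρ1 ⟩
        2 * (ℓ + X)                ≡⟨ l₁ ℓ X ⟩
        2 * ℓ + (1 * X + X)        ≤⟨ +-monoʳ-≤ (2 * ℓ) (sumTo-pair (p′ + p) 1 ℓ (λ i j e → ≤-trans (≤-reflexive (cong (_+ ρ (2 + j)) (+-identityʳ _)))
                                        (opposite q (suc i) (suc j) q≥1 (trans (l₂ i j q) (trans (cong (λ t → 2 + q + t) e) (trans (l₃ q p′) (sym eℓ)))) (cong suc e)))) ⟩
        2 * ℓ + (p′ + p) * ℓ       ≡⟨ l₄ ℓ (p′ + p) ⟩
        suc (p + p) * ℓ ∎
        where
        open ≤-Reasoning
        X : ℕ
        X = σ 2 (p′ + p)
        l₁ : ∀ a x → 2 * (a + x) ≡ 2 * a + (1 * x + x)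
        l₁ = solve-∀
        l₂ : ∀ i j q → 1 + suc i + q + suc j ≡ 2 + q + (i + suc j)
        l₂ = solve-∀
        l₃ : ∀ q r → 2 + q + (r + suc r) ≡ suc q + (suc r + suc r)
        l₃ = solve-∀
        l₄ : ∀ c r → 2 * c + r * c ≡ suc (suc r) * c
        l₄ = solve-∀

      -- The edge bound of Bondy's pancyclicity theorem for the even length m: a Hamiltonian graph
      -- on ℓ vertices without a cycle of length m has at most ℓ²/4 edges.
      bondy : 1 ≤ p → 1 ≤ q → 2 * S ≤ ℓ * ℓ
      bondy p≥1 q≥1 = begin
        2 * S                            ≡⟨ cong (2 *_) S-split ⟩
        2 * (σ 1 q + σ 1 (p + p))        ≡⟨ *-distribˡ-+ 2 (σ 1 q) _ ⟩
        2 * σ 1 q + 2 * σ 1 (p + p)      ≤⟨ +-mono-≤ low (high p≥1 q≥1) ⟩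
        q * ℓ + suc (p + p) * ℓ          ≡⟨ l₁ q (p + p) ℓ ⟩
        (suc q + (p + p)) * ℓ            ≡⟨ cong (_* ℓ) (sym eℓ) ⟩
        ℓ * ℓ ∎
        where
        open ≤-Reasoning
        l₁ : ∀ q r c → q * c + suc r * c ≡ (suc q + r) * c
        l₁ = solve-∀

    -- In `double` the length b rises by 2 when a falls by 1, so the k topmost lengths of the window
    -- meet k lengths in steps of 2. The deficit vℓ - V of the window is at least kℓ - Top and at
    -- least kℓ - Alt; twice the first plus the second is at least kℓ.
    near : ∀ lo v o k → k ≤ v → o + 2 * k ≤ suc v →
           (∀ i → i < k → 2 * ρ (lo + (v ∸ suc i)) + ρ (lo + (o + 2 * i)) ≤ 2 * ℓ) → 3 * σ lo v + k * ℓ ≤ 3 * v * ℓ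
    near lo v o k k≤v le h = linear (3 * V + k * ℓ) (3 * v * ℓ) 0
        (+-mono-≤ (+-mono-≤ (*-monoʳ-≤ 2 fromTop) skipped) both)
        (l₁ V Top Alt k v ℓ)
      where
      open ≤-Reasoning
      V Top Alt : ℕ
      V = σ lo v
      Top = sumTo k (λ i → ρ (lo + (v ∸ suc i)))
      Alt = sumTo k (λ i → ρ (lo + (o + 2 * i)))
      fromTop : V + k * ℓ ≤ Top + v * ℓ
      fromTop = begin
        V + k * ℓ                                        ≡⟨ cong (_+ k * ℓ) (sumTo-rev v _) ⟩
        sumTo v f + k * ℓ                                ≡⟨ cong (λ t → sumTo t f + k * ℓ) (sym (m+[n∸m]≡n k≤v)) ⟩
        sumTo (k + (v ∸ k)) f + k * ℓ                    ≡⟨ cong (_+ k * ℓ) (sumTo-split k (v ∸ k) f) ⟩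
        Top + sumTo (v ∸ k) (λ i → f (k + i)) + k * ℓ      ≤⟨ +-monoˡ-≤ (k * ℓ) (+-monoʳ-≤ Top (sumTo-bound (v ∸ k) ℓ (λ i _ → ρ≤ _))) ⟩
        Top + (v ∸ k) * ℓ + k * ℓ                          ≡⟨ l₂ Top (v ∸ k) k ℓ ⟩
        Top + (k + (v ∸ k)) * ℓ                            ≡⟨ cong (λ t → Top + t * ℓ) (m+[n∸m]≡n k≤v) ⟩
        Top + v * ℓ ∎
        where
        f : ℕ → ℕ
        f i = ρ (lo + (v ∸ suc i))
        l₂ : ∀ t a k c → t + a * c + k * c ≡ t + (k + a) * c
        l₂ = solve-∀
      skipped : V + k * ℓ ≤ Alt + v * ℓ
      skipped = sumTo-skip k v o (λ i → ρ (lo + i)) ℓ (λ i → ρ≤ _) le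
      both : 2 * Top + Alt ≤ 2 * k * ℓ
      both = begin
        2 * Top + Alt                  ≡⟨ cong (_+ Alt) (sumTo-* k 2 _) ⟩
        sumTo k (λ i → 2 * ρ (lo + (v ∸ suc i))) + Alt ≡⟨ sym (sumTo-+ k _ _) ⟩
        sumTo k (λ i → 2 * ρ (lo + (v ∸ suc i)) + ρ (lo + (o + 2 * i))) ≤⟨ sumTo-bound k (2 * ℓ) h ⟩
        k * (2 * ℓ)                ≡⟨ l₃ k ℓ ⟩
        2 * k * ℓ ∎
        where l₃ : ∀ k c → k * (2 * c) ≡ 2 * k * c
              l₃ = solve-∀
      l₁ : ∀ V Top Alt k v c → 3 * V + k * c + (2 * (Top + v * c) + (Alt + v * c) + 2 * k * c) + 0 ≡ 3 * v * c + (2 * (V + k * c) + (V + k * c) + (2 * Top + Alt))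
      l₁ = solve-∀

-- Average degree on a long cycle.

module Bounds {m ℓ : ℕ} {ρ : ℕ → ℕ} (ch : Chords m ℓ ρ) (p : ℕ) (em : m ≡ suc p + suc p) (p≥1 : 1 ≤ p) where
  open Count ch
  open Even p em

  -- The range ℓ > 4p. The q = 2p + g lengths of `low` are cut into p near ones, g middle ones and p
  -- far ones.
  module Wide (g : ℕ) (eℓ : ℓ ≡ suc g + 4 * p) where
    -- The condition for k uses of `double` with a = p - i and b = g + 2 + 2i, i < k, to stay among
    -- the lengths up to p.
    Fits : ℕ → Set
    Fits k = k ≡ 0 ⊎ (k ≤ p × g + 2 * k ≤ p)
    private
      q : ℕ
      q = p + g + p
      eq : ℓ ≡ suc q + (p + p)
      eq = trans eℓ (lem p g)
        where lem : ∀ p g → suc g + 4 * p ≡ suc (p + g + p) + (p + p)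
              lem = solve-∀
    open Width q eq using (S-split; high)

    private
      N O F : ℕ
      N = σ 1 p
      O = σ (suc p) g
      F = σ (suc (p + g)) p

      split : σ 1 q ≡ N + O + F
      split = trans (σ-split 1 (p + g) p) (cong (_+ F) (σ-split 1 p g))

      -- `triangle` joins the far length p + g + 1 + i to the near length p - i; in `mid` it joins
      -- the middle window to itself.
      far : 2 * F + N ≤ p * ℓ
      far = sumTo-pair p 2 ℓ λ i j e → ≤-trans (≤-reflexive (cong (λ t → 2 * ρ t + ρ (suc j)) (l₁ p g i)))
          (triangle (suc (g + i)) (suc j) (s≤s z≤n) (s≤s z≤n) (trans (l₂ p g i j) (trans (cong (λ t → suc g + 3 * p + t) e) (trans (l₃ p g) (sym eℓ)))))
        where
        l₁ : ∀ p g i → suc (p + g) + i ≡ p + suc (g + i)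
        l₁ = solve-∀
        l₂ : ∀ p g i j → p + suc j + suc (g + i) + (p + p) ≡ suc g + 3 * p + (i + suc j)
        l₂ = solve-∀
        l₃ : ∀ p g → suc g + 3 * p + p ≡ suc g + 4 * p
        l₃ = solve-∀

      mid : 2 * O + O ≤ g * ℓ
      mid = sumTo-pair g 2 ℓ λ i j e → ≤-trans (≤-reflexive (cong (λ t → 2 * ρ t + ρ (suc p + j)) (l₁ p i)))
          (triangle (suc i) (suc p + j) (s≤s z≤n) (s≤s z≤n) (trans (l₂ p i j) (trans (cong (λ t → 1 + 4 * p + t) e) (trans (l₃ p g) (sym eℓ)))))
        where
        l₁ : ∀ p i → suc p + i ≡ p + suc i
        l₁ = solve-∀
        l₂ : ∀ p i j → p + (suc p + j) + suc i + (p + p) ≡ 1 + 4 * p + (i + suc j)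
        l₂ = solve-∀
        l₃ : ∀ p g → 1 + 4 * p + g ≡ suc g + 4 * p
        l₃ = solve-∀

      q≥1 : 1 ≤ q
      q≥1 = ≤-trans p≥1 (m≤n+m p (p + g))

      shorts : ∀ k → Fits k → 3 * N + k * ℓ ≤ 3 * p * ℓ
      shorts k (inj₁ refl) = ≤-trans (≤-reflexive (+-identityʳ (3 * N))) (≤-trans (*-monoʳ-≤ 3 (σ≤ 1 p)) (≤-reflexive (sym (*-assoc 3 p ℓ))))
      shorts k (inj₂ (k≤p , le)) = near 1 p (suc g) k k≤p (s≤s le) λ i i< →
        double (1 + (p ∸ suc i)) (1 + (suc g + 2 * i)) p≥1 (s≤s z≤n) (s≤s z≤n)
          (trans (l₁ (p ∸ suc i) i g p) (trans (cong (λ t → 2 + g + 2 * t + (p + p)) (m∸n+n≡m (≤-trans i< k≤p))) (trans (l₂ p g) (cong suc (sym eℓ)))))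
        where
        l₁ : ∀ r i g p → 2 * (1 + r) + (1 + (suc g + 2 * i)) + (p + p) ≡ 2 + g + 2 * (r + suc i) + (p + p)
        l₁ = solve-∀
        l₂ : ∀ p g → 2 + g + 2 * p + (p + p) ≡ suc (suc g + 4 * p)
        l₂ = solve-∀

    boundA : ∀ k → Fits k → 6 * S + k * ℓ ≤ (12 * p + 2 * g + 3) * ℓ
    boundA k fit = linear _ _ 0
       (+-mono-≤ (+-mono-≤ (*-monoʳ-≤ 3 far) (*-monoʳ-≤ 2 mid)) (+-mono-≤ (shorts k fit) (*-monoʳ-≤ 3 (high p≥1 q≥1))))
       (trans (cong (λ t → 6 * t + k * ℓ + R + 0) (trans S-split (cong (_+ σ 1 (p + p)) split))) (l N O F (σ 1 (p + p)) k p g ℓ))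
      where
      R : ℕ
      R = 3 * (p * ℓ) + 2 * (g * ℓ) + (3 * p * ℓ + 3 * (suc (p + p) * ℓ))
      l : ∀ N O F H k p g c → 6 * (N + O + F + H) + k * c + (3 * (p * c) + 2 * (g * c) + (3 * p * c + 3 * (suc (p + p) * c))) + 0
           ≡ (12 * p + 2 * g + 3) * c + (3 * (2 * F + N) + 2 * (2 * O + O) + (3 * N + k * c + 3 * (2 * H)))
      l = solve-∀

    -- Instead of using `high`, the second half of `S-split` is enlarged by g lengths to the first
    -- half, so that `far`, `mid` and `shorts` cover both. This beats `boundA` when g is small
    -- compared with p.
    boundB : ∀ k → Fits k → 3 * S + k * ℓ ≤ (6 * p + 2 * g) * ℓ
    boundB k fit = linear _ _ (3 * σ (suc (p + p)) g)
       (+-mono-≤ (+-mono-≤ (*-monoʳ-≤ 3 far) (*-monoʳ-≤ 2 mid)) (shorts k fit))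
       (trans (cong (λ t → 3 * t + k * ℓ + R + 3 * X) S-split) (trans (l₀ (σ 1 q) (σ 1 (p + p)) X k p g ℓ)
         (trans (cong (λ t → 3 * (σ 1 q + t) + k * ℓ + R) (trans (sym (σ-split 1 (p + p) g)) (cong (σ 1) (l₁ p g))))
          (trans (cong (λ t → 3 * (t + t) + k * ℓ + R) split) (l N O F k p g ℓ)))))
      where
      R X : ℕ
      R = 3 * (p * ℓ) + 2 * (g * ℓ) + 3 * p * ℓ
      X = σ (suc (p + p)) g
      l₀ : ∀ A H X k p g c → 3 * (A + H) + k * c + (3 * (p * c) + 2 * (g * c) + 3 * p * c) + 3 * X
         ≡ 3 * (A + (H + X)) + k * c + (3 * (p * c) + 2 * (g * c) + 3 * p * c)
      l₀ = solve-∀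
      l₁ : ∀ p g → p + p + g ≡ p + g + p
      l₁ = solve-∀
      l : ∀ N O F k p g c → 3 * (N + O + F + (N + O + F)) + k * c + (3 * (p * c) + 2 * (g * c) + 3 * p * c)
          ≡ (6 * p + 2 * g) * c + (3 * (2 * F + N) + 2 * (2 * O + O) + (3 * N + k * c))
      l = solve-∀

  -- The range 3p + 2 ≤ ℓ ≤ 4p. Now q = p + u is below 2p, and the lengths of `G`, from q + 1 to 2p,
  -- occur only in the second half of `S-split`.
  module Narrow (u h : ℕ) (ep : p ≡ u + suc h) (eℓ : ℓ ≡ suc u + 3 * p) (u≥1 : 1 ≤ u) where
    private
      q : ℕ
      q = u + suc h + u
      eq : ℓ ≡ suc q + (p + p)
      eq = trans eℓ (trans (lem u p) (cong (λ t → suc (t + u) + (p + p)) ep))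
        where lem : ∀ u p → suc u + 3 * p ≡ suc (p + u) + (p + p)
              lem = solve-∀
    open Width q eq using (S-split)

    private
      N O F G : ℕ
      N = σ 1 u
      O = σ (suc u) (suc h)
      F = σ (suc (u + suc h)) u
      G = σ (suc q) (suc h)

      split : σ 1 q ≡ N + O + F
      split = trans (σ-split 1 (u + suc h) u) (cong (_+ F) (σ-split 1 u (suc h)))

      S≡ : S ≡ N + O + F + (N + O + F + G)
      S≡ = trans S-split (cong₂ _+_ split (trans (cong (σ 1) (trans (cong₂ _+_ ep ep) (lem u h))) (trans (σ-split 1 q (suc h)) (cong (_+ G) split))))
        where lem : ∀ u h → u + suc h + (u + suc h) ≡ u + suc h + u + suc h
              lem = solve-∀

      far : 2 * F + N ≤ u * ℓ
      far = sumTo-pair u 2 ℓ λ i j e → ≤-trans (≤-reflexive (cong (λ t → 2 * ρ t + ρ (suc j)) (trans (l₁ u h i) (cong (_+ suc i) (sym ep)))))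
          (triangle (suc i) (suc j) (s≤s z≤n) (s≤s z≤n) (trans (l₂ p i j) (trans (cong (λ t → 1 + 3 * p + t) e) (trans (l₃ p u) (sym eℓ)))))
        where
        l₁ : ∀ u h i → suc (u + suc h) + i ≡ u + suc h + suc i
        l₁ = solve-∀
        l₂ : ∀ p i j → p + suc j + suc i + (p + p) ≡ 1 + 3 * p + (i + suc j)
        l₂ = solve-∀
        l₃ : ∀ p u → 1 + 3 * p + u ≡ suc u + 3 * p
        l₃ = solve-∀

      mid : 1 * O + O ≤ suc h * ℓ
      mid = sumTo-pair (suc h) 1 {λ i → ρ (suc u + i)} {λ j → ρ (suc u + j)} ℓ λ i j e → ≤-trans (≤-reflexive (cong (_+ ρ (suc u + j)) (+-identityʳ _)))
          (pair (suc u + i) (suc u + j) (trans (l₁ u i j p) (trans (cong (λ t → suc (u + (u + t)) + (p + p)) e)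
             (trans (cong (λ t → suc (u + t) + (p + p)) (sym ep)) (trans (l₂ u p) (sym eℓ))))) (s≤s z≤n) (s≤s z≤n))
        where
        l₁ : ∀ u i j p → suc u + i + (suc u + j) + (p + p) ≡ suc (u + (u + (i + suc j))) + (p + p)
        l₁ = solve-∀
        l₂ : ∀ u p → suc (u + p) + (p + p) ≡ suc u + 3 * p
        l₂ = solve-∀

      q≥1 : 1 ≤ q
      q≥1 = ≤-trans u≥1 (m≤n+m u (u + suc h))

      opp : ∀ α β → α + β ≡ p + p → ρ (suc α) + ρ (suc β) ≤ ℓ
      opp α β e = opposite q α β q≥1 (trans (l₁ α q β) (trans (cong (λ t → suc q + t) e) (sym eq))) e
        where
        l₁ : ∀ α q β → 1 + α + q + β ≡ suc q + (α + β)
        l₁ = solve-∀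

    -- The near lengths from 2 to h + 2 are the partners of `G` under `opposite`; the v near lengths
    -- above them are left for `near`.
    boundC : ∀ v → u ≡ suc h + suc v → ∀ k → k ≤ v → 2 * k ≤ suc v → 3 * S + k * ℓ ≤ 3 * (u + 2 * h + 3 + v) * ℓ
    boundC v eu k k≤v le = linear _ _ 0
        (+-mono-≤ (+-mono-≤ (*-monoʳ-≤ 3 far) (*-monoʳ-≤ 3 mid)) (+-mono-≤ (*-monoʳ-≤ 3 cross′) shorts))
        (trans (cong (λ t → 3 * t + k * ℓ + R + 0) S≡) (trans (cong (λ n → 3 * (n + O + F + (N + O + F + G)) + k * ℓ + R + 0) N≡)
          (l ℓ Y V O F G N k u h v)))
      where
      Y V R : ℕ
      Y = σ 2 (suc h)
      V = σ (h + 3) v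
      R = 3 * (u * ℓ) + 3 * (suc h * ℓ) + (3 * (suc h * ℓ) + 3 * v * ℓ)
      N≡ : N ≡ ℓ + (Y + V)
      N≡ = trans (cong (σ 1) (trans eu (+-suc (suc h) v))) (trans (σ-split 1 1 (suc h + v)) (cong₂ _+_ (trans (+-identityʳ _) ρ1)
             (trans (σ-split 2 (suc h) v) (cong (λ t → Y + σ t v) (lem h)))))
        where lem : ∀ h → 2 + suc h ≡ h + 3
              lem = solve-∀
      cross′ : 1 * G + Y ≤ suc h * ℓ
      cross′ = sumTo-pair (suc h) 1 {λ i → ρ (suc q + i)} {λ j → ρ (2 + j)} ℓ λ i j e → ≤-trans (≤-reflexive (cong (_+ ρ (2 + j)) (+-identityʳ _)))
          (opp (q + i) (1 + j) (trans (l₁ q i j) (trans (cong (q +_) e) (trans (l₂ u h) (sym (cong₂ _+_ ep ep))))))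
        where
        l₁ : ∀ q i j → q + i + (1 + j) ≡ q + (i + suc j)
        l₁ = solve-∀
        l₂ : ∀ u h → u + suc h + u + suc h ≡ u + suc h + (u + suc h)
        l₂ = solve-∀
      shorts : 3 * V + k * ℓ ≤ 3 * v * ℓ
      shorts = near (h + 3) v 0 k k≤v le λ i i< →
        double (h + 3 + (v ∸ suc i)) (h + 3 + (0 + 2 * i)) p≥1 (≤-trans (s≤s z≤n) (≤-trans (m≤n+m 3 h) (m≤m+n (h + 3) _)))
          (≤-trans (s≤s z≤n) (≤-trans (m≤n+m 3 h) (m≤m+n (h + 3) _)))
          (trans (l₁ h (v ∸ suc i) i p) (trans (cong (λ t → 7 + 3 * h + 2 * t + (p + p)) (m∸n+n≡m (≤-trans i< k≤v)))
            (trans (l₂ h v p) (trans (cong (λ t → suc (suc t + (t + suc h) + (p + p))) (sym eu)) (trans (cong (λ t → suc (suc u + t + (p + p))) (sym ep)) (trans (l₃ u p) (cong suc (sym eℓ))))))))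
        where
        l₁ : ∀ h r i p → 2 * (h + 3 + r) + (h + 3 + (0 + 2 * i)) + (p + p) ≡ 7 + 3 * h + 2 * (r + suc i) + (p + p)
        l₁ = solve-∀
        l₂ : ∀ h v p → 7 + 3 * h + 2 * v + (p + p) ≡ suc (suc (suc h + suc v) + ((suc h + suc v) + suc h) + (p + p))
        l₂ = solve-∀
        l₃ : ∀ u p → suc (suc u + p + (p + p)) ≡ suc (suc u + 3 * p)
        l₃ = solve-∀
      l : ∀ c Y V O F G N k u h v → 3 * (c + (Y + V) + O + F + (N + O + F + G)) + k * c + (3 * (u * c) + 3 * (suc h * c) + (3 * (suc h * c) + 3 * v * c)) + 0
          ≡ 3 * (u + 2 * h + 3 + v) * c + (3 * (2 * F + N) + 3 * (1 * O + O) + (3 * (1 * G + Y) + (3 * V + k * c)))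
      l = solve-∀

    -- For u ≤ h + 2 the near lengths from 2 to u are partners for only t lengths of `G`; the other
    -- d are bounded by ℓ each.
    boundD : ∀ t d → u ≡ suc t → suc h ≡ d + t → S ≤ (p + h + 2) * ℓ
    boundD t d eu eh = linear _ _ 0
        (+-mono-≤ (+-mono-≤ far mid) (+-mono-≤ (σ≤ (suc q) d) cross′))
        (trans (cong (λ x → x + R + 0) S≡) (trans (cong (λ n → n + O + F + (N + O + F + G) + R + 0) N≡)
          (trans (cong (λ x → ℓ + Y + O + F + (N + O + F + x) + R + 0) G≡)
          (trans (l ℓ Y O F N G₁ G₂ u h d t) (cong (λ x → x * ℓ + (2 * F + N + (1 * O + O) + (G₁ + (1 * G₂ + Y)))) count)))))
      where
      Y G₁ G₂ R : ℕ
      Y = σ 2 t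
      G₁ = σ (suc q) d
      G₂ = σ (suc q + d) t
      R = u * ℓ + suc h * ℓ + (d * ℓ + t * ℓ)
      count : u + suc h + suc (d + t) ≡ p + h + 2
      count = trans (cong₂ (λ a b → a + suc b) (sym ep) (sym eh)) (lem p h)
        where lem : ∀ p h → p + suc (suc h) ≡ p + h + 2
              lem = solve-∀
      N≡ : N ≡ ℓ + Y
      N≡ = trans (cong (σ 1) eu) (cong (_+ Y) ρ1)
      G≡ : G ≡ G₁ + G₂
      G≡ = trans (cong (σ (suc q)) eh) (σ-split (suc q) d t)
      cross′ : 1 * G₂ + Y ≤ t * ℓ
      cross′ = sumTo-pair t 1 {λ i → ρ (suc q + d + i)} {λ j → ρ (2 + j)} ℓ λ i j e → ≤-trans (≤-reflexive (cong (_+ ρ (2 + j)) (+-identityʳ _)))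
          (opp (q + d + i) (1 + j) (trans (l₁ q d i j) (trans (cong (λ x → q + (d + x)) e) (trans (cong (q +_) (sym eh)) (trans (l₂ u h) (sym (cong₂ _+_ ep ep)))))))
        where
        l₁ : ∀ q d i j → q + d + i + (1 + j) ≡ q + (d + (i + suc j))
        l₁ = solve-∀
        l₂ : ∀ u h → u + suc h + u + suc h ≡ u + suc h + (u + suc h)
        l₂ = solve-∀
      l : ∀ c Y O F N G₁ G₂ u h d t → c + Y + O + F + (N + O + F + (G₁ + G₂)) + (u * c + suc h * c + (d * c + t * c)) + 0
          ≡ (u + suc h + suc (d + t)) * c + (2 * F + N + (1 * O + O) + (G₁ + (1 * G₂ + Y)))
      l = solve-∀

  module Any (m<ℓ : m < ℓ) where
    private
      r : ℕ
      r = ℓ ∸ suc (suc (p + p))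
      ≤ℓ : suc (suc (p + p)) ≤ ℓ
      ≤ℓ = ≤-trans (≤-reflexive (trans (lem p) (sym em))) (<⇒≤ m<ℓ)
        where lem : ∀ p → suc (suc (p + p)) ≡ suc p + suc p
              lem = solve-∀
      eq : ℓ ≡ suc (suc r) + (p + p)
      eq = trans (sym (m∸n+n≡m ≤ℓ)) (lem r p)
        where lem : ∀ r p → r + suc (suc (p + p)) ≡ suc (suc r) + (p + p)
              lem = solve-∀
    bondy : 2 * S ≤ ℓ * ℓ
    bondy = Width.bondy (suc r) eq p≥1 (s≤s z≤n)

half : ∀ n → ∃[ k ] (2 * k ≤ n × n ≤ suc (2 * k))
half zero = 0 , z≤n , z≤n
half (suc zero) = 0 , z≤n , s≤s z≤n
half (suc (suc n)) with k , a , b ← half n =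
  suc k , ≤-trans (≤-reflexive (lem k)) (s≤s (s≤s a)) , ≤-trans (s≤s (s≤s b)) (≤-reflexive (cong suc (sym (lem k))))
  where lem : ∀ k → 2 * suc k ≡ suc (suc (2 * k))
        lem = solve-∀

k≤2k : ∀ k → k ≤ 2 * k
k≤2k k = m≤m+n k (k + 0)

-- The shape of a chord bound used for long cycles: average degree at most ℓ/2 − p/10 + 1/6.
module Uniform {m ℓ : ℕ} {ρ : ℕ → ℕ} (ch : Chords m ℓ ρ) (p : ℕ) (em : m ≡ suc p + suc p) (p≥1 : 1 ≤ p) (m<ℓ : m < ℓ) where
  open Count ch using (S)
  open Bounds ch p em p≥1

  Sparse : Set
  Sparse = 60 * S + 6 * p * ℓ ≤ (30 * ℓ + 10) * ℓ

  wide : ∀ g → ℓ ≡ suc g + 4 * p → Sparse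
  -- With 2k ≥ p - g - 1, `boundA` yields `Sparse` for p ≤ 5(g + 1) and `boundB` for p ≥ 5(g + 1).
  wide g eℓ with ≤-total p (5 * suc g)
  ... | inj₁ p≤ = go (≤-total g p)
    where
    open Wide g eℓ
    use : ∀ k → Fits k → 6 * p ≤ 10 * suc g + 10 * k → Sparse
    use k fit h = linear _ _ 0 (+-mono-≤ (*-monoʳ-≤ 10 (boundA k fit)) (*-monoˡ-≤ ℓ h))
      (trans (l S k p g ℓ) (cong (λ t → (30 * t + 10) * ℓ + (10 * (6 * S + k * ℓ) + 6 * p * ℓ)) (sym eℓ)))
      where
      l : ∀ S k p g c → 60 * S + 6 * p * c + (10 * ((12 * p + 2 * g + 3) * c) + (10 * suc g + 10 * k) * c) + 0
          ≡ (30 * (suc g + 4 * p) + 10) * c + (10 * (6 * S + k * c) + 6 * p * c)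
      l = solve-∀
    go : g ≤ p ⊎ p ≤ g → Sparse
    go (inj₂ p≤g) = use 0 (inj₁ refl) (≤-trans (*-monoʳ-≤ 6 (≤-trans p≤g (n≤1+n g))) (≤-trans (*-monoˡ-≤ (suc g) {6} {10} (s≤s (s≤s (s≤s (s≤s (s≤s (s≤s z≤n))))))) (m≤m+n _ 0)))
    go (inj₁ g≤p) with k , a , b ← half (p ∸ g) =
      use k (inj₂ (≤-trans (k≤2k k) (≤-trans a (m∸n≤m p g)) , ≤-trans (+-monoʳ-≤ g a) (≤-reflexive (m+[n∸m]≡n g≤p))))
        (linear _ _ 0 (+-mono-≤ p≤ (*-monoʳ-≤ 5 (≤-trans (≤-reflexive (sym (m+[n∸m]≡n g≤p))) (+-monoʳ-≤ g b)))) (l p g k))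
      where
      l : ∀ p g k → 6 * p + (5 * suc g + 5 * (g + suc (2 * k))) + 0 ≡ 10 * suc g + 10 * k + (p + 5 * p)
      l = solve-∀
  ... | inj₂ p≥ with k , a , b ← half (p ∸ g) =
      linear _ _ (50 * ℓ) (+-mono-≤ (*-monoʳ-≤ 20 (boundB k (inj₂ (≤-trans (k≤2k k) (≤-trans a (m∸n≤m p g)) ,
                   ≤-trans (+-monoʳ-≤ g a) (≤-reflexive (m+[n∸m]≡n g≤p))))))
                (*-monoˡ-≤ ℓ h))
      (trans (l S k p g ℓ) (cong (λ t → (30 * t + 10) * ℓ + (20 * (3 * S + k * ℓ) + (10 * g + 6 * p + 10) * ℓ)) (sym eℓ)))
    where
    open Wide g eℓ
    g≤p : g ≤ p
    g≤p = ≤-trans (≤-trans (n≤1+n g) (m≤m+n (suc g) (4 * suc g))) p≥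
    h : 10 * g + 6 * p + 10 ≤ 20 * k
    h = linear _ _ 0 (+-mono-≤ (*-monoʳ-≤ 4 p≥) (*-monoʳ-≤ 10 (≤-trans (≤-reflexive (sym (m+[n∸m]≡n g≤p))) (+-monoʳ-≤ g b)))) (l₁ p g k)
      where
      l₁ : ∀ p g k → 10 * g + 6 * p + 10 + (4 * p + 10 * (g + suc (2 * k))) + 0 ≡ 20 * k + (4 * (5 * suc g) + 10 * p)
      l₁ = solve-∀
    l : ∀ S k p g c → 60 * S + 6 * p * c + (20 * ((6 * p + 2 * g) * c) + 20 * k * c) + 50 * c
          ≡ (30 * (suc g + 4 * p) + 10) * c + (20 * (3 * S + k * c) + (10 * g + 6 * p + 10) * c)
    l = solve-∀

  narrow : ∀ u h → p ≡ u + suc h → ℓ ≡ suc u + 3 * p → 1 ≤ u → Sparse ⊎ 5 * ℓ ≤ 17 * p + 6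
  narrow u h ep eℓ u≥1 = go (suc (suc h) ≤? u)
    where
    open Narrow u h ep eℓ u≥1
    go : Dec (suc (suc h) ≤ u) → Sparse ⊎ 5 * ℓ ≤ 17 * p + 6
    go (yes h<u) with k , a , b ← half (suc (u ∸ suc (suc h))) = inj₁ (linear _ _ ((18 * h + 52 + 8 * k) * ℓ)
        (+-mono-≤ (*-monoʳ-≤ 20 (boundC v eu k k≤v a)) (*-monoˡ-≤ ℓ (*-monoʳ-≤ 6 b)))
        (trans (cong₂ (λ x y → 60 * S + 6 * x * ℓ + (20 * (3 * (y + 2 * h + 3 + v) * ℓ) + 6 * suc (2 * k) * ℓ) + (18 * h + 52 + 8 * k) * ℓ) ep′ eu)
          (trans (l S k h v ℓ) (cong (λ x → (30 * x + 10) * ℓ + (20 * (3 * S + k * ℓ) + 6 * suc v * ℓ)) (sym (trans eℓ (cong₂ (λ x y → suc x + 3 * y) eu ep′)))))))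
      where
      v : ℕ
      v = u ∸ suc (suc h)
      eu : u ≡ suc h + suc v
      eu = trans (sym (m+[n∸m]≡n h<u)) (sym (+-suc (suc h) v))
      ep′ : p ≡ suc h + suc v + suc h
      ep′ = trans ep (cong (_+ suc h) eu)
      k≤v : k ≤ v
      k≤v = small k a
        where
        small : ∀ k → 2 * k ≤ suc v → k ≤ v
        small zero _ = z≤n
        small (suc k) le = ≤-pred (≤-trans (s≤s (m≤n+m (suc k) k)) (≤-trans (≤-reflexive (lem k)) le))
          where lem : ∀ k → suc (k + suc k) ≡ 2 * suc k
                lem = solve-∀
      l : ∀ S k h v c → 60 * S + 6 * (suc h + suc v + suc h) * c + (20 * (3 * (suc h + suc v + 2 * h + 3 + v) * c) + 6 * suc (2 * k) * c) + (18 * h + 52 + 8 * k) * c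
          ≡ (30 * (suc (suc h + suc v) + 3 * (suc h + suc v + suc h)) + 10) * c + (20 * (3 * S + k * c) + 6 * suc v * c)
      l = solve-∀
    -- This is what `boundD` needs to give `Sparse`. If it fails, then 3u ≤ 2h + 3, which for ℓ = 3p
    -- + u + 1 means 5ℓ ≤ 17p + 6.
    go (no h≮u) with 45 * h + 55 ≤? 27 * p
    ... | yes le = inj₁ (linear _ _ 0 (+-mono-≤ (*-monoʳ-≤ 60 (boundD (u ∸ 1) (suc h ∸ (u ∸ 1)) (sym (m+[n∸m]≡n u≥1)) (sym (m∸n+n≡m t≤))))
              (*-monoˡ-≤ ℓ (*-monoʳ-≤ 2 le)))
            (trans (cong (λ x → 60 * S + 6 * x * ℓ + (60 * ((x + h + 2) * ℓ) + 2 * (27 * x) * ℓ) + 0) ep)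
              (trans (l S u h ℓ) (cong (λ x → (30 * x + 10) * ℓ + (60 * S + 2 * (45 * h + 55) * ℓ)) (sym (trans eℓ (cong (λ x → suc u + 3 * x) ep)))))))
      where
      t≤ : u ∸ 1 ≤ suc h
      t≤ = ≤-trans (∸-monoˡ-≤ 1 (≤-pred (≰⇒> h≮u))) (n≤1+n h)
      l : ∀ S u h c → 60 * S + 6 * (u + suc h) * c + (60 * ((u + suc h + h + 2) * c) + 2 * (27 * (u + suc h)) * c) + 0
          ≡ (30 * (suc u + 3 * (u + suc h)) + 10) * c + (60 * S + 2 * (45 * h + 55) * c)
      l = solve-∀
    ... | no gt = inj₂ (linear _ _ 0 3u≤ (trans (cong (λ x → 5 * x + (2 * h + 3) + 0) (trans eℓ (cong (λ x → suc u + 3 * x) ep)))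
            (trans (l₂ u h) (cong (λ x → 17 * x + 6 + 3 * u) (sym ep)))))
      where
      3u≤ : 3 * u ≤ 2 * h + 3
      3u≤ = *-cancelˡ-≤ 9 (linear _ _ 0 (≰⇒> gt) (trans (l₁ u h) (cong (λ x → 9 * (2 * h + 3) + suc (27 * x)) (sym ep))))
        where
        l₁ : ∀ u h → 9 * (3 * u) + (45 * h + 55) + 0 ≡ 9 * (2 * h + 3) + suc (27 * (u + suc h))
        l₁ = solve-∀
      l₂ : ∀ u h → 5 * (suc u + 3 * (u + suc h)) + (2 * h + 3) + 0 ≡ 17 * (u + suc h) + 6 + 3 * u
      l₂ = solve-∀

  uniform : Sparse ⊎ (5 * ℓ ≤ 17 * p + 6 × 2 * S ≤ ℓ * ℓ)
  uniform with 4 * p <? ℓ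
  ... | yes gt = inj₁ (wide (ℓ ∸ suc (4 * p)) (sym (trans (lem (ℓ ∸ suc (4 * p)) p) (m∸n+n≡m gt))))
    where lem : ∀ g p → suc g + 4 * p ≡ g + suc (4 * p)
          lem = solve-∀
  ... | no le with suc (suc (3 * p)) ≤? ℓ
  ...   | no small = inj₂ (≤-trans (*-monoʳ-≤ 5 (≤-pred (≰⇒> small))) (≤-trans (≤-reflexive (lem p)) (+-mono-≤ (*-monoˡ-≤ p {15} {17} (m≤m+n 15 2)) (m≤m+n 5 1))) , Any.bondy m<ℓ)
    where lem : ∀ p → 5 * suc (3 * p) ≡ 15 * p + 5
          lem = solve-∀
  ...   | yes big = case narrow u (p ∸ suc u) ep eℓ (s≤s z≤n) of λ { (inj₁ s) → inj₁ s ; (inj₂ r) → inj₂ (r , Any.bondy m<ℓ) }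
    where
    u : ℕ
    u = suc (ℓ ∸ suc (suc (3 * p)))
    eℓ : ℓ ≡ suc u + 3 * p
    eℓ = sym (trans (lem (ℓ ∸ suc (suc (3 * p))) p) (m∸n+n≡m big))
      where lem : ∀ g p → suc (suc g) + 3 * p ≡ g + suc (suc (3 * p))
            lem = solve-∀
    u<p : suc u ≤ p
    u<p = +-cancelʳ-≤ (3 * p) _ _ (≤-trans (≤-reflexive (sym eℓ)) (≤-trans (≮⇒≥ le) (≤-reflexive (lem p))))
      where lem : ∀ p → 4 * p ≡ p + 3 * p
            lem = solve-∀
    ep : p ≡ u + suc (p ∸ suc u)
    ep = sym (trans (+-suc u _) (m+[n∸m]≡n u<p))

-- The inequality at one vertex for p ≥ 17.

Good : ℕ → ℕ → ℕ → Set
Good p n X = X ≤ (p + suc p) * (n ∸ 1) ⊎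
  ∃[ ℓ ] ∃[ ρ ] (suc p + suc p < ℓ × ℓ ≤ n × Chords (suc p + suc p) ℓ ρ × X ≤ sumTo ℓ ρ + ℓ * (n ∸ ℓ))

2xy≤x²+y² : ∀ x y → 2 * (x * y) ≤ x * x + y * y
2xy≤x²+y² x y with ≤-total x y
... | inj₁ le = subst (λ y → 2 * (x * y) ≤ x * x + y * y) (m+[n∸m]≡n le) (linear _ _ ((y ∸ x) * (y ∸ x)) (≤-refl {0}) (l x (y ∸ x)))
  where l : ∀ x d → 2 * (x * (x + d)) + 0 + d * d ≡ x * x + (x + d) * (x + d) + 0
        l = solve-∀
... | inj₂ le = subst (λ x → 2 * (x * y) ≤ x * x + y * y) (m+[n∸m]≡n le) (linear _ _ ((x ∸ y) * (x ∸ y)) (≤-refl {0}) (l y (x ∸ y)))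
  where l : ∀ y d → 2 * ((y + d) * y) + 0 + d * d ≡ (y + d) * (y + d) + y * y + 0
        l = solve-∀

product≤square : ∀ t s w → t + s ≡ 2 * w → t * s ≤ w * w
product≤square t s w e = *-cancelˡ-≤ 4 (linear _ _ 0 (2xy≤x²+y² t s) (trans (l t s) (trans (cong (λ x → x * x + 2 * (t * s)) e) (l₂ w (t * s)))))
  where
  l : ∀ t s → 4 * (t * s) + (t * t + s * s) + 0 ≡ (t + s) * (t + s) + 2 * (t * s)
  l = solve-∀
  l₂ : ∀ w x → (2 * w) * (2 * w) + 2 * x ≡ 4 * (w * w) + 2 * x
  l₂ = solve-∀

-- `Good` with ℓ eliminated. In `dense`, w/30 = n + 1/6 - p/10, and w²/1800 is the maximum of ℓ(w/30
-- - ℓ/2) over ℓ. In `wide`, y is the number n - ℓ of vertices off a cycle so short that 2S ≤ ℓ² is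
-- used.
data Cap (p n X : ℕ) : Set where
  short : X ≤ (p + suc p) * (n ∸ 1) → Cap p n X
  dense : ∀ w → w + 3 * p ≡ 30 * n + 5 → 1800 * X ≤ w * w → Cap p n X
  wide : ∀ y → 5 * n ≤ 5 * y + 17 * p + 6 → 2 * X + y * y ≤ n * n → Cap p n X

cap : ∀ {p n X} → 1 ≤ p → Good p n X → Cap p n X
cap p≥1 (inj₁ h) = short h
cap {p} {n} {X} p≥1 (inj₂ (ℓ , ρ , m<ℓ , ℓ≤n , ch , h)) with Uniform.uniform ch p refl p≥1 m<ℓ
... | inj₂ (r , b) = wide y (≤-trans (≤-reflexive (trans (cong (5 *_) (sym n≡)) (*-distribˡ-+ 5 ℓ y)))
        (≤-trans (+-monoˡ-≤ (5 * y) r) (≤-reflexive (l₁ p y))))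
      (linear _ _ 0 (+-mono-≤ (*-monoʳ-≤ 2 h) b) (trans (l₂ X y ℓ (sumTo ℓ ρ)) (cong (λ t → t * t + (2 * X + 2 * sumTo ℓ ρ)) n≡)))
  where
  y : ℕ
  y = n ∸ ℓ
  n≡ : ℓ + y ≡ n
  n≡ = m+[n∸m]≡n ℓ≤n
  l₁ : ∀ p y → 17 * p + 6 + 5 * y ≡ 5 * y + 17 * p + 6
  l₁ = solve-∀
  l₂ : ∀ X y c S → 2 * X + y * y + (2 * (S + c * y) + c * c) + 0 ≡ (c + y) * (c + y) + (2 * X + 2 * S)
  l₂ = solve-∀
... | inj₁ sp = dense w w≡ (≤-trans (linear _ _ 0 (+-mono-≤ (*-monoʳ-≤ 1800 h) (*-monoʳ-≤ 30 sp))
        (trans (l₂ X p ℓ y S) (trans (cong (λ t → 30 * (ℓ * t) + (1800 * X + 1800 * S)) s≡) (l₃ ℓ s p X S))))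
        (product≤square (30 * ℓ) s w (+-cancelʳ-≡ (6 * p) _ _ (trans (+-assoc (30 * ℓ) s (6 * p)) (trans (cong (30 * ℓ +_) (sym s≡))
          (trans (l₄ ℓ y) (trans (cong (λ t → 2 * (30 * t + 5)) n≡) (trans (cong (2 *_) (sym w≡)) (l₅ w p)))))))))
  where
  S y s w : ℕ
  S = sumTo ℓ ρ
  y = n ∸ ℓ
  n≡ : ℓ + y ≡ n
  n≡ = m+[n∸m]≡n ℓ≤n
  p≤ℓ : p ≤ ℓ
  p≤ℓ = ≤-trans (≤-trans (n≤1+n p) (m≤m+n (suc p) (suc p))) (<⇒≤ m<ℓ)
  s = (30 * ℓ + 10 + 60 * y) ∸ 6 * p
  s≡ : 30 * ℓ + 10 + 60 * y ≡ s + 6 * p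
  s≡ = sym (m∸n+n≡m (≤-trans (*-mono-≤ {6} {30} (m≤m+n 6 24) p≤ℓ) (≤-trans (m≤m+n (30 * ℓ) 10) (m≤m+n _ (60 * y)))))
  w = (30 * n + 5) ∸ 3 * p
  w≡ : w + 3 * p ≡ 30 * n + 5
  w≡ = m∸n+n≡m (≤-trans (*-mono-≤ {3} {30} (m≤m+n 3 27) (≤-trans p≤ℓ ℓ≤n)) (m≤m+n (30 * n) 5))
  l₂ : ∀ X p c y S → 1800 * X + (1800 * (S + c * y) + 30 * ((30 * c + 10) * c)) + 0
       ≡ 30 * (c * (30 * c + 10 + 60 * y)) + (1800 * X + 1800 * S)
  l₂ = solve-∀
  l₃ : ∀ c s p X S → 30 * (c * (s + 6 * p)) + (1800 * X + 1800 * S) ≡ 30 * c * s + (1800 * X + 30 * (60 * S + 6 * p * c))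
  l₃ = solve-∀
  l₄ : ∀ c y → 30 * c + (30 * c + 10 + 60 * y) ≡ 2 * (30 * (c + y) + 5)
  l₄ = solve-∀
  l₅ : ∀ w p → 2 * (w + 3 * p) ≡ 2 * w + 6 * p
  l₅ = solve-∀

-- The hypotheses `ps` and `s≥14` serve the cases `dense` and `wide` of `one-small`.
module Large (p s : ℕ) (p≥17 : 17 ≤ p) (s≥14 : 14 ≤ s) (ps : 10530 * p ≤ 180 * (p * s) + 900 * (s * s) + 6900 * s + 1175) where

  private
    a D : ℕ
    a = p + suc p
    D = 8 * p + 11 + s

    -- 46 = 3 · 17 - 5. A gap of at least 30 also gives w ≤ 30(n - 1), which `small-side` needs.
    w-gap : ∀ n {w} → w + 3 * p ≡ 30 * n + 5 → w + 46 ≤ 30 * n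
    w-gap n {w} e = linear _ _ 0 (*-monoʳ-≤ 3 p≥17) (trans (l₁ w p) (trans (cong (_+ 46) e) (l₂ n)))
      where
      l₁ : ∀ w p → w + 46 + 3 * p + 0 ≡ w + 3 * p + 46
      l₁ = solve-∀
      l₂ : ∀ n → 30 * n + 5 + 46 ≡ 30 * n + 3 * 17
      l₂ = solve-∀

  -- n²/2 - n is the share of one side in Goodman's count when both sides have n vertices. The least
  -- n for which the bound in `short` lies below it is 4p + 4.
  large-side : ∀ {n X} → 4 * p + 4 ≤ n → Cap p n X → suc (2 * X + 2 * n) ≤ n * n
  large-side {n} {X} n≥ (short h) = subst (λ n → X ≤ a * (n ∸ 1) → suc (2 * X + 2 * n) ≤ n * n) (m+[n∸m]≡n n≥)
      (λ h → ≤-trans (s≤s (+-monoˡ-≤ (2 * (4 * p + 4 + t)) (*-monoʳ-≤ 2 (≤-trans h (≤-reflexive (cong (λ x → a * (x ∸ 1)) (l₀ p t)))))))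
        (linear _ _ (t * (4 * p + 4 + t) + (4 * p + 1)) (≤-refl {0}) (l p t))) h
    where
    t : ℕ
    t = n ∸ (4 * p + 4)
    l₀ : ∀ p t → 4 * p + 4 + t ≡ suc (4 * p + 3 + t)
    l₀ = solve-∀
    l : ∀ p t → suc (2 * ((p + suc p) * (4 * p + 3 + t)) + 2 * (4 * p + 4 + t)) + 0 + (t * (4 * p + 4 + t) + (4 * p + 1))
        ≡ (4 * p + 4 + t) * (4 * p + 4 + t) + 0
    l = solve-∀
  large-side {n} {X} n≥ (dense w e h) = *-cancelˡ-≤ 900 (linear _ _ 24 (+-mono-≤ (≤-trans h (*-mono-≤ w≤r w≤r)) (*-monoʳ-≤ 32 r≥49))
      (trans (l₁ X n r) (trans (cong (λ v → 900 + 1800 * X + 60 * v + (r * r + 32 * r) + 24) (sym r≡)) (trans (l₂ X r)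
        (trans (cong (λ v → v * v + (1800 * X + 32 * 49)) r≡) (l₃ X n))))))
    where
    r : ℕ
    r = 30 * n ∸ 46
    r≡ : r + 46 ≡ 30 * n
    r≡ = m∸n+n≡m (≤-trans (m≤n+m 46 w) (w-gap n e))
    w≤r : w ≤ r
    w≤r = +-cancelʳ-≤ 46 _ _ (≤-trans (w-gap n e) (≤-reflexive (sym r≡)))
    r≥49 : 49 ≤ r
    r≥49 = +-cancelʳ-≤ 46 _ _ (≤-trans (≤-trans (m≤m+n 95 25) (*-monoʳ-≤ 30 (≤-trans (m≤n+m 4 (4 * p)) n≥))) (≤-reflexive (sym r≡)))
    l₁ : ∀ X n r → 900 * suc (2 * X + 2 * n) + (r * r + 32 * r) + 24 ≡ 900 + 1800 * X + 60 * (30 * n) + (r * r + 32 * r) + 24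
    l₁ = solve-∀
    l₂ : ∀ X r → 900 + 1800 * X + 60 * (r + 46) + (r * r + 32 * r) + 24 ≡ (r + 46) * (r + 46) + (1800 * X + 32 * 49)
    l₂ = solve-∀
    l₃ : ∀ X n → 30 * n * (30 * n) + (1800 * X + 32 * 49) ≡ 900 * (n * n) + (1800 * X + 32 * 49)
    l₃ = solve-∀
  large-side {n} {X} n≥ (wide y e h) = linear _ _ 0 (+-mono-≤ h y²) (l X n (y * y))
    where
    y-big : 3 * n + 44 ≤ 20 * y
    y-big = linear _ _ 0 (+-mono-≤ (*-monoʳ-≤ 4 e) (*-monoʳ-≤ 17 n≥)) (l₁ n y p)
      where l₁ : ∀ n y p → 3 * n + 44 + (4 * (5 * y + 17 * p + 6) + 17 * n) + 0 ≡ 20 * y + (4 * (5 * n) + 17 * (4 * p + 4))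
            l₁ = solve-∀
    y≥13 : 13 ≤ y
    y≥13 = *-cancelˡ-≤ 20 (≤-trans (+-monoˡ-≤ 44 (*-monoʳ-≤ 3 (≤-trans (+-monoˡ-≤ 4 (*-monoʳ-≤ 4 p≥17)) n≥))) y-big)
    k : ℕ
    k = y ∸ 13
    y² : suc (2 * n) ≤ y * y
    y² = *-cancelˡ-≤ 3 (subst (λ y → 3 * n + 44 ≤ 20 * y → 3 * suc (2 * n) ≤ 3 * (y * y)) (m+[n∸m]≡n y≥13)
           (λ h → linear _ _ (3 * (k * k) + 38 * k + 72) (*-monoʳ-≤ 2 h) (l₂ n k)) y-big)
      where l₂ : ∀ n k → 3 * suc (2 * n) + 2 * (20 * (13 + k)) + (3 * (k * k) + 38 * k + 72) ≡ 3 * ((13 + k) * (13 + k)) + 2 * (3 * n + 44)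
            l₂ = solve-∀
    l : ∀ X n z → suc (2 * X + 2 * n) + (n * n + z) + 0 ≡ n * n + (2 * X + z + suc (2 * n))
    l = solve-∀

  -- Because 4p + 2 = 2a, a bound n(n - 1)/2, or n²/2 when n ≤ 4p + 2, is at most an.
  small-side : ∀ {n X} → n ≤ 4 * p + 3 → Cap p n X → X ≤ a * n
  small-side {n} {X} n≤ (short h) = ≤-trans h (*-monoʳ-≤ a (m∸n≤m n 1))
  small-side {n} {X} n≤ (dense w e h) = *-cancelˡ-≤ 1800 (begin
      1800 * X                       ≤⟨ h ⟩
      w * w                          ≤⟨ *-mono-≤ (≤-trans (m≤m+n w 46) (w-gap n e)) w≤ ⟩
      30 * n * (30 * (n ∸ 1))        ≤⟨ *-monoʳ-≤ (30 * n) (*-monoʳ-≤ 30 (≤-trans (∸-monoˡ-≤ 1 n≤) (≤-reflexive (trans (cong (_∸ 1) (+-suc (4 * p) 2)) (l₁ p))))) ⟩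
      30 * n * (30 * (2 * a))        ≡⟨ l₂ n a ⟩
      1800 * (a * n) ∎)
    where
    open ≤-Reasoning
    l₁ : ∀ p → 4 * p + 2 ≡ 2 * (p + suc p)
    l₁ = solve-∀
    l₂ : ∀ n a → 30 * n * (30 * (2 * a)) ≡ 1800 * (a * n)
    l₂ = solve-∀
    w≤ : w ≤ 30 * (n ∸ 1)
    w≤ = ≤-trans (m+n≤o⇒m≤o∸n w (≤-trans (+-monoʳ-≤ w {30} {46} (m≤m+n 30 16)) (w-gap n e))) (≤-reflexive (sym (*-distribˡ-∸ 30 n 1)))
  small-side {n} {X} n≤ (wide y e h) with m≤n⇒m<n∨m≡n n≤
  ... | inj₁ lt = *-cancelˡ-≤ 2 (begin
      2 * X                ≤⟨ ≤-trans (m≤m+n (2 * X) (y * y)) h ⟩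
      n * n                ≤⟨ *-monoˡ-≤ n (≤-pred (≤-trans lt (≤-reflexive (l₁ p)))) ⟩
      2 * a * n            ≡⟨ *-assoc 2 a n ⟩
      2 * (a * n) ∎)
    where
    open ≤-Reasoning
    l₁ : ∀ p → 4 * p + 3 ≡ suc (2 * (p + suc p))
    l₁ = solve-∀
  -- For n = 2a + 1 the number n² exceeds 2an by n, and y² ≥ n makes up for it.
  ... | inj₂ refl = *-cancelˡ-≤ 2 (linear _ _ 0 (+-mono-≤ h n≤y²) (l₃ X (y * y) p))
    where
    5y : 3 * p + 9 ≤ 5 * y
    5y = linear _ _ 0 e (l₁ p y)
      where l₁ : ∀ p y → 3 * p + 9 + (5 * y + 17 * p + 6) + 0 ≡ 5 * y + 5 * (4 * p + 3)
            l₁ = solve-∀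
    n≤y² : 4 * p + 3 ≤ y * y
    n≤y² = *-cancelˡ-≤ 25 (linear _ _ (107 * p + 6) (+-mono-≤ (*-mono-≤ 5y 5y) (*-monoʳ-≤ 9 (*-monoˡ-≤ p p≥17))) (l₂ p y))
      where l₂ : ∀ p y → 25 * (4 * p + 3) + (5 * y * (5 * y) + 9 * (p * p)) + (107 * p + 6) ≡ 25 * (y * y) + ((3 * p + 9) * (3 * p + 9) + 9 * (17 * p))
            l₂ = solve-∀
    l₃ : ∀ X z p → 2 * X + ((4 * p + 3) * (4 * p + 3) + z) + 0 ≡ 2 * ((p + suc p) * (4 * p + 3)) + (2 * X + z + (4 * p + 3))
    l₃ = solve-∀

  -- Once the two bounds are inserted, only 2n₁n₂ ≤ n₁² + n₂² is left.
  both-large : ∀ {n₁ n₂ X₁ X₂} → n₁ + n₂ ≡ D → suc (2 * X₁ + 2 * n₁) ≤ n₁ * n₁ → suc (2 * X₂ + 2 * n₂) ≤ n₂ * n₂ →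
               suc (X₁ + X₂ + 3 * (n₁ * n₂)) + D ≤ D * D
  both-large {n₁} {n₂} {X₁} {X₂} e h₁ h₂ = subst (λ D → suc (X₁ + X₂ + 3 * (n₁ * n₂)) + D ≤ D * D) e
      (*-cancelˡ-≤ 2 (linear _ _ 0 (+-mono-≤ (+-mono-≤ h₁ h₂) (2xy≤x²+y² n₁ n₂)) (l n₁ n₂ X₁ X₂)))
    where
    l : ∀ n k X Y → 2 * (suc (X + Y + 3 * (n * k)) + (n + k)) + (n * n + k * k + (n * n + k * k)) + 0
        ≡ 2 * ((n + k) * (n + k)) + (suc (2 * X + 2 * n) + suc (2 * Y + 2 * k) + 2 * (n * k))
    l = solve-∀

  -- n₂ = 4p + 3 − j and n₁ = 4p + 8 + s + j.
  one-small : ∀ j {n₂ X₁ X₂} → n₂ + j ≡ 4 * p + 3 → X₂ ≤ a * n₂ → Cap p (4 * p + 8 + s + j) X₁ →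
              suc (X₁ + X₂ + 3 * ((4 * p + 8 + s + j) * n₂)) + D ≤ D * D
  one-small j {n₂} {X₁} {X₂} e h₂ (short h) = *-cancelˡ-≤ 4 (linear _ _ (8 * (p * s) + s * s + 24 * p + 14 * s + 29)
      (+-mono-≤ (+-mono-≤ (*-monoʳ-≤ 4 h′) (*-monoʳ-≤ 4 h₂)) (*-monoʳ-≤ 3 4ab))
      (trans (l₁ X₁ X₂ n₁ n₂ a D (8 * (p * s) + s * s + 24 * p + 14 * s + 29))
        (trans (cong (λ N → 4 + 4 * D + (4 * (a * N) + 3 * (N * N)) + (8 * (p * s) + s * s + 24 * p + 14 * s + 29) + (4 * X₁ + 4 * X₂ + 3 * (4 * (n₁ * n₂)))) N≡)
          (cong (_+ (4 * X₁ + 4 * X₂ + 3 * (4 * (n₁ * n₂)))) (l₂ p s)))))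
    where
    n₁ : ℕ
    n₁ = 4 * p + 8 + s + j
    N≡ : n₁ + n₂ ≡ D
    N≡ = trans (l p s j n₂) (trans (cong (4 * p + 8 + s +_) e) (l₀ p s))
      where
      l : ∀ p s j n → 4 * p + 8 + s + j + n ≡ 4 * p + 8 + s + (n + j)
      l = solve-∀
      l₀ : ∀ p s → 4 * p + 8 + s + (4 * p + 3) ≡ 8 * p + 11 + s
      l₀ = solve-∀
    h′ : X₁ ≤ a * n₁
    h′ = ≤-trans h (*-monoʳ-≤ a (m∸n≤m n₁ 1))
    4ab : 4 * (n₁ * n₂) ≤ (n₁ + n₂) * (n₁ + n₂)
    4ab = linear _ _ 0 (2xy≤x²+y² n₁ n₂) (l n₁ n₂)
      where l : ∀ x y → 4 * (x * y) + (x * x + y * y) + 0 ≡ (x + y) * (x + y) + 2 * (x * y)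
            l = solve-∀
    l₁ : ∀ X Y n k a D t → 4 * (suc (X + Y + 3 * (n * k)) + D) + (4 * (a * n) + 4 * (a * k) + 3 * ((n + k) * (n + k))) + t
         ≡ 4 + 4 * D + (4 * (a * (n + k)) + 3 * ((n + k) * (n + k))) + t + (4 * X + 4 * Y + 3 * (4 * (n * k)))
    l₁ = solve-∀
    l₂ : ∀ p s → 4 + 4 * (8 * p + 11 + s) + (4 * ((p + suc p) * (8 * p + 11 + s)) + 3 * ((8 * p + 11 + s) * (8 * p + 11 + s))) + (8 * (p * s) + s * s + 24 * p + 14 * s + 29)
         ≡ 4 * ((8 * p + 11 + s) * (8 * p + 11 + s))
    l₂ = solve-∀
  -- The square (67j - 26p)² absorbs the negative product of j and p, and `ps` the negative term
  -- linear in p.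
  one-small j {n₂} {X₁} {X₂} e h₂ (dense w we h) = *-cancelˡ-≤ 1800 (linear _ _ (11 * (j * j) + 64 * (j * p) + 3600 * (j * s) + 35 * (p * p) + 14100 * j)
      (+-mono-≤ (+-mono-≤ (≤-trans h (≤-reflexive (cong₂ _*_ w≡ w≡))) (*-monoʳ-≤ 1800 h₂)) (+-mono-≤ (+-mono-≤ (2xy≤x²+y² (67 * j) (26 * p)) ps)
         (≤-reflexive (cong (_* (1800 * a + 5400 * (4 * p + 8 + s + j))) e))))
      (l p s j n₂ X₁ X₂))
    where
    w≡ : w ≡ 117 * p + 245 + 30 * s + 30 * j
    w≡ = +-cancelʳ-≡ (3 * p) _ _ (trans we (l₁ p s j))
      where l₁ : ∀ p s j → 30 * (4 * p + 8 + s + j) + 5 ≡ 117 * p + 245 + 30 * s + 30 * j + 3 * p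
            l₁ = solve-∀
    l : ∀ p s j k X Y →
        1800 * (suc (X + Y + 3 * ((4 * p + 8 + s + j) * k)) + (8 * p + 11 + s)) +
        ((117 * p + 245 + 30 * s + 30 * j) * (117 * p + 245 + 30 * s + 30 * j) + 1800 * ((p + suc p) * k)
          + (67 * j * (67 * j) + 26 * p * (26 * p) + (180 * (p * s) + 900 * (s * s) + 6900 * s + 1175)
             + (4 * p + 3) * (1800 * (p + suc p) + 5400 * (4 * p + 8 + s + j))))
        + (11 * (j * j) + 64 * (j * p) + 3600 * (j * s) + 35 * (p * p) + 14100 * j)
        ≡ 1800 * ((8 * p + 11 + s) * (8 * p + 11 + s)) +
        (1800 * X + 1800 * Y + (2 * (67 * j * (26 * p)) + 10530 * p + (k + j) * (1800 * (p + suc p) + 5400 * (4 * p + 8 + s + j))))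
    l = solve-∀
  -- Here (12j - 3p)² and `s≥14` take over these two tasks.
  one-small j {n₂} {X₁} {X₂} e h₂ (wide y ye h) = *-cancelˡ-≤ 50 (linear _ _ (6 * (j * j) + 2 * (j * p) + 150 * (j * s) + 740 * j + 50 * (s * s) + 540 * s + 1256 + 324 * p)
      (+-mono-≤ (+-mono-≤ (*-monoʳ-≤ 25 h) (*-monoʳ-≤ 50 h₂)) (+-mono-≤ (+-mono-≤ (2xy≤x²+y² (12 * j) (3 * p)) (*-monoʳ-≤ 30 (*-monoʳ-≤ p s≥14)))
         (+-mono-≤ (*-mono-≤ low low) (≤-reflexive (cong (_* (50 * a + 150 * (4 * p + 8 + s + j))) e)))))
      (l p s j n₂ X₁ X₂ y))
    where
    low : 3 * p + 34 + 5 * s + 5 * j ≤ 5 * y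
    low = linear _ _ 0 ye (l₁ p s j y)
      where l₁ : ∀ p s j y → 3 * p + 34 + 5 * s + 5 * j + (5 * y + 17 * p + 6) + 0 ≡ 5 * y + 5 * (4 * p + 8 + s + j)
            l₁ = solve-∀
    l : ∀ p s j k X Y y →
        50 * (suc (X + Y + 3 * ((4 * p + 8 + s + j) * k)) + (8 * p + 11 + s)) +
        (25 * ((4 * p + 8 + s + j) * (4 * p + 8 + s + j)) + 50 * ((p + suc p) * k)
          + (12 * j * (12 * j) + 3 * p * (3 * p) + 30 * (p * s) + (5 * y * (5 * y) + (4 * p + 3) * (50 * (p + suc p) + 150 * (4 * p + 8 + s + j)))))
        + (6 * (j * j) + 2 * (j * p) + 150 * (j * s) + 740 * j + 50 * (s * s) + 540 * s + 1256 + 324 * p)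
        ≡ 50 * ((8 * p + 11 + s) * (8 * p + 11 + s)) +
        (25 * (2 * X + y * y) + 50 * Y + (2 * (12 * j * (3 * p)) + 30 * (p * 14)
          + ((3 * p + 34 + 5 * s + 5 * j) * (3 * p + 34 + 5 * s + 5 * j) + (k + j) * (50 * (p + suc p) + 150 * (4 * p + 8 + s + j)))))
    l = solve-∀

  large-ordered : ∀ {n₁ n₂ X₁ X₂} → n₂ ≤ n₁ → n₁ + n₂ ≡ D → Cap p n₁ X₁ → Cap p n₂ X₂ → suc (X₁ + X₂ + 3 * (n₁ * n₂)) + D ≤ D * D
  large-ordered {n₁} {n₂} {X₁} {X₂} le e c₁ c₂ with 4 * p + 4 ≤? n₂
  ... | yes big = both-large {n₁} {n₂} {X₁} {X₂} e (large-side (≤-trans big le) c₁) (large-side big c₂)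
  ... | no small = subst (λ n₁ → Cap p n₁ X₁ → suc (X₁ + X₂ + 3 * (n₁ * n₂)) + D ≤ D * D) (sym n₁≡)
        (one-small j ej (small-side n₂≤ c₂)) c₁
    where
    n₂≤ : n₂ ≤ 4 * p + 3
    n₂≤ = ≤-pred (≤-trans (≰⇒> small) (≤-reflexive (+-suc (4 * p) 3)))
    j : ℕ
    j = 4 * p + 3 ∸ n₂
    ej : n₂ + j ≡ 4 * p + 3
    ej = m+[n∸m]≡n n₂≤
    n₁≡ : n₁ ≡ 4 * p + 8 + s + j
    n₁≡ = +-cancelʳ-≡ n₂ _ _ (trans e (sym (trans (l p s j n₂) (trans (cong (4 * p + 8 + s +_) ej) (l₀ p s)))))
      where
      l : ∀ p s j n → 4 * p + 8 + s + j + n ≡ 4 * p + 8 + s + (n + j)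
      l = solve-∀
      l₀ : ∀ p s → 4 * p + 8 + s + (4 * p + 3) ≡ 8 * p + 11 + s
      l₀ = solve-∀

  large : ∀ {n₁ n₂ X₁ X₂} → n₁ + n₂ ≡ D → Good p n₁ X₁ → Good p n₂ X₂ → suc (X₁ + X₂ + 3 * (n₁ * n₂)) + D ≤ D * D
  large {n₁} {n₂} {X₁} {X₂} e g₁ g₂ with ≤-total n₂ n₁
  ... | inj₁ le = large-ordered le e (cap p≥1 g₁) (cap p≥1 g₂)
    where p≥1 : 1 ≤ p
          p≥1 = ≤-trans (s≤s z≤n) p≥17
  ... | inj₂ le = subst (λ t → suc t + D ≤ D * D) (cong₂ _+_ (+-comm X₂ X₁) (cong (3 *_) (*-comm n₂ n₁)))
        (large-ordered le (trans (+-comm n₂ n₁) e) (cap p≥1 g₂) (cap p≥1 g₁))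
    where p≥1 : 1 ≤ p
          p≥1 = ≤-trans (s≤s z≤n) p≥17

-- Certificates and evaluation for p ≤ 16.

∧⁻ : ∀ {x y} → x ∧ y ≡ true → x ≡ true × y ≡ true
∧⁻ {true} {true} _ = refl , refl

≤ᵇ⁻ : ∀ {a b} → (a ≤ᵇ b) ≡ true → a ≤ b
≤ᵇ⁻ {a} {b} e = ≤ᵇ⇒≤ a b (subst T (sym e) _)

≡ᵇ⁻ : ∀ {a b} → (a ≡ᵇ b) ≡ true → a ≡ b
≡ᵇ⁻ {a} {b} e = ≡ᵇ⇒≡ a b (subst T (sym e) _)

all⁻ : ∀ {X : Set} {p : X → Bool} xs → all p xs ≡ true → All (λ x → p x ≡ true) xs
all⁻ [] e = []
all⁻ (x ∷ xs) e = let a , b = ∧⁻ e in a ∷ all⁻ xs b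

allTo : ℕ → (ℕ → Bool) → Bool
allTo zero f = true
allTo (suc n) f = f n ∧ allTo n f

allTo⁻ : ∀ n {f} → allTo n f ≡ true → ∀ i → i < n → f i ≡ true
allTo⁻ (suc n) e i i<n with ∧⁻ e | m≤n⇒m<n∨m≡n (≤-pred i<n)
... | a , b | inj₁ lt = allTo⁻ n b i lt
... | a , b | inj₂ refl = a

min : ℕ → ℕ → ℕ
min a b = if a ≤ᵇ b then a else b

min-elim : ∀ (P : ℕ → Set) a b → P a → P b → P (min a b)
min-elim P a b pa pb with a ≤ᵇ b
... | true = pa
... | false = pb

max : ℕ → ℕ → ℕ
max a b = if a ≤ᵇ b then b else a

≤-max : ∀ a b → a ≤ max a b × b ≤ max a b
≤-max a b with a ≤ᵇ b in e
... | true = ≤ᵇ⁻ e , ≤-refl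
... | false = ≤-refl , ≮⇒≥ λ lt → case trans (sym e) (Equivalence.to T-≡ (≤⇒≤ᵇ (<⇒≤ lt))) of λ ()

-- Linear-programming certificates: nonnegative combinations of instances of the chord inequalities.

data Ineq : Set where
  fw : ℕ → List ℕ → Ineq
  cr : ℕ → ℕ → ℕ → ℕ → Ineq
  tr : ℕ → ℕ → Ineq
  un : ℕ → Ineq
  t₈₁₅ : Ineq

infix 6 _·_
record Weighted : Set where
  constructor _·_
  field
    weight : ℕ
    ineq : Ineq

-- den · S ≤ num · ℓ with den = suc den-1.
record Entry : Set where
  constructor entry
  field
    ℓ num den-1 : ℕ
    cert : List Weighted

module Certificate (p ℓ : ℕ) where
  private
    m : ℕ
    m = suc p + suc p

  lhs : Ineq → List ℕ
  lhs (fw t ss) = t ∷ ss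
  lhs (cr a α b β) = a + α ∷ α + b ∷ []
  lhs (tr b e) = p + b ∷ p + b ∷ e ∷ []
  lhs (un w) = w ∷ []
  lhs t₈₁₅ = 3 ∷ 5 ∷ 6 ∷ []

  rhs : Ineq → ℕ
  rhs (fw t ss) = length ss
  rhs _ = 1

  valid : Ineq → Bool
  valid (fw t ss) = all (1 ≤ᵇ_) (t ∷ ss) ∧ ((length (t ∷ ss) ≤ᵇ m) ∧ (sum (t ∷ ss) + (m ∸ length (t ∷ ss)) ≡ᵇ ℓ))
  valid (cr a α b β) = (1 ≤ᵇ a) ∧ ((1 ≤ᵇ b) ∧ ((α + β + 2 ≡ᵇ m) ∧ (a + α + b + β ≡ᵇ ℓ)))
  valid (tr b e) = (1 ≤ᵇ e) ∧ ((1 ≤ᵇ b) ∧ (p + e + b + (p + p) ≡ᵇ ℓ))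
  valid (un w) = true
  valid t₈₁₅ = (m ≡ᵇ 8) ∧ (ℓ ≡ᵇ 15)

  -- Complementary lengths have equal ρ and count as one variable of the linear program, named by
  -- the smaller length.
  class : ℕ → ℕ
  class w = if w + w ≤ᵇ ℓ then w else (if w ≤ᵇ ℓ then ℓ ∸ w else w)

  coef : List Weighted → ℕ → ℕ
  coef ws c = ∑ ws (λ { (k · q) → k * ∑ (lhs q) (λ w → ⟦ class w ≡ᵇ c ⟧) })

  -- `S` contains the classes 1, ..., h₁ twice; for even ℓ there is one more class h₂ = ℓ/2,
  -- contained once.
  h₁ h₂ : ℕ
  h₁ = (ℓ ∸ 1) / 2
  h₂ = ℓ ∸ 1 ∸ h₁

  -- Weak duality: the weights are a dual solution if at every class their combined coefficient
  -- reaches `den` times the multiplicity of the class in `S`.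
  certifies : ℕ → ℕ → List Weighted → Bool
  certifies num den ws = all (λ { (k · q) → valid q }) ws ∧ ((∑ ws (λ { (k · q) → k * rhs q }) ≤ᵇ num) ∧ ((1 ≤ᵇ ℓ) ∧ ((h₁ ≤ᵇ h₂) ∧
    allTo h₂ (λ c → den * (⟦ suc c ≤ᵇ h₁ ⟧ + 1) ≤ᵇ coef ws (suc c)))))

  module _ {ρ : ℕ → ℕ} (ch : Chords m ℓ ρ) where
    open Count ch
    open Even p refl

    sound-ineq : ∀ q → valid q ≡ true → ∑ (lhs q) ρ ≤ rhs q * ℓ
    sound-ineq (fw t ss) v =
      let a , v₁ = ∧⁻ v ; b , c = ∧⁻ v₁ in
      +-cancelʳ-≤ ℓ _ _ (≤-trans (chords≤ t ss (m ∸ length (t ∷ ss)) (All.map ≤ᵇ⁻ (all⁻ (t ∷ ss) a)) (≡ᵇ⁻ c) (m+[n∸m]≡n (≤ᵇ⁻ {length (t ∷ ss)} b)))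
        (≤-reflexive (+-comm ℓ _)))
    sound-ineq (cr a α b β) v =
      let a≥1 , v₁ = ∧⁻ v ; b≥1 , v₂ = ∧⁻ v₁ ; e₁ , e₂ = ∧⁻ v₂ in
      ≤-trans (≤-reflexive (cong (ρ (a + α) +_) (+-identityʳ _))) (≤-trans (cross a α b β (≤ᵇ⁻ a≥1) (≤ᵇ⁻ b≥1) (≡ᵇ⁻ e₁) (≡ᵇ⁻ e₂)) (≤-reflexive (sym (+-identityʳ ℓ))))
    sound-ineq (tr b e) v =
      let e≥1 , v₁ = ∧⁻ v ; b≥1 , eq = ∧⁻ v₁ in
      ≤-trans (≤-reflexive (lem (ρ (p + b)) (ρ e))) (≤-trans (triangle b e (≤ᵇ⁻ b≥1) (≤ᵇ⁻ e≥1) (≡ᵇ⁻ eq)) (≤-reflexive (sym (+-identityʳ ℓ))))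
      where lem : ∀ x y → x + (x + (y + 0)) ≡ 2 * x + y
            lem = solve-∀
    sound-ineq (un w) v = +-monoˡ-≤ 0 (ρ≤ w)
    sound-ineq t₈₁₅ v = let a , b = ∧⁻ v in
      ≤-trans (≤-reflexive (cong (λ t → ρ 3 + (ρ 5 + t)) (+-identityʳ _))) (≤-trans (tri-8-15 (≡ᵇ⁻ a) (≡ᵇ⁻ b)) (≤-reflexive (sym (+-identityʳ ℓ))))

    ρ-class : ∀ w → ρ (class w) ≡ ρ w
    ρ-class w with w + w ≤ᵇ ℓ
    ... | true = refl
    ... | false with w ≤ᵇ ℓ in e
    ...   | true = flip (m+[n∸m]≡n (≤ᵇ⁻ {w} {ℓ} e))
    ...   | false = refl

    pick : ∀ B x (f : ℕ → ℕ) → sumTo B (λ c → ⟦ x ≡ᵇ c ⟧ * f c) ≤ f x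
    pick zero x f = z≤n
    pick (suc B) zero f = ≤-reflexive (trans (cong₂ _+_ (+-identityʳ (f 0)) (trans (sumTo-const B 0) (*-zeroʳ B))) (+-identityʳ (f 0)))
    pick (suc B) (suc x) f = pick B x (f ∘ suc)

    -- An inequality only, since lengths whose class is 0 or above `B` are dropped.
    pick-list : ∀ B ws → sumTo B (λ c → ∑ ws (λ w → ⟦ class w ≡ᵇ suc c ⟧) * ρ (suc c)) ≤ ∑ ws ρ
    pick-list B [] = ≤-reflexive (trans (sumTo-const B 0) (*-zeroʳ B))
    pick-list B (w ∷ ws) = begin
      sumTo B (λ c → (⟦ class w ≡ᵇ suc c ⟧ + ∑ ws (λ w → ⟦ class w ≡ᵇ suc c ⟧)) * ρ (suc c))
        ≡⟨ trans (sumTo-cong B (λ c _ → *-distribʳ-+ (ρ (suc c)) ⟦ class w ≡ᵇ suc c ⟧ _)) (sumTo-+ B _ _) ⟩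
      sumTo B (λ c → ⟦ class w ≡ᵇ suc c ⟧ * ρ (suc c)) + sumTo B (λ c → ∑ ws (λ w → ⟦ class w ≡ᵇ suc c ⟧) * ρ (suc c))
        ≤⟨ +-mono-≤ (≤-trans (m≤n+m _ _) (pick (suc B) (class w) ρ)) (pick-list B ws) ⟩
      ρ (class w) + ∑ ws ρ
        ≡⟨ cong (_+ ∑ ws ρ) (ρ-class w) ⟩
      ρ w + ∑ ws ρ ∎
      where open ≤-Reasoning

    combine : ∀ B ws → All (λ { (k · q) → valid q ≡ true }) ws →
              sumTo B (λ c → coef ws (suc c) * ρ (suc c)) ≤ ∑ ws (λ { (k · q) → k * rhs q }) * ℓ
    combine B [] _ = ≤-reflexive (trans (sumTo-const B 0) (*-zeroʳ B))
    combine B ((k · q) ∷ ws) (v ∷ vs) = begin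
      sumTo B (λ c → (k * f c + coef ws (suc c)) * ρ (suc c))
        ≡⟨ trans (sumTo-cong B (λ c _ → trans (*-distribʳ-+ (ρ (suc c)) (k * f c) _) (cong (_+ coef ws (suc c) * ρ (suc c)) (*-assoc k (f c) _)))) (sumTo-+ B _ _) ⟩
      sumTo B (λ c → k * (f c * ρ (suc c))) + sumTo B (λ c → coef ws (suc c) * ρ (suc c))
        ≡⟨ cong (_+ sumTo B (λ c → coef ws (suc c) * ρ (suc c))) (sym (sumTo-* B k _)) ⟩
      k * sumTo B (λ c → f c * ρ (suc c)) + sumTo B (λ c → coef ws (suc c) * ρ (suc c))
        ≤⟨ +-mono-≤ (*-monoʳ-≤ k (≤-trans (pick-list B (lhs q)) (sound-ineq q v))) (combine B ws vs) ⟩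
      k * (rhs q * ℓ) + R * ℓ
        ≡⟨ cong (_+ R * ℓ) (sym (*-assoc k (rhs q) ℓ)) ⟩
      k * rhs q * ℓ + R * ℓ
        ≡⟨ sym (*-distribʳ-+ ℓ (k * rhs q) R) ⟩
      (k * rhs q + R) * ℓ ∎
      where
      open ≤-Reasoning
      R : ℕ
      R = ∑ ws (λ { (k · q) → k * rhs q })
      f : ℕ → ℕ
      f c = ∑ (lhs q) (λ w → ⟦ class w ≡ᵇ suc c ⟧)

    certificate : ∀ num den ws → certifies num den ws ≡ true → den * S ≤ num * ℓ
    certificate num den ws e =
      let vs , e₁ = ∧⁻ e ; tot , e₂ = ∧⁻ e₁ ; ℓ≥1 , e₃ = ∧⁻ e₂ ; h≤ , cs = ∧⁻ e₃ in begin
      den * S                                                   ≤⟨ *-monoʳ-≤ den (S≤ (≤ᵇ⁻ ℓ≥1) (≤ᵇ⁻ h≤)) ⟩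
      den * sumTo h₂ (λ c → (⟦ suc c ≤ᵇ h₁ ⟧ + 1) * ρ (suc c))  ≡⟨ trans (sumTo-* h₂ den _) (sumTo-cong h₂ (λ c _ → sym (*-assoc den _ _))) ⟩
      sumTo h₂ (λ c → den * (⟦ suc c ≤ᵇ h₁ ⟧ + 1) * ρ (suc c))  ≤⟨ sumTo-mono h₂ (λ c c< → *-monoˡ-≤ (ρ (suc c)) (≤ᵇ⁻ {den * (⟦ suc c ≤ᵇ h₁ ⟧ + 1)} {coef ws (suc c)} (allTo⁻ h₂ cs c c<))) ⟩
      sumTo h₂ (λ c → coef ws (suc c) * ρ (suc c))              ≤⟨ combine h₂ ws (All.map (λ { {k · q} v → v }) (all⁻ ws vs)) ⟩
      ∑ ws (λ { (k · q) → k * rhs q }) * ℓ                      ≤⟨ *-monoˡ-≤ ℓ (≤ᵇ⁻ {∑ ws (λ { (k · q) → k * rhs q })} {num} tot) ⟩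
      num * ℓ ∎
      where
      open ≤-Reasoning
      S≤ : 1 ≤ ℓ → h₁ ≤ h₂ → S ≤ sumTo h₂ (λ c → (⟦ suc c ≤ᵇ h₁ ⟧ + 1) * ρ (suc c))
      S≤ ℓ≥1 h≤ = begin
        S                                                       ≡⟨ cong (λ t → sumTo t ρ) eℓ ⟩
        ρ 0 + sumTo (h₁ + h₂) (ρ ∘ suc)                         ≡⟨ cong₂ _+_ ρ0 (sumTo-split h₁ h₂ (ρ ∘ suc)) ⟩
        sumTo h₁ (ρ ∘ suc) + sumTo h₂ (λ i → ρ (suc (h₁ + i)))  ≡⟨ cong (sumTo h₁ (ρ ∘ suc) +_) (trans (sumTo-rev h₂ _) (sumTo-cong h₂ mirror)) ⟩
        sumTo h₁ (ρ ∘ suc) + sumTo h₂ (ρ ∘ suc)                 ≤⟨ +-monoˡ-≤ (sumTo h₂ (ρ ∘ suc)) low ⟩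
        sumTo h₂ (λ c → ⟦ suc c ≤ᵇ h₁ ⟧ * ρ (suc c)) + sumTo h₂ (ρ ∘ suc) ≡⟨ sym (sumTo-+ h₂ _ _) ⟩
        sumTo h₂ (λ c → ⟦ suc c ≤ᵇ h₁ ⟧ * ρ (suc c) + ρ (suc c)) ≡⟨ sumTo-cong h₂ (λ c _ → trans (cong (⟦ suc c ≤ᵇ h₁ ⟧ * ρ (suc c) +_) (sym (+-identityʳ _))) (sym (*-distribʳ-+ (ρ (suc c)) ⟦ suc c ≤ᵇ h₁ ⟧ 1))) ⟩
        sumTo h₂ (λ c → (⟦ suc c ≤ᵇ h₁ ⟧ + 1) * ρ (suc c)) ∎
        where
        h₁≤ : h₁ ≤ ℓ ∸ 1
        h₁≤ = m/n≤m (ℓ ∸ 1) 2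
        eℓ : ℓ ≡ suc (h₁ + h₂)
        eℓ = trans (sym (m+[n∸m]≡n ℓ≥1)) (cong suc (sym (m+[n∸m]≡n h₁≤)))
        mirror : ∀ i → i < h₂ → ρ (suc (h₁ + (h₂ ∸ suc i))) ≡ ρ (suc i)
        mirror i i< = flip (trans (l i h₁ (h₂ ∸ suc i)) (trans (cong (λ t → suc (h₁ + t)) (m+[n∸m]≡n i<)) (sym eℓ)))
          where l : ∀ i a r → suc i + suc (a + r) ≡ suc (a + (suc i + r))
                l = solve-∀
        ind : ∀ c → c < h₁ → ρ (suc c) ≤ ⟦ suc c ≤ᵇ h₁ ⟧ * ρ (suc c)
        ind c c< with suc c ≤ᵇ h₁ in e
        ... | true = ≤-reflexive (sym (+-identityʳ _))
        ... | false = ⊥-elim (subst T e (≤⇒≤ᵇ c<))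
        low : sumTo h₁ (ρ ∘ suc) ≤ sumTo h₂ (λ c → ⟦ suc c ≤ᵇ h₁ ⟧ * ρ (suc c))
        low = ≤-trans (sumTo-mono h₁ ind) (≤-trans (m≤m+n _ _) (≤-reflexive (trans (sym (sumTo-split h₁ (h₂ ∸ h₁) _))
                (cong (λ t → sumTo t (λ c → ⟦ suc c ≤ᵇ h₁ ⟧ * ρ (suc c))) (m+[n∸m]≡n h≤)))))

table : ℕ → List Entry
table 3 =
    entry 11 5 0 (
      2 · un 1 ∷ 2 · fw 4 ([]) ∷ 1 · fw 3 (2 ∷ []) ∷ 1 · cr 1 1 4 5 ∷ 1 · cr 1 2 4 4 ∷ []) ∷
    entry 14 37 5 (
      12 · un 1 ∷ 6 · fw 7 ([]) ∷ 2 · fw 3 (3 ∷ 3 ∷ []) ∷ 1 · fw 2 (2 ∷ 2 ∷ 2 ∷ 2 ∷ 2 ∷ []) ∷ 4 · tr 1 4 ∷ 6 · tr 2 3 ∷ 6 · tr 3 2 ∷ []) ∷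
    entry 15 276 41 (
      84 · un 1 ∷ 84 · fw 8 ([]) ∷ 7 · fw 3 (3 ∷ 3 ∷ 2 ∷ []) ∷ 11 · fw 2 (2 ∷ 2 ∷ 2 ∷ 2 ∷ 2 ∷ 2 ∷ []) ∷ 42 · tr 1 5 ∷ 21 · tr 3 3 ∷ 42 · t₈₁₅ ∷ []) ∷
    entry 16 111 15 (
      32 · un 1 ∷ 32 · fw 9 ([]) ∷ 1 · fw 2 (2 ∷ 2 ∷ 2 ∷ 2 ∷ 2 ∷ 2 ∷ 2 ∷ []) ∷ 16 · tr 1 6 ∷ 8 · tr 5 2 ∷ 16 · cr 1 1 9 5 ∷ 32 · cr 1 2 9 4 ∷ []) ∷
    entry 17 22 2 (
      6 · un 1 ∷ 3 · fw 10 ([]) ∷ 3 · tr 1 7 ∷ 1 · tr 2 6 ∷ 2 · tr 5 3 ∷ 1 · tr 6 2 ∷ 5 · cr 1 1 10 5 ∷ 4 · cr 1 2 10 4 ∷ []) ∷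
    entry 18 89 11 (
      24 · un 1 ∷ 21 · fw 11 ([]) ∷ 12 · tr 1 8 ∷ 3 · tr 2 7 ∷ 2 · tr 3 6 ∷ 6 · tr 6 3 ∷ 6 · tr 7 2 ∷ 18 · cr 1 1 11 5 ∷ 18 · cr 1 2 11 4 ∷ []) ∷ []
table 4 =
    entry 18 95 11 (
      24 · un 1 ∷ 12 · fw 9 ([]) ∷ 6 · fw 4 (4 ∷ 2 ∷ 2 ∷ []) ∷ 3 · fw 3 (3 ∷ 3 ∷ 3 ∷ []) ∷ 8 · tr 1 5 ∷ 12 · tr 2 4 ∷ 12 · tr 3 3 ∷ 12 · tr 4 2 ∷ []) ∷
    entry 19 77 8 (
      18 · un 1 ∷ 18 · fw 10 ([]) ∷ 1 · fw 4 (4 ∷ 4 ∷ []) ∷ 6 · fw 4 (3 ∷ 3 ∷ 3 ∷ []) ∷ 6 · tr 1 6 ∷ 6 · tr 2 5 ∷ 9 · tr 3 4 ∷ 18 · cr 1 1 10 7 ∷ []) ∷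
    entry 20 107 11 (
      24 · un 1 ∷ 24 · fw 11 ([]) ∷ 6 · fw 4 (4 ∷ 3 ∷ 3 ∷ []) ∷ 12 · tr 1 7 ∷ 5 · tr 2 6 ∷ 3 · tr 4 4 ∷ 6 · tr 6 2 ∷ 18 · cr 1 1 11 7 ∷ 12 · cr 1 2 11 6 ∷ 9 · cr 1 3 11 5 ∷ []) ∷
    entry 21 9 0 (
      2 · un 1 ∷ 2 · fw 12 ([]) ∷ 1 · tr 1 8 ∷ 1 · tr 7 2 ∷ 1 · cr 1 1 12 7 ∷ 2 · cr 1 2 12 6 ∷ 2 · cr 1 3 12 5 ∷ []) ∷
    entry 22 57 5 (
      12 · un 1 ∷ 6 · fw 13 ([]) ∷ 6 · tr 1 9 ∷ 2 · tr 2 8 ∷ 1 · tr 3 7 ∷ 4 · tr 6 4 ∷ 3 · tr 7 3 ∷ 2 · tr 8 2 ∷ 10 · cr 1 1 13 7 ∷ 9 · cr 1 2 13 6 ∷ 8 · cr 1 3 13 5 ∷ []) ∷ []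
table 5 =
    entry 18 16 1 (
      4 · un 1 ∷ 4 · fw 7 ([]) ∷ 2 · fw 5 (3 ∷ []) ∷ 1 · fw 4 (4 ∷ []) ∷ 2 · tr 1 2 ∷ 2 · cr 1 1 7 9 ∷ 1 · cr 4 1 4 9 ∷ 2 · cr 1 2 7 8 ∷ 2 · cr 2 2 6 8 ∷ []) ∷
    entry 23 21 1 (
      4 · un 1 ∷ 4 · fw 12 ([]) ∷ 2 · fw 7 (4 ∷ 3 ∷ []) ∷ 1 · fw 5 (5 ∷ 4 ∷ []) ∷ 2 · tr 1 7 ∷ 2 · tr 3 5 ∷ 1 · tr 4 4 ∷ 4 · cr 1 1 12 9 ∷ 2 · cr 1 2 12 8 ∷ []) ∷
    entry 24 261 23 (
      48 · un 1 ∷ 48 · fw 13 ([]) ∷ 9 · fw 7 (4 ∷ 4 ∷ []) ∷ 16 · fw 5 (5 ∷ 5 ∷ []) ∷ 24 · tr 1 8 ∷ 13 · tr 2 7 ∷ 6 · tr 5 4 ∷ 12 · tr 7 2 ∷ 36 · cr 1 1 13 9 ∷ 48 · cr 1 2 13 8 ∷ 24 · cr 1 3 13 7 ∷ []) ∷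
    entry 25 11 0 (
      2 · un 1 ∷ 2 · fw 14 ([]) ∷ 1 · tr 1 9 ∷ 1 · tr 7 3 ∷ 2 · cr 1 1 14 9 ∷ 1 · cr 1 2 14 8 ∷ 2 · cr 1 3 14 7 ∷ 2 · cr 1 4 14 6 ∷ []) ∷
    entry 26 67 5 (
      12 · un 1 ∷ 12 · fw 15 ([]) ∷ 6 · tr 1 10 ∷ 1 · tr 2 9 ∷ 3 · tr 8 3 ∷ 6 · tr 9 2 ∷ 6 · cr 1 1 15 9 ∷ 9 · cr 1 2 15 8 ∷ 12 · cr 1 3 15 7 ∷ 2 · cr 2 3 14 7 ∷ 10 · cr 1 4 15 6 ∷ []) ∷ []
table 6 =
    entry 27 295 23 (
      48 · un 1 ∷ 48 · fw 14 ([]) ∷ 21 · fw 8 (4 ∷ 4 ∷ []) ∷ 6 · fw 6 (6 ∷ 4 ∷ []) ∷ 12 · fw 6 (5 ∷ 5 ∷ []) ∷ 23 · tr 1 8 ∷ 2 · tr 2 7 ∷ 24 · tr 3 6 ∷ 24 · tr 4 5 ∷ 48 · cr 1 1 14 11 ∷ 48 · cr 1 2 14 10 ∷ []) ∷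
    entry 28 3052 239 (
      480 · un 1 ∷ 480 · fw 15 ([]) ∷ 6 · fw 7 (5 ∷ 5 ∷ []) ∷ 225 · fw 6 (6 ∷ 5 ∷ []) ∷ 237 · tr 1 9 ∷ 160 · tr 2 8 ∷ 30 · tr 4 6 ∷ 60 · tr 6 4 ∷ 120 · tr 8 2 ∷ 360 · cr 1 1 15 11 ∷ 480 · cr 1 2 15 10 ∷ 420 · cr 1 3 15 9 ∷ 243 · cr 1 4 15 8 ∷ []) ∷
    entry 29 13 0 (
      2 · un 1 ∷ 2 · fw 16 ([]) ∷ 1 · tr 1 10 ∷ 1 · tr 9 2 ∷ 1 · cr 1 1 16 11 ∷ 2 · cr 1 2 16 10 ∷ 1 · cr 2 2 15 10 ∷ 1 · cr 1 3 16 9 ∷ 2 · cr 1 4 16 8 ∷ 2 · cr 1 5 16 7 ∷ []) ∷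
    entry 30 66 4 (
      10 · un 1 ∷ 10 · fw 17 ([]) ∷ 1 · fw 12 (4 ∷ 3 ∷ []) ∷ 5 · tr 1 11 ∷ 1 · tr 2 10 ∷ 2 · tr 6 6 ∷ 4 · tr 9 3 ∷ 5 · tr 10 2 ∷ 5 · cr 1 1 17 11 ∷ 5 · cr 1 2 17 10 ∷ 9 · cr 1 3 17 9 ∷ 10 · cr 1 4 17 8 ∷ 8 · cr 1 5 17 7 ∷ []) ∷ []
table 7 =
    entry 31 254 17 (
      36 · un 1 ∷ 36 · fw 16 ([]) ∷ 18 · fw 12 (3 ∷ 3 ∷ []) ∷ 15 · fw 9 (5 ∷ 4 ∷ []) ∷ 3 · fw 7 (7 ∷ 4 ∷ []) ∷ 12 · fw 7 (6 ∷ 5 ∷ []) ∷ 2 · fw 6 (6 ∷ 6 ∷ []) ∷ 17 · tr 1 9 ∷ 2 · tr 2 8 ∷ 18 · tr 3 7 ∷ 18 · tr 4 6 ∷ 9 · tr 5 5 ∷ 18 · tr 6 4 ∷ 36 · cr 1 1 16 13 ∷ []) ∷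
    entry 32 701 47 (
      96 · un 1 ∷ 96 · fw 17 ([]) ∷ 30 · fw 7 (7 ∷ 5 ∷ []) ∷ 21 · fw 7 (6 ∷ 6 ∷ []) ∷ 48 · tr 1 10 ∷ 32 · tr 2 9 ∷ 15 · tr 4 7 ∷ 6 · tr 5 6 ∷ 12 · tr 7 4 ∷ 24 · tr 9 2 ∷ 72 · cr 1 1 17 13 ∷ 96 · cr 1 2 17 12 ∷ 84 · cr 1 3 17 11 ∷ 66 · cr 1 4 17 10 ∷ 48 · cr 1 5 17 9 ∷ []) ∷
    entry 33 239 15 (
      32 · un 1 ∷ 32 · fw 18 ([]) ∷ 3 · fw 10 (5 ∷ 5 ∷ []) ∷ 2 · fw 9 (6 ∷ 5 ∷ []) ∷ 16 · fw 7 (7 ∷ 6 ∷ []) ∷ 16 · tr 1 11 ∷ 15 · tr 2 10 ∷ 8 · tr 7 5 ∷ 16 · tr 10 2 ∷ 16 · cr 1 1 18 13 ∷ 32 · cr 1 2 18 12 ∷ 32 · cr 1 3 18 11 ∷ 16 · cr 1 4 18 10 ∷ 14 · cr 1 5 18 9 ∷ []) ∷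
    entry 34 151 9 (
      20 · un 1 ∷ 20 · fw 19 ([]) ∷ 10 · tr 1 12 ∷ 1 · tr 2 11 ∷ 2 · tr 6 7 ∷ 10 · tr 9 4 ∷ 5 · tr 10 3 ∷ 20 · cr 1 1 19 13 ∷ 15 · cr 1 2 19 12 ∷ 10 · cr 1 3 19 11 ∷ 1 · cr 2 3 18 11 ∷ 19 · cr 1 4 19 10 ∷ 20 · cr 1 5 19 9 ∷ 18 · cr 1 6 19 8 ∷ []) ∷ []
table 8 =
    entry 36 593 35 (
      72 · un 1 ∷ 72 · fw 19 ([]) ∷ 21 · fw 11 (6 ∷ 4 ∷ []) ∷ 36 · fw 8 (7 ∷ 6 ∷ []) ∷ 12 · fw 7 (7 ∷ 7 ∷ []) ∷ 31 · tr 1 11 ∷ 24 · tr 2 10 ∷ 10 · tr 3 9 ∷ 36 · tr 4 8 ∷ 15 · tr 6 6 ∷ 9 · tr 8 4 ∷ 18 · tr 10 2 ∷ 54 · cr 1 1 19 15 ∷ 72 · cr 1 2 19 14 ∷ 42 · cr 1 3 19 13 ∷ 72 · cr 1 4 19 12 ∷ []) ∷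
    entry 38 103 5 (
      12 · un 1 ∷ 12 · fw 21 ([]) ∷ 2 · fw 12 (8 ∷ 3 ∷ []) ∷ 6 · tr 1 13 ∷ 1 · tr 2 12 ∷ 3 · tr 8 6 ∷ 3 · tr 11 3 ∷ 6 · tr 12 2 ∷ 6 · cr 1 1 21 15 ∷ 7 · cr 1 2 21 14 ∷ 12 · cr 1 3 21 13 ∷ 5 · cr 2 3 20 13 ∷ 7 · cr 1 4 21 12 ∷ 9 · cr 1 5 21 11 ∷ 12 · cr 1 6 21 10 ∷ 10 · cr 1 7 21 9 ∷ []) ∷ []

table _ = []

-- Six times an upper bound for the average degree on a cycle of length ℓ.
formula : ℕ → ℕ → ℕ
formula p ℓ with 4 * p <? ℓ
... | yes _ = let g = ℓ ∸ suc (4 * p) ; k = proj₁ (half (p ∸ g)) in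
              min (3 * ℓ) (min (12 * p + 2 * g + 3 ∸ k) (2 * (6 * p + 2 * g ∸ k)))
... | no _ with suc (suc (3 * p)) ≤? ℓ
...   | no _ = 3 * ℓ
...   | yes _ with suc (suc (p ∸ suc (ℓ ∸ suc (3 * p)))) ≤? ℓ ∸ suc (3 * p)
...     | yes _ = let u = ℓ ∸ suc (3 * p) ; h = p ∸ suc u ; v = u ∸ suc (suc h) in
                  2 * (3 * (u + 2 * h + 3 + v) ∸ proj₁ (half (suc v)))
...     | no _ = min (3 * ℓ) (6 * (p + (p ∸ suc (ℓ ∸ suc (3 * p))) + 2))

module _ {p ℓ : ℕ} {ρ : ℕ → ℕ} (ch : Chords (suc p + suc p) ℓ ρ) (p≥1 : 1 ≤ p) (m<ℓ : suc p + suc p < ℓ) where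
  open Count ch using (S)
  open Bounds ch p refl p≥1

  private
    Bound : ℕ → Set
    Bound a = 6 * S ≤ a * ℓ

    trunc : ∀ {x} c k → x + k * ℓ ≤ c * ℓ → x ≤ (c ∸ k) * ℓ
    trunc {x} c k h = ≤-trans (m+n≤o⇒m≤o∸n x h) (≤-reflexive (sym (*-distribʳ-∸ ℓ c k)))

    bondy6 : Bound (3 * ℓ)
    bondy6 = ≤-trans (≤-reflexive (l₁ S)) (≤-trans (*-monoʳ-≤ 3 (Any.bondy m<ℓ)) (≤-reflexive (sym (*-assoc 3 ℓ ℓ))))
      where l₁ : ∀ S → 6 * S ≡ 3 * (2 * S)
            l₁ = solve-∀

    twice : ∀ {c} → 3 * S ≤ c * ℓ → Bound (2 * c)
    twice {c} h = ≤-trans (≤-reflexive (l₁ S)) (≤-trans (*-monoʳ-≤ 2 h) (≤-reflexive (sym (*-assoc 2 c ℓ))))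
      where l₁ : ∀ S → 6 * S ≡ 2 * (3 * S)
            l₁ = solve-∀

    module NarrowRange (le : ¬ (4 * p < ℓ)) (big : suc (suc (3 * p)) ≤ ℓ) where
      u h : ℕ
      u = ℓ ∸ suc (3 * p)
      h = p ∸ suc u
      eℓ : ℓ ≡ suc u + 3 * p
      eℓ = sym (trans (lem u p) (m∸n+n≡m (≤-trans (n≤1+n _) big)))
        where lem : ∀ g p → suc g + 3 * p ≡ g + suc (3 * p)
              lem = solve-∀
      u<p : suc u ≤ p
      u<p = +-cancelʳ-≤ (3 * p) _ _ (≤-trans (≤-reflexive (sym eℓ)) (≤-trans (≮⇒≥ le) (≤-reflexive (lem p))))
        where lem : ∀ p → 4 * p ≡ p + 3 * p
              lem = solve-∀
      ep : p ≡ u + suc h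
      ep = sym (trans (+-suc u h) (m+[n∸m]≡n u<p))
      u≥1 : 1 ≤ u
      u≥1 = m+n≤o⇒m≤o∸n 1 big
      open Narrow u h ep eℓ u≥1 public

  formula-bound : 6 * S ≤ formula p ℓ * ℓ
  formula-bound with 4 * p <? ℓ
  ... | yes gt = min-elim Bound (3 * ℓ) _ bondy6 (min-elim Bound (12 * p + 2 * g + 3 ∸ k) (2 * (6 * p + 2 * g ∸ k))
        (trunc (12 * p + 2 * g + 3) k (boundA k fits)) (twice {6 * p + 2 * g ∸ k} (trunc (6 * p + 2 * g) k (boundB k fits))))
    where
    g k : ℕ
    g = ℓ ∸ suc (4 * p)
    k = proj₁ (half (p ∸ g))
    lem : ∀ g p → suc g + 4 * p ≡ g + suc (4 * p)
    lem = solve-∀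
    open Wide g (sym (trans (lem g p) (m∸n+n≡m gt)))
    2k≤ : 2 * k ≤ p ∸ g
    2k≤ = proj₁ (proj₂ (half (p ∸ g)))
    fits : Fits k
    fits with ≤-total g p
    ... | inj₁ g≤p = inj₂ (≤-trans (m≤m+n k (k + 0)) (≤-trans 2k≤ (m∸n≤m p g)) , ≤-trans (+-monoʳ-≤ g 2k≤) (≤-reflexive (m+[n∸m]≡n g≤p)))
    ... | inj₂ p≤g = inj₁ (n≤0⇒n≡0 (≤-trans (m≤m+n k (k + 0)) (≤-trans 2k≤ (≤-reflexive (m≤n⇒m∸n≡0 p≤g)))))
  ... | no le with suc (suc (3 * p)) ≤? ℓ
  ...   | no _ = bondy6
  ...   | yes big with suc (suc (p ∸ suc (ℓ ∸ suc (3 * p)))) ≤? ℓ ∸ suc (3 * p)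
  ...     | yes h<u = twice {3 * (u + 2 * h + 3 + v) ∸ k} (trunc (3 * (u + 2 * h + 3 + v)) k
              (boundC v (trans (sym (m+[n∸m]≡n h<u)) (sym (+-suc (suc h) v))) k k≤v (proj₁ (proj₂ (half (suc v))))))
    where
    open NarrowRange le big
    v k : ℕ
    v = u ∸ suc (suc h)
    k = proj₁ (half (suc v))
    k≤v : k ≤ v
    k≤v = small k (proj₁ (proj₂ (half (suc v))))
      where
      small : ∀ k → 2 * k ≤ suc v → k ≤ v
      small zero _ = z≤n
      small (suc k) le = ≤-pred (≤-trans (s≤s (m≤n+m (suc k) k)) (≤-trans (≤-reflexive (lem k)) le))
        where lem : ∀ k → suc (k + suc k) ≡ 2 * suc k
              lem = solve-∀
  ...     | no h≮u = min-elim Bound (3 * ℓ) (6 * (p + h + 2)) bondy6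
              (≤-trans (*-monoʳ-≤ 6 (boundD (u ∸ 1) (suc h ∸ (u ∸ 1)) (sym (m+[n∸m]≡n u≥1)) (sym (m∸n+n≡m t≤)))) (≤-reflexive (sym (*-assoc 6 (p + h + 2) ℓ))))
    where
    open NarrowRange le big
    t≤ : u ∸ 1 ≤ suc h
    t≤ = ≤-trans (∸-monoˡ-≤ 1 (≤-pred (≰⇒> h≮u))) (n≤1+n h)

lookup : ℕ → List Entry → ℕ × ℕ → ℕ × ℕ
lookup ℓ [] d = d
lookup ℓ (entry ℓ′ num den-1 _ ∷ es) d = if ℓ ≡ᵇ ℓ′ then (num , den-1) else lookup ℓ es d

-- Lengths missing from the table fall back on `formula`; 5 stands for the denominator 6 there.
rate : ℕ → ℕ → ℕ × ℕ
rate p ℓ = lookup ℓ (table p) (formula p ℓ , 5)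

valid-table : ℕ → Bool
valid-table p = all (λ { (entry ℓ num den-1 cert) → Certificate.certifies p ℓ num (suc den-1) cert }) (table p)

-- Rounding down loses nothing, as the number bounded is an integer; y counts the vertices off the
-- cycle.
side : ℕ → ℕ → ℕ → ℕ
side p ℓ y = let (num , den-1) = rate p ℓ in (num * ℓ + suc den-1 * (ℓ * y)) / suc den-1

maxTo : ℕ → (ℕ → ℕ) → ℕ
maxTo zero f = 0
maxTo (suc n) f = max (f n) (maxTo n f)

≤-maxTo : ∀ n f i → i < n → f i ≤ maxTo n f
≤-maxTo (suc n) f i i<n with m≤n⇒m<n∨m≡n (≤-pred i<n)
... | inj₁ lt = ≤-trans (≤-maxTo n f i lt) (proj₂ (≤-max (f n) _))
... | inj₂ refl = proj₁ (≤-max (f n) _)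

extremal : ℕ → ℕ → ℕ
extremal p n = max ((p + suc p) * (n ∸ 1)) (maxTo (n ∸ (suc p + suc p)) (λ i → let ℓ = suc (suc p + suc p) + i in side p ℓ (n ∸ ℓ)))

-- For p ≤ 16 the minimum in the theorem is p - 3.
order : ℕ → ℕ
order p = 8 * p + 11 + (p ∸ 3)

sparse-enough : ℕ → Bool
sparse-enough p = let D = order p in
  allTo (suc D) (λ r → suc (extremal p r + extremal p (D ∸ r) + 3 * (r * (D ∸ r))) + D ≤ᵇ D * D)

module Evaluated (p : ℕ) (p≥1 : 1 ≤ p) (vt : valid-table p ≡ true) (se : sparse-enough p ≡ true) where

  lookup-sound : ∀ {ρ ℓ} → Chords (suc p + suc p) ℓ ρ → ∀ es → All (λ { (entry ℓ num den-1 cert) → Certificate.certifies p ℓ num (suc den-1) cert ≡ true }) es →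
    ∀ d → suc (proj₂ d) * sumTo ℓ ρ ≤ proj₁ d * ℓ → suc (proj₂ (lookup ℓ es d)) * sumTo ℓ ρ ≤ proj₁ (lookup ℓ es d) * ℓ
  lookup-sound ch [] _ d h = h
  lookup-sound {ρ} {ℓ} ch (entry ℓ′ num den-1 cert ∷ es) (c ∷ cs) d h with ℓ ≡ᵇ ℓ′ in e
  ... | false = lookup-sound ch es cs d h
  ... | true with refl ← ≡ᵇ⁻ {ℓ} {ℓ′} e = Certificate.certificate p ℓ ch num (suc den-1) cert c

  extremal-bound : ∀ {n X} → Good p n X → X ≤ extremal p n
  extremal-bound {n} (inj₁ h) = ≤-trans h (proj₁ (≤-max _ (maxTo (n ∸ (suc p + suc p)) _)))
  extremal-bound {n} {X} (inj₂ (ℓ , ρ , m<ℓ , ℓ≤n , ch , h)) =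
      ≤-trans X≤ (≤-trans (≤-reflexive (cong (λ t → side p t (n ∸ t)) (sym ℓ≡))) (≤-trans (≤-maxTo (n ∸ (suc p + suc p)) _ i i<) (proj₂ (≤-max ((p + suc p) * (n ∸ 1)) _))))
    where
    m i num den : ℕ
    m = suc p + suc p
    i = ℓ ∸ suc m
    num = proj₁ (rate p ℓ)
    den = suc (proj₂ (rate p ℓ))
    ℓ≡ : suc m + i ≡ ℓ
    ℓ≡ = m+[n∸m]≡n m<ℓ
    i< : i < n ∸ m
    i< = m+n≤o⇒m≤o∸n (suc i) (≤-trans (≤-reflexive (trans (cong suc (+-comm i m)) ℓ≡)) ℓ≤n)
    rated : den * sumTo ℓ ρ ≤ num * ℓ
    rated = lookup-sound ch (table p) (All.map (λ { {entry _ _ _ _} v → v }) (all⁻ (table p) vt)) (formula p ℓ , 5) (formula-bound ch p≥1 m<ℓ)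
    X≤ : X ≤ side p ℓ (n ∸ ℓ)
    X≤ = ≤-trans (≤-reflexive (sym (m*n/n≡m X den))) (/-monoˡ-≤ den (begin
        X * den                                  ≡⟨ *-comm X den ⟩
        den * X                                  ≤⟨ *-monoʳ-≤ den h ⟩
        den * (sumTo ℓ ρ + ℓ * (n ∸ ℓ))          ≡⟨ *-distribˡ-+ den (sumTo ℓ ρ) _ ⟩
        den * sumTo ℓ ρ + den * (ℓ * (n ∸ ℓ))    ≤⟨ +-monoˡ-≤ (den * (ℓ * (n ∸ ℓ))) rated ⟩
        num * ℓ + den * (ℓ * (n ∸ ℓ)) ∎))
      where open ≤-Reasoning

  evaluated : ∀ {n₁ n₂ X₁ X₂} → n₁ + n₂ ≡ order p → Good p n₁ X₁ → Good p n₂ X₂ → suc (X₁ + X₂ + 3 * (n₁ * n₂)) + order p ≤ order p * order p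
  evaluated {n₁} {n₂} e g₁ g₂ = ≤-trans
    (s≤s (+-monoˡ-≤ (order p) (+-mono-≤ (+-mono-≤ (extremal-bound g₁) (≤-trans (extremal-bound g₂) (≤-reflexive (cong (extremal p) n₂≡))))
       (≤-reflexive (cong (λ t → 3 * (n₁ * t)) n₂≡)))))
    (≤ᵇ⁻ {suc (extremal p n₁ + extremal p (order p ∸ n₁) + 3 * (n₁ * (order p ∸ n₁))) + order p} (allTo⁻ (suc (order p)) se n₁ (s≤s (≤-trans (m≤m+n n₁ n₂) (≤-reflexive e)))))
    where
    n₂≡ : n₂ ≡ order p ∸ n₁
    n₂≡ = sym (trans (cong (_∸ n₁) (sym e)) (m+n∸m≡n n₁ n₂))

main-inequality : ∀ p s → 3 ≤ p → s ≡ (p ∸ 3) ⊓ 660 → ∀ {n₁ n₂ X₁ X₂} → n₁ + n₂ ≡ 8 * p + 11 + s →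
  Good p n₁ X₁ → Good p n₂ X₂ → suc (X₁ + X₂ + 3 * (n₁ * n₂)) + (8 * p + 11 + s) ≤ (8 * p + 11 + s) * (8 * p + 11 + s)
main-inequality p s p≥3 es = go p p≥3 es (17 ≤? p)
  where
  s≥14 : ∀ p → 17 ≤ p → 14 ≤ (p ∸ 3) ⊓ 660
  s≥14 p h = ⊓-glb (∸-monoˡ-≤ 3 h) (m≤m+n 14 646)
  ps : ∀ p → 17 ≤ p → let s = (p ∸ 3) ⊓ 660 in 10530 * p ≤ 180 * (p * s) + 900 * (s * s) + 6900 * s + 1175
  ps p h with ≤-total (p ∸ 3) 660
  ... | inj₁ le rewrite m≤n⇒m⊓n≡m le = subst (λ q → 10530 * q ≤ 180 * (q * (q ∸ 3)) + 900 * ((q ∸ 3) * (q ∸ 3)) + 6900 * (q ∸ 3) + 1175) (m+[n∸m]≡n h)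
        (linear _ _ (1080 * (k * k) + 27150 * k + 138005) (≤-refl {0}) (l k))
    where
    k : ℕ
    k = p ∸ 17
    l : ∀ k → 10530 * (17 + k) + 0 + (1080 * (k * k) + 27150 * k + 138005) ≡ 180 * ((17 + k) * (14 + k)) + 900 * ((14 + k) * (14 + k)) + 6900 * (14 + k) + 1175 + 0
    l = solve-∀
  -- With s = 660 the single term 180ps dominates.
  ... | inj₂ ge rewrite m≥n⇒m⊓n≡n ge = begin
      10530 * p                ≤⟨ *-monoˡ-≤ p {10530} {118800} (m≤m+n 10530 108270) ⟩
      180 * 660 * p            ≡⟨ trans (*-assoc 180 660 p) (cong (180 *_) (*-comm 660 p)) ⟩
      180 * (p * 660)          ≤⟨ ≤-trans (m≤m+n _ (900 * (660 * 660))) (≤-trans (m≤m+n _ (6900 * 660)) (m≤m+n _ 1175)) ⟩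
      180 * (p * 660) + 900 * (660 * 660) + 6900 * 660 + 1175 ∎
    where open ≤-Reasoning
  Claim : ℕ → ℕ → Set
  Claim p s = ∀ {n₁ n₂ X₁ X₂} → n₁ + n₂ ≡ 8 * p + 11 + s →
    Good p n₁ X₁ → Good p n₂ X₂ → suc (X₁ + X₂ + 3 * (n₁ * n₂)) + (8 * p + 11 + s) ≤ (8 * p + 11 + s) * (8 * p + 11 + s)
  go : ∀ p → 3 ≤ p → ∀ {s} → s ≡ (p ∸ 3) ⊓ 660 → Dec (17 ≤ p) → Claim p s
  go p p≥3 refl (yes h) = Large.large p ((p ∸ 3) ⊓ 660) h (s≥14 p h) (ps p h)
  go p p≥3 refl (no n) = subst (Claim p) (sym (m≤n⇒m⊓n≡m (≤-trans (<⇒≤ q<14) (m≤m+n 14 646))))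
    (Evaluated.evaluated p (≤-trans (s≤s z≤n) p≥3) (proj₁ (∧⁻ {valid-table p} {sparse-enough p} checked)) (proj₂ (∧⁻ {valid-table p} {sparse-enough p} checked)))
    where
    checks : ℕ → Bool
    checks p = valid-table p ∧ sparse-enough p
    q<14 : p ∸ 3 < 14
    q<14 = +-cancelˡ-< 3 _ _ (≤-trans (≤-reflexive (cong suc (m+[n∸m]≡n p≥3))) (≰⇒> n))
    checked : checks p ≡ true
    -- The `refl` evaluates the certificates and the final inequality for p = 3, ..., 16.
    checked = subst (λ p → checks p ≡ true) (m+[n∸m]≡n p≥3) (allTo⁻ 14 {λ q → checks (3 + q)} refl (p ∸ 3) q<14)

-- Goodman's count of triangles.

Pair : Set
Pair = Maybe Bool

is : Bool → Pair → Bool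
is b nothing = false
is true (just c) = c
is false (just c) = not c

-- A monochromatic triangle has no corner at which both colours meet, any other triangle exactly
-- two. `nothing` marks a pair of equal vertices; the other two pairs then agree by hypothesis and
-- both sides vanish, so the identity may be summed over all triples.
triangle-count : ∀ p q r → (p ≡ nothing → q ≡ r) → (q ≡ nothing → p ≡ r) → (r ≡ nothing → p ≡ q) →
  let R = λ s → ⟦ is true s ⟧ ; B = λ s → ⟦ is false s ⟧ ; δ = λ s → R s + B s in
  2 * (R p * (R q * R r) + B p * (B q * B r)) + ((R p * B q + B p * R q) + ((R p * B r + B p * R r) + (R q * B r + B q * R r)))
    ≡ 2 * (δ p * (δ q * δ r))
triangle-count nothing q r h _ _ rewrite h refl = neutral r
  where
  neutral : ∀ r → ⟦ is true r ⟧ * ⟦ is false r ⟧ + ⟦ is false r ⟧ * ⟦ is true r ⟧ ≡ 0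
  neutral nothing = refl
  neutral (just true) = refl
  neutral (just false) = refl
triangle-count (just a) nothing r _ h _ rewrite sym (h refl) with a
... | true = refl
... | false = refl
triangle-count (just a) (just b) nothing _ _ h with h refl
... | refl with a
...   | true = refl
...   | false = refl
triangle-count (just true) (just true) (just true) _ _ _ = refl
triangle-count (just true) (just true) (just false) _ _ _ = refl
triangle-count (just true) (just false) (just true) _ _ _ = refl
triangle-count (just true) (just false) (just false) _ _ _ = refl
triangle-count (just false) (just true) (just true) _ _ _ = refl
triangle-count (just false) (just true) (just false) _ _ _ = refl
triangle-count (just false) (just false) (just true) _ _ _ = refl
triangle-count (just false) (just false) (just false) _ _ _ = refl

∑-* : ∀ {X : Set} (xs : List X) k f → k * ∑ xs f ≡ ∑ xs (λ x → k * f x)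
∑-* [] k f = *-zeroʳ k
∑-* (x ∷ xs) k f = trans (*-distribˡ-+ k (f x) _) (cong (k * f x +_) (∑-* xs k f))

∑-filter : ∀ {X : Set} (p : X → Bool) xs f → ∑ (filterᵇ p xs) f ≡ ∑ xs (λ x → ⟦ p x ⟧ * f x)
∑-filter p [] f = refl
∑-filter p (x ∷ xs) f with p x
... | true = cong₂ _+_ (sym (+-identityʳ (f x))) (∑-filter p xs f)
... | false = ∑-filter p xs f

length-∑ : ∀ {X : Set} (xs : List X) → length xs ≡ ∑ xs (λ _ → 1)
length-∑ [] = refl
length-∑ (x ∷ xs) = cong suc (length-∑ xs)

module Coloured {N : ℕ} (c : Colouring N) where

  V : Set
  V = Fin N

  pair : V → V → Pair
  pair x y with x FP.≟ y
  ... | yes _ = nothing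
  ... | no _ = just (col c x y)

  pair-sym : ∀ x y → pair x y ≡ pair y x
  pair-sym x y with x FP.≟ y | y FP.≟ x
  ... | yes _ | yes _ = refl
  ... | yes e | no n = ⊥-elim (n (sym e))
  ... | no n | yes e = ⊥-elim (n (sym e))
  ... | no _ | no _ = cong just (Colouring.sym c x y)

  pair-nothing : ∀ {x y} → pair x y ≡ nothing → x ≡ y
  pair-nothing {x} {y} e with x FP.≟ y
  ... | yes p = p

  pair-self : ∀ x → pair x x ≡ nothing
  pair-self x with x FP.≟ x
  ... | yes _ = refl
  ... | no n = ⊥-elim (n refl)

  G : Bool → Rel
  G b x y = is b (pair x y)

  G-sym : ∀ b → Symm (G b)
  G-sym b x y = cong (is b) (pair-sym x y)

  G-irr : ∀ b → Irr (G b)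
  G-irr b x rewrite pair-self x = refl

  G-col : ∀ b {x y} → G b x y ≡ true → col c x y ≡ b
  G-col b {x} {y} e with x FP.≟ y
  G-col true e | no _ = e
  G-col false {x} {y} e | no _ with col c x y
  ... | false = refl

  vertices : List V
  vertices = allFin N

  nbrs : Bool → V → List V
  nbrs b v = filterᵇ (G b v) vertices

  deg : Bool → V → ℕ
  deg b v = ∑ vertices (λ x → ⟦ G b v x ⟧)

  length-nbrs : ∀ b v → length (nbrs b v) ≡ deg b v
  length-nbrs b v = trans (length-∑ (nbrs b v)) (trans (∑-filter (G b v) vertices _) (∑-cong vertices (λ _ → *-identityʳ _)))

  nbrs-unique : ∀ b v → Unique (nbrs b v)
  nbrs-unique b v = filter⁺ (T? ∘ G b v) (allFin⁺ N)

  nbrs-G : ∀ b v {x} → x ∈ nbrs b v → G b v x ≡ true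
  nbrs-G b v x∈ = Equivalence.to T-≡ (proj₂ (∈-filter⁻ (T? ∘ G b v) {xs = vertices} x∈))

  δ : V → V → ℕ
  δ x y = ⟦ G true x y ⟧ + ⟦ G false x y ⟧

  mono : V → ℕ
  mono v = E (G true) (nbrs true v) (nbrs true v) + E (G false) (nbrs false v) (nbrs false v)

  E-nbrs : ∀ b v → E (G b) (nbrs b v) (nbrs b v) ≡ ∑ vertices (λ x → ∑ vertices (λ y → ⟦ G b v x ⟧ * (⟦ G b v y ⟧ * ⟦ G b x y ⟧)))
  E-nbrs b v = trans (∑-filter (G b v) vertices _) (∑-cong vertices (λ {x} _ → trans (cong (⟦ G b v x ⟧ *_) (∑-filter (G b v) vertices _)) (∑-* vertices ⟦ G b v x ⟧ _)))

  single : ∀ v → ∑ vertices (λ x → ⟦ does (v FP.≟ x) ⟧) ≡ 1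
  single v with zs , p ← ∈-↭ (∈-allFin v) = trans (∑-↭ _ p) (cong₂ _+_ self (∑-zero zs rest))
    where
    self : ⟦ does (v FP.≟ v) ⟧ ≡ 1
    self with v FP.≟ v
    ... | yes _ = refl
    ... | no n = ⊥-elim (n refl)
    rest : ∀ {x} → x ∈ zs → ⟦ does (v FP.≟ x) ⟧ ≡ 0
    rest {x} x∈ with v FP.≟ x
    ... | yes refl = ⊥-elim (∉-head (Unique-↭ p (allFin⁺ N)) x∈)
    ... | no _ = refl

  δ-eq : ∀ x y → δ x y + ⟦ does (x FP.≟ y) ⟧ ≡ 1
  δ-eq x y with x FP.≟ y
  ... | yes _ = refl
  ... | no _ with col c x y
  ...   | true = refl
  ...   | false = refl

  degrees : ∀ v → deg true v + deg false v + 1 ≡ N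
  degrees v = begin
    deg true v + deg false v + 1                             ≡⟨ cong₂ _+_ (sym (∑-+ vertices _ _)) (sym (single v)) ⟩
    ∑ vertices (δ v) + ∑ vertices (λ x → ⟦ does (v FP.≟ x) ⟧)          ≡⟨ sym (∑-+ vertices _ _) ⟩
    ∑ vertices (λ x → δ v x + ⟦ does (v FP.≟ x) ⟧)                ≡⟨ ∑-cong vertices (λ {x} _ → δ-eq v x) ⟩
    ∑ vertices (λ _ → 1)                                          ≡⟨ sym (length-∑ vertices) ⟩
    length vertices                                               ≡⟨ length-tabulate id ⟩
    N ∎
    where open ≡-Reasoning

  ∑³ : (V → V → V → ℕ) → ℕ
  ∑³ f = ∑ vertices (λ v → ∑ vertices (λ x → ∑ vertices (λ y → f v x y)))

  ∑³-cong : ∀ {f g} → (∀ v x y → f v x y ≡ g v x y) → ∑³ f ≡ ∑³ g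
  ∑³-cong h = ∑-cong vertices (λ _ → ∑-cong vertices (λ _ → ∑-cong vertices (λ _ → h _ _ _)))

  ∑³-+ : ∀ f g → ∑³ (λ v x y → f v x y + g v x y) ≡ ∑³ f + ∑³ g
  ∑³-+ f g = trans (∑-cong vertices (λ _ → trans (∑-cong vertices (λ _ → ∑-+ vertices _ _)) (∑-+ vertices _ _))) (∑-+ vertices _ _)

  ∑³-* : ∀ k f → k * ∑³ f ≡ ∑³ (λ v x y → k * f v x y)
  ∑³-* k f = trans (∑-* vertices k _) (∑-cong vertices (λ _ → trans (∑-* vertices k _) (∑-cong vertices (λ _ → ∑-* vertices k _))))

  ∑-mul : ∀ f g → ∑ vertices (λ x → ∑ vertices (λ y → f x * g y)) ≡ ∑ vertices f * ∑ vertices g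
  ∑-mul f g = trans (∑-cong vertices (λ {x} _ → sym (∑-* vertices (f x) g))) (trans (∑-cong vertices (λ {x} _ → *-comm (f x) _)) (trans (sym (∑-* vertices (∑ vertices g) f)) (*-comm _ (∑ vertices f))))

  mixed : V → V → V → ℕ
  mixed v x y = ⟦ G true v x ⟧ * ⟦ G false v y ⟧ + ⟦ G false v x ⟧ * ⟦ G true v y ⟧

  ∑-mixed : ∑³ mixed ≡ ∑ vertices (λ v → 2 * (deg true v * deg false v))
  ∑-mixed = ∑-cong vertices (λ {v} _ → trans (∑-cong vertices (λ _ → ∑-+ vertices _ _)) (trans (∑-+ vertices _ _)
     (trans (cong₂ _+_ (∑-mul _ _) (∑-mul _ _)) (lem (deg true v) (deg false v)))))
    where lem : ∀ a b → a * b + b * a ≡ 2 * (a * b)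
          lem = solve-∀

  mono³ : V → V → V → ℕ
  mono³ v x y = ⟦ G true v x ⟧ * (⟦ G true v y ⟧ * ⟦ G true x y ⟧) + ⟦ G false v x ⟧ * (⟦ G false v y ⟧ * ⟦ G false x y ⟧)

  ∑-mono³ : ∑³ mono³ ≡ ∑ vertices mono
  ∑-mono³ = ∑-cong vertices (λ {v} _ → trans (∑-cong vertices (λ _ → ∑-+ vertices _ _)) (trans (∑-+ vertices _ _) (sym (cong₂ _+_ (E-nbrs true v) (E-nbrs false v)))))

  pointwise : ∀ v x y → 2 * mono³ v x y + (mixed v x y + (mixed x v y + mixed y v x)) ≡ 2 * (δ v x * (δ v y * δ x y))
  pointwise v x y = trans (cong₂ (λ s t → 2 * mono³ v x y + (mixed v x y + (s + t)))
        (cong₂ (λ a b → ⟦ is true a ⟧ * ⟦ G false x y ⟧ + ⟦ is false b ⟧ * ⟦ G true x y ⟧) (pair-sym x v) (pair-sym x v))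
        (trans (cong₂ (λ a b → ⟦ is true a ⟧ * ⟦ is false b ⟧ + ⟦ is false a ⟧ * ⟦ is true b ⟧) (pair-sym y v) (pair-sym y x)) refl))
     (triangle-count (pair v x) (pair v y) (pair x y)
       (λ e → cong (λ t → pair t y) (pair-nothing e))
       (λ e → trans (pair-sym v x) (cong (pair x) (pair-nothing e)))
       (λ e → cong (pair v) (pair-nothing e)))

  swap₁₂ : ∀ f → ∑³ (λ v x y → f x v y) ≡ ∑³ f
  swap₁₂ f = ∑-swap vertices vertices (λ v x → ∑ vertices (λ y → f x v y))

  swap₁₃ : ∀ f → ∑³ (λ v x y → f y v x) ≡ ∑³ f
  swap₁₃ f = trans (∑-cong vertices (λ {v} _ → ∑-swap vertices vertices (λ x y → f y v x))) (swap₁₂ f)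

  -- Of the pairs of vertices different from `v`, only those with x = y are lost.
  distinct-triples : ∀ v → ∑ vertices (δ v) * ∑ vertices (δ v) ≤ ∑ vertices (λ x → ∑ vertices (λ y → δ v x * (δ v y * δ x y))) + ∑ vertices (δ v)
  distinct-triples v = begin
    ∑ vertices (δ v) * ∑ vertices (δ v)                                ≡⟨ sym (∑-mul (δ v) (δ v)) ⟩
    ∑ vertices (λ x → ∑ vertices (λ y → δ v x * δ v y))                ≤⟨ ∑-mono vertices (λ {x} _ → ∑-mono vertices (λ {y} _ → step x y)) ⟩
    ∑ vertices (λ x → ∑ vertices (λ y → δ v x * (δ v y * δ x y) + δ v x * ⟦ does (x FP.≟ y) ⟧))
                                                             ≡⟨ trans (∑-cong vertices (λ {x} _ → trans (∑-+ vertices _ _) (cong (∑ vertices (λ y → δ v x * (δ v y * δ x y)) +_) (trans (sym (∑-* vertices (δ v x) _)) (trans (cong (δ v x *_) (single x)) (*-identityʳ _)))))) (∑-+ vertices _ _) ⟩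
    ∑ vertices (λ x → ∑ vertices (λ y → δ v x * (δ v y * δ x y))) + ∑ vertices (δ v) ∎
    where
    open ≤-Reasoning
    δ≤1 : ∀ x y → δ x y ≤ 1
    δ≤1 x y = ≤-trans (m≤m+n _ _) (≤-reflexive (δ-eq x y))
    step : ∀ x y → δ v x * δ v y ≤ δ v x * (δ v y * δ x y) + δ v x * ⟦ does (x FP.≟ y) ⟧
    step x y = ≤-trans (*-monoʳ-≤ (δ v x) (begin
        δ v y                                            ≡⟨ sym (*-identityʳ _) ⟩
        δ v y * 1                                        ≡⟨ cong (δ v y *_) (sym (δ-eq x y)) ⟩
        δ v y * (δ x y + ⟦ does (x FP.≟ y) ⟧)            ≡⟨ *-distribˡ-+ (δ v y) _ _ ⟩
        δ v y * δ x y + δ v y * ⟦ does (x FP.≟ y) ⟧      ≤⟨ +-monoʳ-≤ (δ v y * δ x y) (≤-trans (*-monoˡ-≤ ⟦ does (x FP.≟ y) ⟧ (δ≤1 v y)) (≤-reflexive (+-identityʳ _))) ⟩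
        δ v y * δ x y + ⟦ does (x FP.≟ y) ⟧ ∎)) (≤-reflexive (*-distribˡ-+ (δ v x) _ _))

  -- Summed over all vertices, `mono v` plus three times the product of the two degrees is ND(D -
  -- 1), while the hypothesis bounds that sum by N less.
  goodman : ∀ D → N ≡ suc D → ∑ vertices (λ v → suc (mono v + 3 * (deg true v * deg false v)) + D) ≤ N * (D * D) → ⊥
  goodman D N≡ h = 1+n≰n (≤-trans (≤-trans (≤-reflexive (sym N≡)) N≤) z≤n)
    where
    ∑δ : ∀ v → ∑ vertices (δ v) ≡ D
    ∑δ v = suc-injective (trans (+-comm 1 _) (trans (cong (_+ 1) (∑-+ vertices _ _)) (trans (degrees v) N≡)))
    M P Δ : ℕ
    M = ∑ vertices mono
    P = ∑ vertices (λ v → deg true v * deg false v)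
    Δ = ∑³ (λ v x y → δ v x * (δ v y * δ x y))
    const : ∀ k → ∑ vertices (λ _ → k) ≡ N * k
    const k = trans (∑-const vertices k) (cong (_* k) (length-tabulate {n = N} id))
    triples : 2 * M + 3 * (2 * P) ≡ 2 * Δ
    triples = begin
      2 * M + 3 * (2 * P)
        ≡⟨ cong₂ (λ s t → 2 * s + 3 * t) (sym ∑-mono³) (trans (∑-* vertices 2 _) (sym ∑-mixed)) ⟩
      2 * ∑³ mono³ + 3 * ∑³ mixed
        ≡⟨ lem (2 * ∑³ mono³) (∑³ mixed) ⟩
      2 * ∑³ mono³ + (∑³ mixed + (∑³ mixed + ∑³ mixed))
        ≡⟨ cong₂ (λ s t → s + (∑³ mixed + t)) (∑³-* 2 mono³) (cong₂ _+_ (sym (swap₁₂ mixed)) (sym (swap₁₃ mixed))) ⟩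
      ∑³ (λ v x y → 2 * mono³ v x y) + (∑³ mixed + (∑³ (λ v x y → mixed x v y) + ∑³ (λ v x y → mixed y v x)))
        ≡⟨ cong (λ t → ∑³ (λ v x y → 2 * mono³ v x y) + (∑³ mixed + t)) (sym (∑³-+ (λ v x y → mixed x v y) (λ v x y → mixed y v x))) ⟩
      ∑³ (λ v x y → 2 * mono³ v x y) + (∑³ mixed + ∑³ (λ v x y → mixed x v y + mixed y v x))
        ≡⟨ cong (∑³ (λ v x y → 2 * mono³ v x y) +_) (sym (∑³-+ mixed (λ v x y → mixed x v y + mixed y v x))) ⟩
      ∑³ (λ v x y → 2 * mono³ v x y) + ∑³ (λ v x y → mixed v x y + (mixed x v y + mixed y v x))
        ≡⟨ sym (∑³-+ (λ v x y → 2 * mono³ v x y) (λ v x y → mixed v x y + (mixed x v y + mixed y v x))) ⟩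
      ∑³ (λ v x y → 2 * mono³ v x y + (mixed v x y + (mixed x v y + mixed y v x)))
        ≡⟨ ∑³-cong pointwise ⟩
      ∑³ (λ v x y → 2 * (δ v x * (δ v y * δ x y)))
        ≡⟨ sym (∑³-* 2 (λ v x y → δ v x * (δ v y * δ x y))) ⟩
      2 * Δ ∎
      where
      open ≡-Reasoning
      lem : ∀ a b → a + 3 * b ≡ a + (b + (b + b))
      lem = solve-∀
    Δ≥ : N * (D * D) ≤ Δ + N * D
    Δ≥ = begin
      N * (D * D)                                      ≡⟨ sym (const (D * D)) ⟩
      ∑ vertices (λ _ → D * D)                              ≤⟨ ∑-mono vertices (λ {v} _ → subst (λ t → t * t ≤ ∑ vertices (λ x → ∑ vertices (λ y → δ v x * (δ v y * δ x y))) + t) (∑δ v) (distinct-triples v)) ⟩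
      ∑ vertices (λ v → ∑ vertices (λ x → ∑ vertices (λ y → δ v x * (δ v y * δ x y))) + D) ≡⟨ trans (∑-+ vertices _ _) (cong (Δ +_) (const D)) ⟩
      Δ + N * D ∎
      where open ≤-Reasoning
    h′ : N + (M + 3 * P) + N * D ≤ N * (D * D)
    h′ = ≤-trans (≤-reflexive (sym (begin
      ∑ vertices (λ v → suc (mono v + 3 * (deg true v * deg false v)) + D)
        ≡⟨ ∑-+ vertices (λ v → suc (mono v + 3 * (deg true v * deg false v))) (λ _ → D) ⟩
      ∑ vertices (λ v → 1 + (mono v + 3 * (deg true v * deg false v))) + ∑ vertices (λ _ → D)
        ≡⟨ cong₂ _+_ (∑-+ vertices (λ _ → 1) (λ v → mono v + 3 * (deg true v * deg false v))) (const D) ⟩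
      ∑ vertices (λ _ → 1) + ∑ vertices (λ v → mono v + 3 * (deg true v * deg false v)) + N * D
        ≡⟨ cong₂ (λ s t → s + t + N * D) (trans (const 1) (*-identityʳ N)) (trans (∑-+ vertices mono (λ v → 3 * (deg true v * deg false v))) (cong (M +_) (sym (∑-* vertices 3 (λ v → deg true v * deg false v))))) ⟩
      N + (M + 3 * P) + N * D ∎))) h
      where open ≡-Reasoning
    N≤ : N ≤ 0
    N≤ = *-cancelˡ-≤ 2 (linear (2 * N) (2 * 0) 0 (+-mono-≤ (+-mono-≤ (*-monoʳ-≤ 2 h′) (*-monoʳ-≤ 2 Δ≥)) (≤-reflexive (sym triples)))
           (lem N M P Δ (N * D) (N * (D * D))))
      where
      lem : ∀ N M P Δ a b → 2 * N + (2 * b + 2 * (Δ + a) + (2 * M + 3 * (2 * P))) + 0 ≡ 2 * 0 + (2 * (N + (M + 3 * P) + a) + 2 * b + 2 * Δ)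
      lem = solve-∀

-- From cycles to wheels, and the theorem.

module _ {N : ℕ} (c : Colouring N) where
  open Coloured c

  -- The hub 0 goes to `v` and the rim, numbered from 1, to the cycle; distinctness holds because
  -- `v` is not its own neighbour.
  wheel : ∀ b m v L → Cycle-in (G b) (nbrs b v) L → length L ≡ m → 1 ≤ m →
          Σ (Fin (suc m) → V) λ f → Injective _≡_ _≡_ f × (∀ x y → WheelAdj (suc m) x y → col c (f x) (f y) ≡ b)
  wheel b m v [] cy refl ()
  wheel b m v L@(x₀ ∷ xs) (cy , u , L⊆) refl _ = f , inj , adj
    where
    f : Fin (suc m) → V
    f i = at x₀ (v ∷ L) (toℕ i)
    v∉L : v ∉ L
    v∉L v∈ with trans (sym (nbrs-G b v (L⊆ v∈))) (G-irr b v)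
    ... | ()
    uvL : Unique (v ∷ L)
    uvL = Unique-cons v∉L u
    inj : Injective _≡_ _≡_ f
    inj {i} {k} e with <-cmp (toℕ i) (toℕ k)
    ... | tri< l _ _ = ⊥-elim (at-inj x₀ (v ∷ L) uvL (toℕ i) (toℕ k) l (FP.toℕ<n k) e)
    ... | tri≈ _ q _ = FP.toℕ-injective q
    ... | tri> _ _ g = ⊥-elim (at-inj x₀ (v ∷ L) uvL (toℕ k) (toℕ i) g (FP.toℕ<n i) (sym e))
    P : ℕ → ℕ → Set
    P i k = G b (at x₀ (v ∷ L) i) (at x₀ (v ∷ L) k) ≡ true
    P-sym : ∀ i k → P i k → P k i
    P-sym i k p = trans (G-sym b (at x₀ (v ∷ L) k) (at x₀ (v ∷ L) i)) p
    spoke : ∀ k → k ≢ 0 → k < suc m → P 0 k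
    spoke zero n _ = ⊥-elim (n refl)
    spoke (suc k) _ (s≤s h) = nbrs-G b v (L⊆ (at-∈ x₀ L k h))
    step : ∀ k → k ≢ 0 → suc k < suc m → P k (suc k)
    step zero n _ = ⊥-elim (n refl)
    step (suc k) _ (s≤s h) = at-Seg xs cy k (≤-trans (n≤1+n k) (≤-pred h))
    closing : P m 1
    closing = subst (λ t → G b (at x₀ L (length xs)) t ≡ true) (at-end x₀ xs) (at-Seg xs cy (length xs) ≤-refl)
    edge : ∀ i k → i < suc m → k < suc m → i ≢ 0 → k ≢ 0 → CycAdj m i k → P i k
    edge i k i< k< i≢ k≢ (inj₁ refl) = step i i≢ k<
    edge i k i< k< i≢ k≢ (inj₂ (inj₁ refl)) = P-sym k i (step k k≢ i<)
    edge i k i< k< i≢ k≢ (inj₂ (inj₂ (inj₁ (refl , refl)))) = P-sym m 1 closing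
    edge i k i< k< i≢ k≢ (inj₂ (inj₂ (inj₂ (refl , refl)))) = closing
    adjP : ∀ i k → i < suc m → k < suc m → ((i ≡ 0 × k ≢ 0) ⊎ (i ≢ 0 × k ≡ 0) ⊎ (i ≢ 0 × k ≢ 0 × CycAdj m i k)) → P i k
    adjP i k i< k< (inj₁ (refl , n)) = spoke k n k<
    adjP i k i< k< (inj₂ (inj₁ (n , refl))) = P-sym 0 i (spoke i n i<)
    adjP i k i< k< (inj₂ (inj₂ (n , n′ , a))) = edge i k i< k< n n′ a
    adj : ∀ x y → WheelAdj (suc m) x y → col c (f x) (f y) ≡ b
    adj x y a = G-col b (adjP (toℕ x) (toℕ y) (FP.toℕ<n x) (FP.toℕ<n y) a)

search : ∀ {N} k {Q : Vec (Fin N) k → Set} → (∀ xs → Dec (Q xs)) → Dec (∃ Q)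
search zero q = map′ ([] ,_) (λ { ([] , h) → h }) (q [])
search (suc k) q = map′ (λ { (x , xs , h) → x ∷ xs , h }) (λ { (x ∷ xs , h) → x , xs , h }) (FP.any? (λ x → search k (λ xs → q (x ∷ xs))))

cycAdj? : ∀ m a b → Dec (CycAdj m a b)
cycAdj? m a b = (b ≟ suc a) ⊎-dec ((a ≟ suc b) ⊎-dec (((a ≟ 1) ×-dec (b ≟ m)) ⊎-dec ((a ≟ m) ×-dec (b ≟ 1))))

wheelAdj? : ∀ n (x y : Fin n) → Dec (WheelAdj n x y)
wheelAdj? n x y = ((toℕ x ≟ 0) ×-dec ¬? (toℕ y ≟ 0)) ⊎-dec ((¬? (toℕ x ≟ 0) ×-dec (toℕ y ≟ 0))
  ⊎-dec (¬? (toℕ x ≟ 0) ×-dec (¬? (toℕ y ≟ 0) ×-dec cycAdj? (n ∸ 1) (toℕ x) (toℕ y))))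

-- The argument only refutes the absence of wheels in both colours, whereas the Ramsey property asks
-- for one of them; exhaustive search over all maps closes the gap.
monoCopy? : ∀ n {N} (c : Colouring N) b → Dec (MonoCopy (Wheel n) c b)
monoCopy? n {N} c b = map′ (λ { (xs , i , a) → Vec.lookup xs , (λ {x} {y} → i x y) , a })
    (λ { (f , i , a) → Vec.tabulate f ,
       (λ x y e → i (trans (sym (lookup∘tabulate f x)) (trans e (lookup∘tabulate f y)))) ,
       (λ x y w → trans (cong₂ (col c) (lookup∘tabulate f x) (lookup∘tabulate f y)) (a x y w)) })
    (search n λ xs → (FP.all? λ x → FP.all? λ y → (Vec.lookup xs x FP.≟ Vec.lookup xs y) →-dec (x FP.≟ y))
      ×-dec (FP.all? λ x → FP.all? λ y → wheelAdj? n x y →-dec (col c (Vec.lookup xs x) (Vec.lookup xs y) Bool.≟ b)))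

ramsey : ∀ p → 3 ≤ p → RamseyProperty (Wheel (suc (suc p + suc p))) (Wheel (suc (suc p + suc p))) (suc (8 * p + 11 + (p ∸ 3) ⊓ 660))
ramsey p p≥3 c with monoCopy? (suc (suc p + suc p)) c red | monoCopy? (suc (suc p + suc p)) c blue
... | yes r | _ = inj₁ r
... | no _ | yes b = inj₂ b
... | no nr | no nb = ⊥-elim (goodman D refl (≤-trans (∑-bound vertices (D * D) (λ {v} _ → at-vertex v)) (≤-reflexive (cong (_* (D * D)) (length-tabulate {n = suc D} id)))))
  where
  open Coloured c
  D m : ℕ
  D = 8 * p + 11 + (p ∸ 3) ⊓ 660
  m = suc p + suc p
  none : ∀ b → ¬ MonoCopy (Wheel (suc m)) c b → ∀ v L → Cycle-in (G b) (nbrs b v) L → length L ≢ m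
  none b n v L cy e = n (wheel c b m v L cy e (s≤s z≤n))
  good : ∀ b → ¬ MonoCopy (Wheel (suc m)) c b → ∀ v → ¬ ¬ Good p (deg b v) (E (G b) (nbrs b v) (nbrs b v))
  good b n v k = degree-sum (G-sym b) (G-irr b) (nbrs b v) (nbrs-unique b v) (none b n v)
    (λ g → k (subst (λ d → Good p d (E (G b) (nbrs b v) (nbrs b v))) (length-nbrs b v) g))
  at-vertex : ∀ v → suc (mono v + 3 * (deg true v * deg false v)) + D ≤ D * D
  at-vertex v = decidable-stable (_ ≤? _) λ ng → good red nr v λ g₁ → good blue nb v λ g₂ →
    ng (main-inequality p ((p ∸ 3) ⊓ 660) p≥3 refl (suc-injective (trans (+-comm 1 _) (degrees v))) g₁ g₂)

odd-form : ∀ n → 9 ≤ n → ¬ (2 ∣ n) → ∃[ p ] (3 ≤ p × n ≡ suc (suc p + suc p))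
odd-form n n≥9 odd with half n
... | k , a , b with m≤n⇒m<n∨m≡n a
...   | inj₂ e = ⊥-elim (odd (divides k (trans (sym e) (*-comm 2 k))))
...   | inj₁ lt = go k (≤-antisym b lt) n≥9
  where
  go : ∀ k → n ≡ suc (2 * k) → 9 ≤ n → ∃[ p ] (3 ≤ p × n ≡ suc (suc p + suc p))
  go zero refl (s≤s ())
  go (suc p) e h = p , ≤-pred (*-cancelˡ-≤ 2 (≤-pred (≤-trans h (≤-reflexive e)))) , trans e (cong (λ t → suc (suc p + t)) (+-identityʳ (suc p)))

theorem10 : (n : ℕ) → 9 ≤ n → ¬ (2 ∣ n) →
    RamseyLE (Wheel n) (Wheel n) (4 * n + (((n ∸ 9) / 2) ⊓ 660))
theorem10 n n≥9 odd with p , p≥3 , refl ← odd-form n n≥9 odd =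
  suc (8 * p + 11 + (p ∸ 3) ⊓ 660) , s≤s z≤n , ≤-reflexive size , ramsey p p≥3
  where
  third : ∀ p → 3 ≤ p → (suc (suc p + suc p) ∸ 9) / 2 ≡ p ∸ 3
  third (suc zero) (s≤s ())
  third (suc (suc zero)) (s≤s (s≤s ()))
  third (suc (suc (suc q))) _ = trans (cong (_/ 2) (trans (cong (_∸ 9) (l q)) (m+n∸n≡m (q * 2) 9))) (m*n/n≡m q 2)
    where l : ∀ q → suc (suc (3 + q) + suc (3 + q)) ≡ q * 2 + 9
          l = solve-∀
  size : suc (8 * p + 11 + (p ∸ 3) ⊓ 660) ≡ 4 * suc (suc p + suc p) + (((suc (suc p + suc p) ∸ 9) / 2) ⊓ 660)
  size = trans (cong (_+ (p ∸ 3) ⊓ 660) (l p)) (cong (λ t → 4 * suc (suc p + suc p) + t ⊓ 660) (sym (third p p≥3)))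
    where l : ∀ p → suc (8 * p + 11) ≡ 4 * suc (suc p + suc p)
          l = solve-∀
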